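{- Let $W$ be a finite Coxeter group, $c$ a standard Coxeter element, and $w\in W$. There exists a chain $\vec\pi\in\mathsf{MC}(W,c)$ such that $w\in\omega_\downarrow(\vec\pi)\vec\pi=\{\omega_\downarrow(\vec\pi)\pi:\pi\in\vec\pi\}$ if and only if $w^{ -1}$ is $c^{ -1}$-sortable.
   Context: $W$ is a finite Coxeter group of rank $r$ with simple reflections $S$ and reflections $T$; $\ell_S,\ell_T$ denote lengths. Bruhat order covers: $u\lessdot_{\mathrm B}v$ iff $v=ut$, $t\in T$, $\ell_S(v)=\ell_S(u)+1$. Absolute order: $u\leq_T v$ iff $\ell_T(u)+\ell_T(u^{ -1}v)=\ell_T(v)$. A standard Coxeter element $c$ is a product of all elements of $S$ each once. $W_c^+=\{u:\ell_S(uc)=\ell_S(u)+r\}$. $\mathsf{MC}(W,c)$ is the set of maximal chains $\vec\pi=\{e=\pi_0\lessdot_T\cdots\lessdot_T\pi_r=c\}$ in $[e,c]_T$. $u\in W_c^+$ and $\vec\pi$ are concordant if $u\pi_0\leq_{\mathrm B}\cdots\leq_{\mathrm B}u\pi_r$. Left weak order: $u\leq_L v$ iff some reduced $S$-word of $v$ has a reduced word of $u$ as a suffix. For each $\vec\pi$, the set of $u\in W_c^+$ concordant with $\vec\pi$ is a nonempty interval of the left weak order; $\omega_\downarrow(\vec\pi)$ denotes its minimum. Sortability: for a standard Coxeter element $c'$ with a fixed reduced $S$-word $\mathsf c'$, the $c'$-sorting word of $w$ is the lexicographically first (by positions) subword of $\mathsf c'\mathsf c'\mathsf c'\cdots$ that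 is a reduced $S$-word for $w$; letting $I^{(k)}(w)$ be the set of letters of the $k$-th copy of $\mathsf c'$ used by it, $w$ is $c'$-sortable if $I^{(1)}(w)\supseteq I^{(2)}(w)\supseteq I^{(3)}(w)\supseteq\cdots$ (independent of the choice of $\mathsf c'$). -}

module Defs where

open import Level using (0ℓ)
open import Data.Nat using (ℕ; zero; suc; _+_; _≤_; _<_)
open import Data.Fin using (Fin; toℕ; fromℕ; inject₁)
open import Data.List using (List; []; _∷_; _++_; foldr; map; length; allFin; lookup)
open import Data.List.Membership.Propositional using (_∈_)
open import Data.List.Relation.Unary.All using (All)
open import Data.List.Relation.Unary.Linked using (Linked)
open import Data.List.Relation.Binary.Permutation.Propositional using (_↭_)
open import Data.Product using (Σ; ∃; _×_; _,_)
open import Data.Sum using (_⊎_)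
open import Data.Empty using (⊥)
open import Data.Unit using (⊤)
open import Relation.Binary.PropositionalEquality using (_≡_; _≢_)
open import Relation.Binary.Construct.Closure.ReflexiveTransitive using (Star)
open import Algebra.Bundles using (Group)

gpow : (H : Group 0ℓ 0ℓ) → Group.Carrier H → ℕ → Group.Carrier H
gpow H x zero    = Group.ε H
gpow H x (suc n) = Group._∙_ H x (gpow H x n)

record FinGroup : Set₁ where
  infixl 7 _·_
  field
    W       : Set
    _·_     : W → W → W
    e       : W
    _⁻¹     : W → W
    assoc   : ∀ x y z → (x · y) · z ≡ x · (y · z)
    identityˡ : ∀ x → e · x ≡ x
    identityʳ : ∀ x → x · e ≡ x
    inverseˡ  : ∀ x → (x ⁻¹) · x ≡ e
    inverseʳ  : ∀ x → x · (x ⁻¹) ≡ e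
    enum     : List W
    complete : ∀ x → x ∈ enum

  pow : W → ℕ → W
  pow x zero    = e
  pow x (suc n) = x · pow x n

  prod : List W → W
  prod = foldr _·_ e

-- A finite Coxeter system (W , S) with S = {gen i | i : Fin rank}.
-- (W,S) is Coxeter: W is presented by generators S and the relations
-- (s t)^{m(s,t)} = e, m(s,t) the order of s t; expressed by the universal
-- property of the presentation (into every group).

record CoxeterSystem : Set₁ where
  field
    grp  : FinGroup
  open FinGroup grp public
  field
    rank : ℕ
    gen  : Fin rank → W
    gen-injective  : ∀ i j → gen i ≡ gen j → i ≡ j
    gen-nontrivial : ∀ i → gen i ≢ e
    gen-involution : ∀ i → gen i · gen i ≡ e
    generates : ∀ w → ∃ λ (ws : List (Fin rank)) → prod (map gen ws) ≡ w
    m : Fin rank → Fin rank → ℕ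
    m-pos   : ∀ i j → 1 ≤ m i j
    m-rel   : ∀ i j → pow (gen i · gen j) (m i j) ≡ e
    m-least : ∀ i j k → 1 ≤ k → k < m i j → pow (gen i · gen j) k ≢ e
    universal : (H : Group 0ℓ 0ℓ) (f : Fin rank → Group.Carrier H) →
      (∀ i j → Group._≈_ H (gpow H (Group._∙_ H (f i) (f j)) (m i j)) (Group.ε H)) →
      ∃ λ (φ : W → Group.Carrier H) →
        (∀ x y → Group._≈_ H (φ (x · y)) (Group._∙_ H (φ x) (φ y))) ×
        (∀ i → Group._≈_ H (φ (gen i)) (f i))

module Theory (C : CoxeterSystem) where
  open CoxeterSystem C public

  Word : Set
  Word = List (Fin rank)

  evalWord : Word → W
  evalWord ws = prod (map gen ws)

  HasSLen : W → ℕ → Set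
  HasSLen w n = (∃ λ (ws : Word) → length ws ≡ n × evalWord ws ≡ w)
              × (∀ (ws : Word) → evalWord ws ≡ w → n ≤ length ws)

  ReducedWordFor : Word → W → Set
  ReducedWordFor ws w = evalWord ws ≡ w × HasSLen w (length ws)

  Reflection : W → Set
  Reflection t = ∃ λ (x : W) → ∃ λ (i : Fin rank) → t ≡ x · gen i · (x ⁻¹)

  HasTLen : W → ℕ → Set
  HasTLen w n = (∃ λ (ts : List W) → All Reflection ts × length ts ≡ n × prod ts ≡ w)
              × (∀ (ts : List W) → All Reflection ts → prod ts ≡ w → n ≤ length ts)

  _⋖B_ : W → W → Set
  u ⋖B v = (∃ λ t → Reflection t × v ≡ u · t)
         × (∃ λ n → HasSLen u n × HasSLen v (suc n))

  _≤B_ : W → W → Set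
  _≤B_ = Star _⋖B_

  _≤T_ : W → W → Set
  u ≤T v = ∃ λ a → ∃ λ b → HasTLen u a × HasTLen ((u ⁻¹) · v) b × HasTLen v (a + b)

  _⋖T_ : W → W → Set
  u ⋖T v = u ≤T v × u ≢ v × (∀ z → u ≤T z → z ≤T v → z ≡ u ⊎ z ≡ v)

  _≤L_ : W → W → Set
  u ≤L v = ∃ λ (a : Word) → ∃ λ (b : Word) → ReducedWordFor (a ++ b) v × ReducedWordFor b u

  StandardCoxeter : W → Set
  StandardCoxeter c = ∃ λ (ws : Word) → ws ↭ allFin rank × evalWord ws ≡ c

  Wc⁺ : W → W → Set
  Wc⁺ c u = ∃ λ n → HasSLen u n × HasSLen (u · c) (n + rank)

  Chain : Set
  Chain = Fin (suc rank) → W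

  MaxChain : W → Chain → Set
  MaxChain c π = π Fin.zero ≡ e × π (fromℕ rank) ≡ c
               × (∀ (i : Fin rank) → π (inject₁ i) ⋖T π (Fin.suc i))

  Concordant : W → Chain → Set
  Concordant u π = ∀ (i : Fin rank) → (u · π (inject₁ i)) ≤B (u · π (Fin.suc i))

  IsOmegaDown : W → Chain → W → Set
  IsOmegaDown c π u = Wc⁺ c u × Concordant u π
                    × (∀ v → Wc⁺ c v → Concordant v π → u ≤L v)

  -- Sortability w.r.t. a fixed word cw for c' (cw a permutation of S).
  -- A position in cw cw cw ... is a pair (k , j): copy k (0-based),
  -- index j inside cw.
  module Sorting (cw : Word) where
    Pos : Set
    Pos = ℕ × Fin (length cw)

    letter : Pos → Fin rank
    letter (k , j) = lookup cw j

    _<P_ : Pos → Pos → Set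
    (k , j) <P (k' , j') = k < k' ⊎ (k ≡ k' × toℕ j < toℕ j')

    Subword : List Pos → Set
    Subword = Linked _<P_

    LexLeq : List Pos → List Pos → Set
    LexLeq []       _        = ⊤
    LexLeq (_ ∷ _)  []       = ⊥
    LexLeq (p ∷ ps) (q ∷ qs) = p <P q ⊎ (p ≡ q × LexLeq ps qs)

    IsSortingWord : W → List Pos → Set
    IsSortingWord w ps = Subword ps × ReducedWordFor (map letter ps) w
      × (∀ qs → Subword qs → ReducedWordFor (map letter qs) w → LexLeq ps qs)

    -- I^{(k+1)}: letters used from the (k+1)-th copy of cw
    I : ℕ → List Pos → Fin rank → Set
    I k ps s = ∃ λ (j : Fin (length cw)) → (k , j) ∈ ps × lookup cw j ≡ s

    Sortable : W → Set
    Sortable w = ∃ λ ps → IsSortingWord w ps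
               × (∀ k s → I (suc k) ps s → I k ps s)

{-# OPTIONS --safe #-}
module Submission where

-- Invert everything and write c′ = c⁻¹. A concordant pair becomes a chain U = z₀ ⋖ z₁ ⋖ ⋯ ⋖ zᵣ = c′U of Bruhat
-- covers, and U⁻¹ is minimal for its chain only if each right descent d of U is a step zᵢ = zᵢ₋₁ d. Let s be the
-- first letter of c′.
--
-- Minimal implies sortable: if left multiplication by s is not a step of the chain, then s is a left descent
-- of every zᵢ and strips off. If it is a step, deleting it leaves a chain inside one coset of the parabolic
-- subgroup of the other letters; a right descent of the minimal element of that coset could not be a step, so
-- the chain lies in the parabolic subgroup itself. Both cases match the recursive description of sortability.
--
-- Sortable implies minimal: let v = c′_I U with I the letters of the first copy of c′ that are used. Inserting
-- each letter of c′_I into U at the place where it is first skipped, in order, leads from U to v, and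
-- inserting the unused letters leads on to c′U. These words are reduced by the Demazure product argument of
-- Red-insert, and the same recursion shows that U is a prefix of every X concordant with the chain.
--
-- That c has absolute length r follows by removing peaks from paths in the Bruhat graph inside dihedral
-- reflection subgroups; the strong exchange condition comes from the action of W on W × {±1}.

open import Defs
open import Level using (0ℓ)
open import Algebra.Bundles using (Group)
open import Data.Bool using (Bool; true; false; not; _xor_)
open import Data.Bool.Properties using (xor-assoc; xor-same; xor-identityʳ)
open import Data.Empty using (⊥; ⊥-elim)
open import Data.Fin using (Fin; zero; suc; toℕ; fromℕ; inject₁; fromℕ<)
import Data.Fin.Properties as Finₚ
open import Data.List using (List; []; _∷_; _++_; length; map; reverse; lookup; allFin; tabulate; drop)
import Data.List as List
import Data.List.Properties as Listₚ
open import Data.List.Membership.Propositional using (_∈_; _∉_)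
open import Data.List.Membership.Propositional.Properties using (∈-++⁺ˡ; ∈-++⁺ʳ; ∈-++⁻; ∈-insert; ∈-map⁺; ∈-lookup; ∈-tabulate⁺; ∈-tabulate⁻)
open import Data.List.Relation.Binary.Permutation.Propositional using (_↭_; ↭-sym; ↭⇒↭ₛ)
open import Data.List.Relation.Binary.Permutation.Propositional.Properties using (∷↭∷ʳ; ↭-length)
import Data.List.Relation.Binary.Permutation.Setoid.Properties as Permₛ
open import Data.List.Relation.Binary.Sublist.Propositional using (_⊆_; []; _∷_; _∷ʳ_; ⊆-refl; ⊆-trans)
import Data.List.Relation.Binary.Sublist.Propositional as Sub
import Data.List.Relation.Binary.Sublist.Propositional.Properties as Subₚ
open import Data.List.Relation.Unary.All using (All; []; _∷_)
import Data.List.Relation.Unary.All as All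
import Data.List.Relation.Unary.All.Properties as Allₚ
open import Data.List.Relation.Unary.AllPairs using (AllPairs; []; _∷_)
import Data.List.Relation.Unary.AllPairs as AllPairs
import Data.List.Relation.Unary.AllPairs.Properties as AllPairsₚ
open import Data.List.Relation.Unary.Any using (here; there)
import Data.List.Relation.Unary.Any as Any
import Data.List.Relation.Unary.Any.Properties as Anyₚ
open import Data.List.Relation.Unary.Any.Properties using (lookup-index)
open import Data.List.Relation.Unary.Linked.Properties using (AllPairs⇒Linked; Linked⇒AllPairs)
open import Data.List.Relation.Unary.Unique.Propositional using (Unique)
open import Data.List.Relation.Unary.Unique.Propositional.Properties using (Unique[x∷xs]⇒x∉xs; allFin⁺)
open import Data.Nat using (ℕ; zero; suc; _+_; _∸_; _≤_; _<_; z≤n; s≤s)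
import Data.Nat.Properties as ℕₚ
open import Data.Product using (Σ; ∃; _×_; _,_; proj₁; proj₂)
open import Data.Product.Properties using (≡-dec)
open import Data.Sum using (_⊎_; inj₁; inj₂)
open import Data.Unit using (⊤; tt)
open import Data.Vec using (Vec; []; _∷_) renaming (lookup to vlookup)
open import Function using (_∘_; id)
open import Function.Bundles using (_⇔_; mk⇔)
open import Relation.Binary.Construct.Closure.ReflexiveTransitive using (Star; ε; _◅_; _◅◅_)
open import Relation.Binary.PropositionalEquality using (_≡_; _≢_; refl; sym; trans; cong; cong₂; subst; subst₂; setoid; module ≡-Reasoning)
open import Relation.Nullary using (¬_; Dec; yes; no; does)
open import Relation.Nullary.Decidable using (map′; _⊎-dec_; decidable-stable)

-- No root system is at hand, so all facts about lengths rest on the cocycle `η`, where `η w t`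
-- tells whether `t` is a left inversion of `w`. Inverting all elements makes the factors of a chain
-- act from the left, and a chain is stored as the bare list of these reflections. The same list can
-- be started at any `X`: `Asc ts X` expresses that the inverse of `X` is concordant with the chain.
-- Minimality thus compares the starting points of one fixed list.

module Coxeter (C : CoxeterSystem) where
  open Theory C

  -- Equality, and a solver for group identities

  infix 4 _≟_

  _≟_ : (x y : W) → Dec (x ≡ y)
  x ≟ y with Any.index (complete x) Finₚ.≟ Any.index (complete y)
  ... | yes p = yes (trans (lookup-index (complete x)) (trans (cong (lookup enum) p)
      (sym (lookup-index (complete y)))))
  ... | no ¬p = no λ q → ¬p (cong (λ z → Any.index (complete z)) q)

  -- Free reduction in the group with generic atoms and involutive atoms.

  cancelˡ : ∀ x y → x ⁻¹ · (x · y) ≡ y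
  cancelˡ x y = trans (sym (assoc _ _ _)) (trans (cong (_· y) (inverseˡ x)) (identityˡ y))

  cancelʳ : ∀ x y → x · (x ⁻¹ · y) ≡ y
  cancelʳ x y = trans (sym (assoc _ _ _)) (trans (cong (_· y) (inverseʳ x)) (identityˡ y))

  inv-unique : ∀ x y → x · y ≡ e → y ≡ x ⁻¹
  inv-unique x y p = trans (sym (cancelˡ x y)) (trans (cong (x ⁻¹ ·_) p) (identityʳ _))

  inv-inv : ∀ x → (x ⁻¹) ⁻¹ ≡ x
  inv-inv x = sym (inv-unique (x ⁻¹) x (inverseˡ x))

  inv-mul : ∀ x y → (x · y) ⁻¹ ≡ y ⁻¹ · x ⁻¹
  inv-mul x y = sym (inv-unique (x · y) (y ⁻¹ · x ⁻¹)
    (trans (assoc _ _ _) (trans (cong (x ·_) (cancelʳ y (x ⁻¹))) (inverseʳ x))))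

  inv-e : e ⁻¹ ≡ e
  inv-e = sym (inv-unique e e (identityˡ e))

  Involution : Set
  Involution = Σ W λ t → t · t ≡ e

  data Atom (n k : ℕ) : Set where
    pos neg : Fin n → Atom n k
    inv     : Fin k → Atom n k

  infixl 7 _⊗_
  infix 20 _⁻

  data Expr (n k : ℕ) : Set where
    var : Fin n → Expr n k
    ref : Fin k → Expr n k
    ε   : Expr n k
    _⊗_ : Expr n k → Expr n k → Expr n k
    _⁻  : Expr n k → Expr n k

  module _ {n k : ℕ} where

    cancels : (a b : Atom n k) → Bool
    cancels (pos i) (neg j) = does (i Finₚ.≟ j)
    cancels (neg i) (pos j) = does (i Finₚ.≟ j)
    cancels (inv i) (inv j) = does (i Finₚ.≟ j)
    cancels _ _ = false

    push : Atom n k → List (Atom n k) → List (Atom n k)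
    push a [] = a ∷ []
    push a (b ∷ l) with cancels a b
    ... | true  = l
    ... | false = a ∷ b ∷ l

    norm norm⁻ : Expr n k → List (Atom n k) → List (Atom n k)
    norm (var i) l = push (pos i) l
    norm (ref i) l = push (inv i) l
    norm ε l = l
    norm (x ⊗ y) l = norm x (norm y l)
    norm (x ⁻) l = norm⁻ x l
    norm⁻ (var i) l = push (neg i) l
    norm⁻ (ref i) l = push (inv i) l
    norm⁻ ε l = l
    norm⁻ (x ⊗ y) l = norm⁻ y (norm⁻ x l)
    norm⁻ (x ⁻) l = norm x l

    module _ (ρ : Vec W n) (σ : Vec Involution k) where

      ⟦_⟧ : Expr n k → W
      ⟦ var i ⟧ = vlookup ρ i
      ⟦ ref i ⟧ = proj₁ (vlookup σ i)
      ⟦ ε ⟧ = e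
      ⟦ x ⊗ y ⟧ = ⟦ x ⟧ · ⟦ y ⟧
      ⟦ x ⁻ ⟧ = ⟦ x ⟧ ⁻¹

      ⟦_⟧ₐ : Atom n k → W
      ⟦ pos i ⟧ₐ = vlookup ρ i
      ⟦ neg i ⟧ₐ = vlookup ρ i ⁻¹
      ⟦ inv i ⟧ₐ = proj₁ (vlookup σ i)

      ⟦_⟧ₗ : List (Atom n k) → W
      ⟦ [] ⟧ₗ = e
      ⟦ a ∷ l ⟧ₗ = ⟦ a ⟧ₐ · ⟦ l ⟧ₗ

      cancels-sound : ∀ a b → cancels a b ≡ true → ∀ x → ⟦ a ⟧ₐ · (⟦ b ⟧ₐ · x) ≡ x
      cancels-sound (pos i) (neg j) p x with i Finₚ.≟ j
      cancels-sound (pos i) (neg j) p x | yes refl = cancelʳ _ x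
      cancels-sound (neg i) (pos j) p x with i Finₚ.≟ j
      cancels-sound (neg i) (pos j) p x | yes refl = cancelˡ _ x
      cancels-sound (inv i) (inv j) p x with i Finₚ.≟ j
      cancels-sound (inv i) (inv j) p x | yes refl =
        trans (sym (assoc _ _ _)) (trans (cong (_· x) (proj₂ (vlookup σ i))) (identityˡ x))

      push-sound : ∀ a l → ⟦ push a l ⟧ₗ ≡ ⟦ a ⟧ₐ · ⟦ l ⟧ₗ
      push-sound a [] = refl
      push-sound a (b ∷ l) with cancels a b in eq
      ... | true  = sym (cancels-sound a b eq _)
      ... | false = refl

      norm-sound  : ∀ x l → ⟦ norm x l ⟧ₗ ≡ ⟦ x ⟧ · ⟦ l ⟧ₗ
      norm⁻-sound : ∀ x l → ⟦ norm⁻ x l ⟧ₗ ≡ ⟦ x ⟧ ⁻¹ · ⟦ l ⟧ₗ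
      norm-sound (var i) l = push-sound (pos i) l
      norm-sound (ref i) l = push-sound (inv i) l
      norm-sound ε l = sym (identityˡ _)
      norm-sound (x ⊗ y) l = trans (norm-sound x _) (trans (cong (_ ·_) (norm-sound y l)) (sym (assoc _ _ _)))
      norm-sound (x ⁻) l = norm⁻-sound x l
      norm⁻-sound (var i) l = push-sound (neg i) l
      norm⁻-sound (ref i) l = trans (push-sound (inv i) l) (cong (_· _) (inv-unique _ _ (proj₂ (vlookup σ i))))
      norm⁻-sound ε l = sym (trans (cong (_· ⟦ l ⟧ₗ) inv-e) (identityˡ _))
      norm⁻-sound (x ⊗ y) l = trans (norm⁻-sound y _) (trans (cong (_ ·_) (norm⁻-sound x l))
        (trans (sym (assoc _ _ _)) (cong (_· ⟦ l ⟧ₗ) (sym (inv-mul _ _)))))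
      norm⁻-sound (x ⁻) l = trans (norm-sound x l) (cong (_· _) (sym (inv-inv _)))

      -- A solver by reflection: only soundness of the normalisation is at stake, and in each use
      -- the normal forms agree by `refl`.
      group : ∀ x y → norm x [] ≡ norm y [] → ⟦ x ⟧ ≡ ⟦ y ⟧
      group x y p = trans (sym (identityʳ _)) (trans (sym (norm-sound x []))
        (trans (cong ⟦_⟧ₗ p) (trans (norm-sound y []) (identityʳ _))))

  pattern x₀ = var zero
  pattern x₁ = var (suc zero)
  pattern x₂ = var (suc (suc zero))
  pattern x₃ = var (suc (suc (suc zero)))
  pattern r₀ = ref zero
  pattern r₁ = ref (suc zero)

  simple : Fin rank → Involution
  simple i = gen i , gen-involution i

  gen·gen· : ∀ i x → gen i · (gen i · x) ≡ x
  gen·gen· i x = group (x ∷ []) (simple i ∷ []) (r₀ ⊗ (r₀ ⊗ x₀)) x₀ refl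

  ·-cancelˡ : ∀ x {y z} → x · y ≡ x · z → y ≡ z
  ·-cancelˡ x {y} {z} p = trans (sym (cancelˡ x y)) (trans (cong (x ⁻¹ ·_) p) (cancelˡ x z))

  ·-cancelʳ : ∀ x {y z} → y · x ≡ z · x → y ≡ z
  ·-cancelʳ x {y} {z} p = trans (sym (lem y)) (trans (cong (_· x ⁻¹) p) (lem z))
    where
    lem : ∀ y → y · x · x ⁻¹ ≡ y
    lem y = group (y ∷ x ∷ []) [] (x₀ ⊗ x₁ ⊗ x₁ ⁻) x₀ refl

  evalWord-++ : ∀ a b → evalWord (a ++ b) ≡ evalWord a · evalWord b
  evalWord-++ [] b = sym (identityˡ _)
  evalWord-++ (i ∷ a) b = trans (cong (gen i ·_) (evalWord-++ a b)) (sym (assoc _ _ _))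

  evalWord-[_] : ∀ i → evalWord (i ∷ []) ≡ gen i
  evalWord-[ i ] = identityʳ _

  evalWord-reverse : ∀ a → evalWord (reverse a) ≡ evalWord a ⁻¹
  evalWord-reverse [] = sym inv-e
  evalWord-reverse (i ∷ a) = begin
    evalWord (reverse (i ∷ a))          ≡⟨ cong evalWord (Listₚ.unfold-reverse i a) ⟩
    evalWord (reverse a ++ i ∷ [])      ≡⟨ evalWord-++ (reverse a) (i ∷ []) ⟩
    evalWord (reverse a) · evalWord (i ∷ []) ≡⟨ cong₂ _·_ (evalWord-reverse a) evalWord-[ i ] ⟩
    evalWord a ⁻¹ · gen i ≡⟨ group (evalWord a ∷ []) (simple i ∷ []) (x₀ ⁻ ⊗ r₀) ((r₀ ⊗ x₀) ⁻) refl ⟩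
    evalWord (i ∷ a) ⁻¹ ∎
    where open ≡-Reasoning

  -- Length.

  least : {P : ℕ → Set} → (∀ n → Dec (P n)) → ∀ n → P n → ∃ λ k → P k × (∀ j → P j → k ≤ j)
  least P? zero p = zero , p , λ _ _ → z≤n
  least P? (suc n) p with P? zero
  ... | yes p₀ = zero , p₀ , λ _ _ → z≤n
  ... | no ¬p₀ with least (P? ∘ suc) n p
  ... | k , pk , min = suc k , pk , λ { zero q → ⊥-elim (¬p₀ q) ; (suc j) q → s≤s (min j q) }

  word? : ∀ n w → Dec (∃ λ ws → length ws ≡ n × evalWord ws ≡ w)
  word? zero w = map′ (λ p → [] , refl , p) (λ { ([] , _ , p) → p }) (e ≟ w)
  word? (suc n) w = map′ to from (Finₚ.any? λ i → word? n (gen i · w))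
    where
    to : (∃ λ i → ∃ λ ws → length ws ≡ n × evalWord ws ≡ gen i · w) → ∃ λ ws → length ws ≡ suc n × evalWord ws ≡ w
    to (i , ws , l , p) = i ∷ ws , cong suc l , trans (cong (gen i ·_) p) (gen·gen· i w)
    from : (∃ λ ws → length ws ≡ suc n × evalWord ws ≡ w) → ∃ λ i → ∃ λ ws → length ws ≡ n × evalWord ws ≡ gen i ·
        w
    from (i ∷ ws , l , p) = i , ws , ℕₚ.suc-injective l , trans (sym (gen·gen· i _)) (cong (gen i ·_) p)

  abstract
    length-exists : ∀ w → ∃ (HasSLen w)
    length-exists w with generates w
    ... | ws , p with least (λ n → word? n w) (length ws) (ws , refl , p)
    ... | k , q , min = k , q , λ ws' p' → min _ (ws' , refl , p')

    ℓ : W → ℕ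
    ℓ w = proj₁ (length-exists w)

    ℓ-spec : ∀ w → HasSLen w (ℓ w)
    ℓ-spec w = proj₂ (length-exists w)

  HasSLen-unique : ∀ {w a b} → HasSLen w a → HasSLen w b → a ≡ b
  HasSLen-unique ((ws , l , p) , m₁) ((ws' , l' , p') , m₂) =
    ℕₚ.≤-antisym (subst (_ ≤_) l' (m₁ ws' p')) (subst (_ ≤_) l (m₂ ws p))

  ℓ-unique : ∀ {w n} → HasSLen w n → ℓ w ≡ n
  ℓ-unique {w} = HasSLen-unique (ℓ-spec w)

  HasSLen-ℓ : ∀ {w n} → ℓ w ≡ n → HasSLen w n
  HasSLen-ℓ {w} p = subst (HasSLen w) p (ℓ-spec w)

  ℓ≤length : ∀ ws → ℓ (evalWord ws) ≤ length ws
  ℓ≤length ws = proj₂ (ℓ-spec _) ws refl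

  reducedWord : ∀ w → ∃ λ ws → length ws ≡ ℓ w × evalWord ws ≡ w
  reducedWord w = proj₁ (ℓ-spec w)

  ℓ-e : ℓ e ≡ 0
  ℓ-e = ℕₚ.n≤0⇒n≡0 (ℓ≤length [])

  ℓ≡0⇒e : ∀ {w} → ℓ w ≡ 0 → w ≡ e
  ℓ≡0⇒e {w} p with reducedWord w
  ... | [] , l , q = sym q
  ... | _ ∷ _ , l , q with trans l p
  ... | ()

  ℓ-· : ∀ x y → ℓ (x · y) ≤ ℓ x + ℓ y
  ℓ-· x y with reducedWord x | reducedWord y
  ... | a , la , refl | b , lb , refl = subst₂ _≤_ (cong ℓ (evalWord-++ a b))
    (trans (Listₚ.length-++ a) (cong₂ _+_ la lb)) (ℓ≤length (a ++ b))

  ℓ-inv≤ : ∀ x → ℓ (x ⁻¹) ≤ ℓ x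
  ℓ-inv≤ x with reducedWord x
  ... | a , la , refl = subst₂ _≤_ (cong ℓ (evalWord-reverse a)) (trans (Listₚ.length-reverse a) la)
      (ℓ≤length (reverse a))

  ℓ-inv : ∀ x → ℓ (x ⁻¹) ≡ ℓ x
  ℓ-inv x = ℕₚ.≤-antisym (ℓ-inv≤ x) (subst (λ z → ℓ z ≤ ℓ (x ⁻¹)) (inv-inv x) (ℓ-inv≤ (x ⁻¹)))

  ℓ-gen≤1 : ∀ i → ℓ (gen i) ≤ 1
  ℓ-gen≤1 i = subst (λ z → ℓ z ≤ 1) evalWord-[ i ] (ℓ≤length (i ∷ []))

  ℓ-gen : ∀ i → ℓ (gen i) ≡ 1
  ℓ-gen i with ℓ (gen i) in eq | ℓ-gen≤1 i
  ... | zero  | _ = ⊥-elim (gen-nontrivial i (ℓ≡0⇒e eq))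
  ... | suc zero | _ = refl
  ... | suc (suc _) | s≤s ()

  ℓ-gen·≤ : ∀ i x → ℓ (gen i · x) ≤ suc (ℓ x)
  ℓ-gen·≤ i x = ℕₚ.≤-trans (ℓ-· (gen i) x) (ℕₚ.+-monoˡ-≤ (ℓ x) (ℓ-gen≤1 i))

  -- The sign cocycle.

  δ : W → W → Bool
  δ t u = does (t ≟ u)

  δ-true : ∀ {t u} → δ t u ≡ true → t ≡ u
  δ-true {t} {u} p with t ≟ u
  ... | yes q = q

  δ-false : ∀ {t u} → t ≢ u → δ t u ≡ false
  δ-false {t} {u} ¬p with t ≟ u
  ... | yes p = ⊥-elim (¬p p)
  ... | no _ = refl

  δ-refl : ∀ t → δ t t ≡ true
  δ-refl t with t ≟ t
  ... | yes _ = refl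
  ... | no ¬p = ⊥-elim (¬p refl)

  δ-cong : ∀ {t u t' u'} → (t ≡ u → t' ≡ u') → (t' ≡ u' → t ≡ u) → δ t u ≡ δ t' u'
  δ-cong {t} {u} {t'} {u'} f g with t ≟ u | t' ≟ u'
  ... | yes _ | yes _ = refl
  ... | no _  | no _  = refl
  ... | yes p | no ¬q = ⊥-elim (¬q (f p))
  ... | no ¬p | yes q = ⊥-elim (¬p (g q))

  Signed : Set
  Signed = W × Bool

  -- `universal` asks for a group, so permutations of `Signed` carry their inverses; equality
  -- compares the forward maps only, and the braid relations are checked on these.
  Perm : Group 0ℓ 0ℓ
  Perm = record
    { Carrier = Σ (Signed → Signed) λ f → Σ (Signed → Signed) λ g → (∀ x → f (g x) ≡ x) × (∀ x → g (f x) ≡ x)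
    ; _≈_ = λ a b → ∀ x → proj₁ a x ≡ proj₁ b x
    ; _∙_ = λ { (f , f' , p , p') (g , g' , q , q') → f ∘ g , g' ∘ f'
              , (λ x → trans (cong f (q (f' x))) (p x)) , (λ x → trans (cong g' (p' (g x))) (q' x)) }
    ; ε = id , id , (λ _ → refl) , (λ _ → refl)
    ; _⁻¹ = λ { (f , g , p , q) → g , f , q , p }
    ; isGroup = record
      { isMonoid = record
        { isSemigroup = record
          { isMagma = record
            { isEquivalence = record { refl = λ _ → refl ; sym = λ p x → sym (p x) ; trans = λ p q x → trans (p x)
                (q x) }
            ; ∙-cong = λ {a} {b} {c} {d} p q x → trans (p _) (cong (proj₁ b) (q x)) }
          ; assoc = λ _ _ _ _ → refl }
        ; identity = (λ _ _ → refl) , (λ _ _ → refl) }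
      ; inverse = (λ { (f , g , p , q) x → q x }) , (λ { (f , g , p , q) x → p x })
      ; ⁻¹-cong = λ { {f , f' , p , p'} {g , g' , q , q'} r x →
          trans (cong f' (sym (q x))) (trans (cong f' (sym (r (g' x)))) (p' (g' x))) } } }

  -- A simple reflection conjugates `t` and changes the sign exactly at `t = gen i`. The formula
  -- makes sense on all of `W`, so reflections need no type of their own.
  flip : Fin rank → Signed → Signed
  flip i (t , b) = gen i · t · gen i , b xor δ t (gen i)

  xor-cancelʳ : ∀ b a → (b xor a) xor a ≡ b
  xor-cancelʳ b a = trans (xor-assoc b a a) (trans (cong (b xor_) (xor-same a)) (xor-identityʳ b))

  flip-flip : ∀ i x → flip i (flip i x) ≡ x
  flip-flip i (t , b) = cong₂ _,_
    (group (t ∷ []) (simple i ∷ []) (r₀ ⊗ (r₀ ⊗ x₀ ⊗ r₀) ⊗ r₀) x₀ refl)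
    (trans (cong ((b xor δ t (gen i)) xor_)
       (δ-cong (λ p → trans (group (t ∷ []) (simple i ∷ []) x₀ (r₀ ⊗ (r₀ ⊗ x₀ ⊗ r₀) ⊗ r₀) refl)
                       (trans (cong (λ z → gen i · z · gen i) p)
                           (group [] (simple i ∷ []) (r₀ ⊗ r₀ ⊗ r₀) r₀ refl)))
               (λ p → trans (cong (λ z → gen i · z · gen i) p)
                   (group [] (simple i ∷ []) (r₀ ⊗ r₀ ⊗ r₀) r₀ refl))))
     (xor-cancelʳ b (δ t (gen i))))

  flipPerm : Fin rank → Group.Carrier Perm
  flipPerm i = flip i , flip i , flip-flip i , flip-flip i

  pow-+ : ∀ x a b → pow x (a + b) ≡ pow x a · pow x b
  pow-+ x zero b = sym (identityˡ _)
  pow-+ x (suc a) b = trans (cong (x ·_) (pow-+ x a b)) (sym (assoc _ _ _))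

  module Braid (i j : Fin rank) where
    a b g h : W
    a = gen i
    b = gen j
    g = a · b
    h = b · a

    -- The n-th reflection of the alternating word is hⁿ b.
    parity : ℕ → W → Bool
    parity zero t = false
    parity (suc n) t = parity n t xor δ t (pow h n · b)

    pow-sucʳ : ∀ x n → x · pow x n ≡ pow x n · x
    pow-sucʳ x zero = trans (identityʳ x) (sym (identityˡ x))
    pow-sucʳ x (suc n) = trans (cong (x ·_) (pow-sucʳ x n)) (sym (assoc _ _ _))

    h^g^ : ∀ n → pow h n · pow g n ≡ e
    h^g^ zero = identityˡ e
    h^g^ (suc n) = begin
      h · pow h n · (g · pow g n) ≡⟨ cong (_· (g · pow g n)) (pow-sucʳ h n) ⟩
      pow h n · h · (g · pow g n)
        ≡⟨ group (pow h n ∷ pow g n ∷ []) (simple i ∷ simple j ∷ []) (x₀ ⊗ (r₁ ⊗ r₀) ⊗ (r₀ ⊗ r₁ ⊗ x₁)) (x₀ ⊗ x₁)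
            refl ⟩
      pow h n · pow g n ≡⟨ h^g^ n ⟩
      e ∎
      where open ≡-Reasoning

    inv-g^ : ∀ n → pow g n ⁻¹ ≡ pow h n
    inv-g^ n = trans (cong _⁻¹ (inv-unique _ _ (h^g^ n))) (inv-inv _)

    b·g^ : ∀ n → b · pow g n ≡ pow h n · b
    b·g^ zero = trans (identityʳ b) (sym (identityˡ b))
    b·g^ (suc n) = begin
      b · (a · b · pow g n) ≡⟨ group (a ∷ b ∷ pow g n ∷ []) [] (x₁ ⊗ (x₀ ⊗ x₁ ⊗ x₂)) (x₁ ⊗ x₀ ⊗ (x₁ ⊗ x₂)) refl ⟩
      h · (b · pow g n) ≡⟨ cong (h ·_) (b·g^ n) ⟩
      h · (pow h n · b) ≡⟨ sym (assoc _ _ _) ⟩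
      h · pow h n · b ∎
      where open ≡-Reasoning

    conj-b : ∀ n → pow g n ⁻¹ · b · pow g n ≡ pow h (n + n) · b
    conj-b n = begin
      pow g n ⁻¹ · b · pow g n ≡⟨ assoc _ _ _ ⟩
      pow g n ⁻¹ · (b · pow g n) ≡⟨ cong₂ _·_ (inv-g^ n) (b·g^ n) ⟩
      pow h n · (pow h n · b) ≡⟨ sym (assoc _ _ _) ⟩
      pow h n · pow h n · b ≡⟨ cong (_· b) (sym (pow-+ h n n)) ⟩
      pow h (n + n) · b ∎
      where open ≡-Reasoning

    conj-bab : ∀ n → pow g n ⁻¹ · (b · a · b) · pow g n ≡ pow h (suc (n + n)) · b
    conj-bab n = begin
      pow g n ⁻¹ · (b · a · b) · pow g n ≡⟨ cong (λ z → z · (b · a · b) · pow g n) (inv-g^ n) ⟩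
      pow h n · (h · b) · pow g n ≡⟨ group (pow h n ∷ h ∷ b ∷ pow g n ∷ []) [] (x₀ ⊗ (x₁ ⊗ x₂) ⊗ x₃)
          (x₀ ⊗ x₁ ⊗ (x₂ ⊗ x₃)) refl ⟩
      pow h n · h · (b · pow g n) ≡⟨ cong₂ _·_ (sym (pow-sucʳ h n)) (b·g^ n) ⟩
      h · pow h n · (pow h n · b) ≡⟨ group (h ∷ pow h n ∷ b ∷ []) [] (x₀ ⊗ x₁ ⊗ (x₁ ⊗ x₂)) (x₀ ⊗ (x₁ ⊗ x₁) ⊗ x₂)
          refl ⟩
      h · (pow h n · pow h n) · b ≡⟨ cong (λ z → h · z · b) (sym (pow-+ h n n)) ⟩
      pow h (suc (n + n)) · b ∎
      where open ≡-Reasoning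

    -- The power `pow g n` meets the reflections `pow h k · b` with `k < n + n`; one more factor
    -- `g = a · b` adds the two with `k = n + n` and its successor.
    power : ∀ n t s → proj₁ (gpow Perm (Group._∙_ Perm (flipPerm i) (flipPerm j)) n) (t , s)
          ≡ (pow g n · t · pow g n ⁻¹ , s xor parity (n + n) t)
    power zero t s = cong₂ _,_ (group (t ∷ []) [] x₀ (ε ⊗ x₀ ⊗ ε ⁻) refl) (sym (xor-identityʳ s))
    power (suc n) t s rewrite power n t s | ℕₚ.+-suc n n = cong₂ _,_
      (group (x ∷ t ∷ []) (simple i ∷ simple j ∷ []) (r₀ ⊗ (r₁ ⊗ (x₀ ⊗ x₁ ⊗ x₀ ⁻) ⊗ r₁) ⊗ r₀)
          (r₀ ⊗ r₁ ⊗ x₀ ⊗ x₁ ⊗ (r₀ ⊗ r₁ ⊗ x₀) ⁻) refl)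
      (begin
        ((s xor p) xor δ t' b) xor δ (b · t' · b) a ≡⟨ cong₂ (λ y z → ((s xor p) xor y) xor z) eq₁ eq₂ ⟩
        ((s xor p) xor d₁) xor d₂ ≡⟨ cong (_xor d₂) (xor-assoc s p d₁) ⟩
        (s xor (p xor d₁)) xor d₂ ≡⟨ xor-assoc s (p xor d₁) d₂ ⟩
        s xor ((p xor d₁) xor d₂) ∎)
      where
      open ≡-Reasoning
      x t' : W
      x = pow g n
      t' = x · t · x ⁻¹
      p d₁ d₂ : Bool
      p = parity (n + n) t
      d₁ = δ t (pow h (n + n) · b)
      d₂ = δ t (pow h (suc (n + n)) · b)
      eq₁ : δ t' b ≡ d₁
      eq₁ = δ-cong
        (λ q → trans (group (x ∷ t ∷ []) [] x₁ (x₀ ⁻ ⊗ (x₀ ⊗ x₁ ⊗ x₀ ⁻) ⊗ x₀) refl)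
            (trans (cong (λ z → x ⁻¹ · z · x) q) (conj-b n)))
        (λ q → trans (cong (λ z → x · z · x ⁻¹) (trans q (sym (conj-b n))))
            (group (x ∷ b ∷ []) [] (x₀ ⊗ (x₀ ⁻ ⊗ x₁ ⊗ x₀) ⊗ x₀ ⁻) x₁ refl))
      eq₂ : δ (b · t' · b) a ≡ d₂
      eq₂ = δ-cong
        (λ q → trans (group (x ∷ t ∷ []) (simple j ∷ []) x₁ (x₀ ⁻ ⊗ (r₀ ⊗ (r₀ ⊗ (x₀ ⊗ x₁ ⊗ x₀ ⁻) ⊗ r₀) ⊗ r₀) ⊗ x₀)
            refl)
                  (trans (cong (λ z → x ⁻¹ · (b · z · b) · x) q) (conj-bab n)))
        (λ q → trans (cong (λ z → b · (x · z · x ⁻¹) · b) (trans q (sym (conj-bab n))))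
                  (group (x ∷ a ∷ []) (simple j ∷ []) (r₀ ⊗ (x₀ ⊗ (x₀ ⁻ ⊗ (r₀ ⊗ x₁ ⊗ r₀) ⊗ x₀) ⊗ x₀ ⁻) ⊗ r₀) x₁
                      refl))

    h^m : pow h (m i j) ≡ e
    h^m = trans (sym (inv-g^ (m i j))) (trans (cong _⁻¹ (m-rel i j)) inv-e)

    parity-m+ : ∀ n t → parity (m i j + n) t ≡ parity (m i j) t xor parity n t
    parity-m+ zero t = trans (cong (λ k → parity k t) (ℕₚ.+-identityʳ (m i j))) (sym (xor-identityʳ _))
    parity-m+ (suc n) t rewrite ℕₚ.+-suc (m i j) n =
      trans (cong₂ _xor_ (parity-m+ n t)
        (cong (λ z → δ t (z · b)) (trans (pow-+ h (m i j) n) (trans (cong (_· pow h n) h^m) (identityˡ _)))))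
        (xor-assoc (parity (m i j) t) _ _)

    -- As `h` to the power `m i j` is `e`, the reflections met run twice through the same list, and
    -- all sign changes cancel.
    relation : ∀ x → proj₁ (gpow Perm (Group._∙_ Perm (flipPerm i) (flipPerm j)) (m i j)) x ≡ x
    relation (t , s) = trans (power (m i j) t s) (cong₂ _,_
      (trans (cong (λ z → z · t · z ⁻¹) (m-rel i j)) (group (t ∷ []) [] (ε ⊗ x₀ ⊗ ε ⁻) x₀ refl))
      (trans (cong (s xor_) (trans (parity-m+ (m i j) t) (xor-same (parity (m i j) t)))) (xor-identityʳ s)))

  module Sign where
    hom = universal Perm flipPerm Braid.relation

    φ : W → Signed → Signed
    φ w = proj₁ (proj₁ hom w)

    φ-· : ∀ x y z → φ (x · y) z ≡ φ x (φ y z)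
    φ-· = proj₁ (proj₂ hom)

    φ-gen : ∀ i z → φ (gen i) z ≡ flip i z
    φ-gen = proj₂ (proj₂ hom)

    -- `universal` promises multiplicativity only. But `φ e` is idempotent and has a left inverse,
    -- so it is the identity.
    φ-e : ∀ z → φ e z ≡ z
    φ-e z = begin
      φ e z                  ≡⟨ sym (retract (φ e z)) ⟩
      ψ (φ e (φ e z))        ≡⟨ cong ψ (sym (φ-· e e z)) ⟩
      ψ (φ (e · e) z)        ≡⟨ cong (λ y → ψ (φ y z)) (identityˡ e) ⟩
      ψ (φ e z)              ≡⟨ retract z ⟩
      z ∎
      where
      open ≡-Reasoning
      ψ : Signed → Signed
      ψ = proj₁ (proj₂ (proj₁ hom e))
      retract : ∀ y → ψ (φ e y) ≡ y
      retract = proj₂ (proj₂ (proj₂ (proj₁ hom e)))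

  -- The parity of the number of ways to write `ws` as `a ++ k ∷ b` with
  -- `t = conj (evalWord a) (gen k)`.
  count : Word → W → Bool
  count [] t = false
  count (i ∷ ws) t = δ t (gen i) xor count ws (gen i · t · gen i)

  φ-count : ∀ ws t s → proj₂ (Sign.φ (evalWord ws ⁻¹) (t , s)) ≡ s xor count ws t
  φ-count [] t s = trans (cong (λ z → proj₂ (Sign.φ z (t , s))) inv-e)
    (trans (cong proj₂ (Sign.φ-e (t , s))) (sym (xor-identityʳ s)))
  φ-count (i ∷ ws) t s = begin
    proj₂ (φ ((gen i · w) ⁻¹) (t , s)) ≡⟨ cong (λ z → proj₂ (φ z (t , s)))
        (group (w ∷ []) (simple i ∷ []) ((r₀ ⊗ x₀) ⁻) (x₀ ⁻ ⊗ r₀) refl) ⟩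
    proj₂ (φ (w ⁻¹ · gen i) (t , s))   ≡⟨ cong proj₂ (trans (φ-· _ _ _) (cong (φ (w ⁻¹)) (φ-gen i (t , s)))) ⟩
    proj₂ (φ (w ⁻¹) (flip i (t , s)))  ≡⟨ φ-count ws (gen i · t · gen i) (s xor δ t (gen i)) ⟩
    (s xor δ t (gen i)) xor count ws (gen i · t · gen i) ≡⟨ xor-assoc s _ _ ⟩
    s xor count (i ∷ ws) t ∎
    where
    open ≡-Reasoning
    open Sign
    w = evalWord ws

  abstract
    -- Left inversions. Being defined through the action, `η` depends on no word; `η-word` then
    -- equates it with the parity counted along every word of `w`.
    η : W → W → Bool
    η w t = proj₂ (Sign.φ (w ⁻¹) (t , false))

    η-word : ∀ ws t → η (evalWord ws) t ≡ count ws t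
    η-word ws t = φ-count ws t false

  η-e : ∀ t → η e t ≡ false
  η-e t = η-word [] t

  count-++ : ∀ a b t → count (a ++ b) t ≡ count a t xor count b (evalWord a ⁻¹ · t · evalWord a)
  count-++ [] b t = cong (count b) (group (t ∷ []) [] x₀ (ε ⁻ ⊗ x₀ ⊗ ε) refl)
  count-++ (i ∷ a) b t = begin
    δ t (gen i) xor count (a ++ b) t' ≡⟨ cong (δ t (gen i) xor_) (count-++ a b t') ⟩
    δ t (gen i) xor (count a t' xor count b (evalWord a ⁻¹ · t' · evalWord a))
      ≡⟨ cong (λ z → δ t (gen i) xor (count a t' xor count b z))
           (group (evalWord a ∷ t ∷ []) (simple i ∷ []) (x₀ ⁻ ⊗ (r₀ ⊗ x₁ ⊗ r₀) ⊗ x₀)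
               ((r₀ ⊗ x₀) ⁻ ⊗ x₁ ⊗ (r₀ ⊗ x₀)) refl) ⟩
    δ t (gen i) xor (count a t' xor count b t'') ≡⟨ sym (xor-assoc (δ t (gen i)) _ _) ⟩
    count (i ∷ a) t xor count b t'' ∎
    where
    open ≡-Reasoning
    t' = gen i · t · gen i
    t'' = evalWord (i ∷ a) ⁻¹ · t · evalWord (i ∷ a)

  η-· : ∀ x y t → η (x · y) t ≡ η x t xor η y (x ⁻¹ · t · x)
  η-· x y t with generates x | generates y
  ... | a , refl | b , refl = begin
    η (evalWord a · evalWord b) t ≡⟨ cong (λ z → η z t) (sym (evalWord-++ a b)) ⟩
    η (evalWord (a ++ b)) t ≡⟨ η-word (a ++ b) t ⟩
    count (a ++ b) t ≡⟨ count-++ a b t ⟩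
    count a t xor count b _ ≡⟨ cong₂ _xor_ (sym (η-word a t)) (sym (η-word b _)) ⟩
    η (evalWord a) t xor η (evalWord b) _ ∎
    where open ≡-Reasoning

  η-gen : ∀ i t → η (gen i) t ≡ δ t (gen i)
  η-gen i t = trans (cong (λ z → η z t) (sym evalWord-[ i ])) (trans (η-word (i ∷ []) t) (xor-identityʳ _))

  xor-false⁻ : ∀ {a b} → a xor b ≡ false → a ≡ b
  xor-false⁻ {false} {false} _ = refl
  xor-false⁻ {true} {true} _ = refl

  η-inv : ∀ x t → η (x ⁻¹) (x ⁻¹ · t · x) ≡ η x t
  η-inv x t = sym (xor-false⁻ (trans (sym (η-· x (x ⁻¹) t)) (trans (cong (λ z → η z t) (inverseʳ x)) (η-e t))))

  -- Strong exchange

  split : ∀ ws t → count ws t ≡ true →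
    ∃ λ a → ∃ λ k → ∃ λ b → ws ≡ a ++ k ∷ b × t ≡ evalWord a · gen k · evalWord a ⁻¹
  split (i ∷ ws) t p with t ≟ gen i
  ... | yes q = [] , i , ws , refl , trans q (group [] (simple i ∷ []) r₀ (ε ⊗ r₀ ⊗ ε ⁻) refl)
  ... | no _ with split ws (gen i · t · gen i) p
  ... | a , k , b , refl , q = i ∷ a , k , b , refl , (begin
    t ≡⟨ group (t ∷ []) (simple i ∷ []) x₀ (r₀ ⊗ (r₀ ⊗ x₀ ⊗ r₀) ⊗ r₀) refl ⟩
    gen i · (gen i · t · gen i) · gen i ≡⟨ cong (λ z → gen i · z · gen i) q ⟩
    gen i · (evalWord a · gen k · evalWord a ⁻¹) · gen i
      ≡⟨ group (evalWord a ∷ gen k ∷ []) (simple i ∷ []) (r₀ ⊗ (x₀ ⊗ x₁ ⊗ x₀ ⁻) ⊗ r₀) (r₀ ⊗ x₀ ⊗ x₁ ⊗ (r₀ ⊗ x₀) ⁻)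
          refl ⟩
    evalWord (i ∷ a) · gen k · evalWord (i ∷ a) ⁻¹ ∎)
    where open ≡-Reasoning

  delete-eval : ∀ a k b → (evalWord a · gen k · evalWord a ⁻¹) · evalWord (a ++ k ∷ b) ≡ evalWord (a ++ b)
  delete-eval a k b = begin
    (evalWord a · gen k · evalWord a ⁻¹) · evalWord (a ++ k ∷ b) ≡⟨ cong (_ ·_) (evalWord-++ a (k ∷ b)) ⟩
    (evalWord a · gen k · evalWord a ⁻¹) · (evalWord a · (gen k · evalWord b))
      ≡⟨ group (evalWord a ∷ evalWord b ∷ []) (simple k ∷ []) ((x₀ ⊗ r₀ ⊗ x₀ ⁻) ⊗ (x₀ ⊗ (r₀ ⊗ x₁))) (x₀ ⊗ x₁) refl
          ⟩
    evalWord a · evalWord b ≡⟨ sym (evalWord-++ a b) ⟩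
    evalWord (a ++ b) ∎
    where open ≡-Reasoning

  length-delete : ∀ (a : Word) k b → length (a ++ k ∷ b) ≡ suc (length (a ++ b))
  length-delete [] k b = refl
  length-delete (_ ∷ a) k b = cong suc (length-delete a k b)

  Split : W → Word → Set
  Split t ws = ∃ λ a → ∃ λ k → ∃ λ b →
    ws ≡ a ++ k ∷ b × t ≡ evalWord a · gen k · evalWord a ⁻¹ × t · evalWord ws ≡ evalWord (a ++ b)

  η-split : ∀ ws t → η (evalWord ws) t ≡ true → Split t ws
  η-split ws t p with split ws t (trans (sym (η-word ws t)) p)
  ... | a , k , b , refl , refl = a , k , b , refl , refl , delete-eval a k b

  -- An odd count means that `t` is one of the prefix reflections of a reduced word, and multiplying
  -- by it deletes the corresponding letter.
  η⇒< : ∀ {w t} → η w t ≡ true → ℓ (t · w) < ℓ w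
  η⇒< {w} {t} p with reducedWord w
  ... | ws , l , refl with η-split ws t p
  ... | a , k , b , refl , _ , q = subst₂ _<_ (cong ℓ (sym q)) (trans (sym (length-delete a k b)) l)
      (s≤s (ℓ≤length (a ++ b)))

  Reflection-gen : ∀ i → Reflection (gen i)
  Reflection-gen i = e , i , group [] (simple i ∷ []) r₀ (ε ⊗ r₀ ⊗ ε ⁻) refl

  conj : W → W → W
  conj x t = x · t · x ⁻¹

  Reflection-conj : ∀ x {t} → Reflection t → Reflection (conj x t)
  Reflection-conj x (y , i , refl) = x · y , i , group (x ∷ y ∷ gen i ∷ []) [] (x₀ ⊗ (x₁ ⊗ x₂ ⊗ x₁ ⁻) ⊗ x₀ ⁻)
      (x₀ ⊗ x₁ ⊗ x₂ ⊗ (x₀ ⊗ x₁) ⁻) refl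

  Reflection-inv : ∀ {t} → Reflection t → t · t ≡ e
  Reflection-inv (y , i , refl) = group (y ∷ []) (simple i ∷ []) ((x₀ ⊗ r₀ ⊗ x₀ ⁻) ⊗ (x₀ ⊗ r₀ ⊗ x₀ ⁻)) ε refl

  refl-involution : ∀ {t} → Reflection t → Involution
  refl-involution {t} r = t , Reflection-inv r

  Reflection≢e : ∀ {t} → Reflection t → t ≢ e
  Reflection≢e (y , i , refl) p = gen-nontrivial i (trans
    (group (y ∷ gen i ∷ []) [] x₁ (x₀ ⁻ ⊗ (x₀ ⊗ x₁ ⊗ x₀ ⁻) ⊗ x₀) refl)
    (trans (cong (λ z → y ⁻¹ · z · y) p) (group (y ∷ []) [] (x₀ ⁻ ⊗ ε ⊗ x₀) ε refl)))

  -- In the cocycle expansion along `y · gen i · y ⁻¹` the outer factors contribute the same value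
  -- twice; the middle one contributes `true`.
  η-self : ∀ {t} → Reflection t → η t t ≡ true
  η-self (y , i , refl) = begin
    η (y · gen i · y ⁻¹) t ≡⟨ η-· (y · gen i) (y ⁻¹) t ⟩
    η (y · gen i) t xor η (y ⁻¹) ((y · gen i) ⁻¹ · t · (y · gen i))
      ≡⟨ cong₂ _xor_ (η-· y (gen i) t) (cong (η (y ⁻¹))
          (group (y ∷ []) (simple i ∷ []) ((x₀ ⊗ r₀) ⁻ ⊗ (x₀ ⊗ r₀ ⊗ x₀ ⁻) ⊗ (x₀ ⊗ r₀))
              (x₀ ⁻ ⊗ (x₀ ⊗ r₀ ⊗ x₀ ⁻) ⊗ x₀) refl)) ⟩
    (η y t xor η (gen i) (y ⁻¹ · t · y)) xor η (y ⁻¹) (y ⁻¹ · t · y)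
      ≡⟨ cong₂ (λ p q → (η y t xor p) xor q)
          (trans (η-gen i _) (trans (cong (λ z → δ z (gen i))
              (group (y ∷ gen i ∷ []) [] (x₀ ⁻ ⊗ (x₀ ⊗ x₁ ⊗ x₀ ⁻) ⊗ x₀) x₁ refl)) (δ-refl _)))
          (η-inv y t) ⟩
    (η y t xor true) xor η y t ≡⟨ lem (η y t) ⟩
    true ∎
    where
    open ≡-Reasoning
    t = y · gen i · y ⁻¹
    lem : ∀ b → (b xor true) xor b ≡ true
    lem true = refl
    lem false = refl

  refl·refl· : ∀ {t} → Reflection t → ∀ x → t · (t · x) ≡ x
  refl·refl· r x = group (x ∷ []) (refl-involution r ∷ []) (r₀ ⊗ (r₀ ⊗ x₀)) x₀ refl

  -- The source of the converse of `η⇒<`: exactly one of `w` and `t · w` has `t` as an inversion, so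
  -- lengths decide `η`.
  η-flip : ∀ {t} → Reflection t → ∀ w → η (t · w) t ≡ not (η w t)
  η-flip {t} r w = trans (η-· t w t) (cong₂ _xor_ (η-self r)
    (cong (η w) (group [] (refl-involution r ∷ []) (r₀ ⁻ ⊗ r₀ ⊗ r₀) r₀ refl)))

  ¬η⇒> : ∀ {w t} → Reflection t → η w t ≡ false → ℓ w < ℓ (t · w)
  ¬η⇒> {w} {t} r p = subst (λ z → ℓ z < ℓ (t · w)) (refl·refl· r w) (η⇒< (trans (η-flip r w) (cong not p)))

  <⇒η : ∀ {w t} → Reflection t → ℓ (t · w) < ℓ w → η w t ≡ true
  <⇒η {w} {t} r q with η w t in eq
  ... | true = refl
  ... | false = ⊥-elim (ℕₚ.<-asym q (¬η⇒> r eq))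

  >⇒¬η : ∀ {w t} → ℓ w < ℓ (t · w) → η w t ≡ false
  >⇒¬η {w} {t} q with η w t in eq
  ... | false = refl
  ... | true = ⊥-elim (ℕₚ.<-asym q (η⇒< eq))

  refl-dichotomy : ∀ {t} → Reflection t → ∀ w → ℓ w < ℓ (t · w) ⊎ ℓ (t · w) < ℓ w
  refl-dichotomy {t} r w with η w t in eq
  ... | false = inj₁ (¬η⇒> r eq)
  ... | true  = inj₂ (η⇒< eq)

  ℓ-gen·-≥ : ∀ i x → ℓ x ≤ suc (ℓ (gen i · x))
  ℓ-gen·-≥ i x = subst (λ z → ℓ z ≤ suc (ℓ (gen i · x))) (gen·gen· i x) (ℓ-gen·≤ i (gen i · x))

  gen-dichotomy : ∀ i x → ℓ (gen i · x) ≡ suc (ℓ x) ⊎ ℓ x ≡ suc (ℓ (gen i · x))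
  gen-dichotomy i x with refl-dichotomy (Reflection-gen i) x
  ... | inj₁ p = inj₁ (ℕₚ.≤-antisym (ℓ-gen·≤ i x) p)
  ... | inj₂ p = inj₂ (ℕₚ.≤-antisym (ℓ-gen·-≥ i x) p)

  ℓ-·gen : ∀ x i → ℓ (x · gen i) ≡ ℓ (gen i · x ⁻¹)
  ℓ-·gen x i = trans (sym (ℓ-inv _)) (cong ℓ (group (x ∷ []) (simple i ∷ []) ((x₀ ⊗ r₀) ⁻) (r₀ ⊗ x₀ ⁻) refl))

  gen-dichotomyʳ : ∀ x i → ℓ (x · gen i) ≡ suc (ℓ x) ⊎ ℓ x ≡ suc (ℓ (x · gen i))
  gen-dichotomyʳ x i with gen-dichotomy i (x ⁻¹)
  ... | inj₁ p = inj₁ (trans (ℓ-·gen x i) (trans p (cong suc (ℓ-inv x))))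
  ... | inj₂ p = inj₂ (trans (sym (ℓ-inv x)) (trans p (cong suc (sym (ℓ-·gen x i)))))

  -- Subwords and supports.

  delete⊆ : ∀ (a : Word) {k b} → (a ++ b) ⊆ (a ++ k ∷ b)
  delete⊆ a {k} = Subₚ.++⁺ (⊆-refl {x = a}) (k ∷ʳ ⊆-refl)

  -- If a new first letter shortens the product, it is left out, and exchange deletes one more
  -- letter from the subword found so far.
  reducedSubword : ∀ ws → ∃ λ us → us ⊆ ws × evalWord us ≡ evalWord ws × length us ≡ ℓ (evalWord ws)
  reducedSubword [] = [] , [] , refl , sym ℓ-e
  reducedSubword (i ∷ ws) with reducedSubword ws
  ... | us , us⊆ , q , l with gen-dichotomy i (evalWord ws)
  ... | inj₁ p = i ∷ us , refl ∷ us⊆ , cong (gen i ·_) q , trans (cong suc l) (sym p)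
  ... | inj₂ p with η-split us (gen i) (<⇒η (Reflection-gen i)
      (subst (λ z → ℓ (gen i · z) < ℓ z) (sym q) (ℕₚ.≤-reflexive (sym p))))
  ... | a , k , b , refl , _ , del = a ++ b , i ∷ʳ ⊆-trans (delete⊆ a) us⊆ , trans (sym del) (cong (gen i ·_) q)
    , ℕₚ.suc-injective (trans (sym (length-delete a k b)) (trans l p))

  -- A reduced subword has length one, and `gen` is injective.
  letter-unique : ∀ i ws → evalWord ws ≡ gen i → i ∈ ws
  letter-unique i ws p with reducedSubword ws
  ... | us , us⊆ , q , l with trans l (trans (cong ℓ p) (ℓ-gen i))
  letter-unique i ws p | k ∷ [] , us⊆ , q , l | refl =
    Sub.lookup us⊆ (here (gen-injective i k (sym (trans (sym evalWord-[ k ]) (trans q p)))))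

  Parabolic : Word → W → Set
  Parabolic J x = ∃ λ ws → All (_∈ J) ws × evalWord ws ≡ x

  module _ {J : Word} where
    Parabolic-e : Parabolic J e
    Parabolic-e = [] , [] , refl

    Parabolic-gen : ∀ {i} → i ∈ J → Parabolic J (gen i)
    Parabolic-gen p = _ ∷ [] , p ∷ [] , evalWord-[ _ ]

    Parabolic-· : ∀ {x y} → Parabolic J x → Parabolic J y → Parabolic J (x · y)
    Parabolic-· (a , p , refl) (b , q , refl) = a ++ b , Allₚ.++⁺ p q , evalWord-++ a b

    Parabolic-inv : ∀ {x} → Parabolic J x → Parabolic J (x ⁻¹)
    Parabolic-inv (a , p , refl) = reverse a , All.tabulate (λ q → All.lookup p (Anyₚ.reverse⁻ q)) ,
        evalWord-reverse a

    Parabolic-gen⁻ : ∀ {i} → Parabolic J (gen i) → i ∈ J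
    Parabolic-gen⁻ {i} (a , p , q) = All.lookup p (letter-unique i a q)

    Parabolic-eval : ∀ {ws} → All (_∈ J) ws → Parabolic J (evalWord ws)
    Parabolic-eval p = _ , p , refl

    Parabolic-conj-split : ∀ a k → All (_∈ J) a → k ∈ J → Parabolic J (evalWord a · gen k · evalWord a ⁻¹)
    Parabolic-conj-split a k p q = Parabolic-· (Parabolic-· (Parabolic-eval p) (Parabolic-gen q))
        (Parabolic-inv (Parabolic-eval p))

  IsReduced : Word → Set
  IsReduced ws = ℓ (evalWord ws) ≡ length ws

  IsReduced-tail : ∀ {i ws} → IsReduced (i ∷ ws) → IsReduced ws
  IsReduced-tail {i} {ws} p = ℕₚ.≤-antisym (ℓ≤length ws)
    (ℕₚ.≤-pred (subst (_≤ suc (ℓ (evalWord ws))) p (ℓ-gen·≤ i (evalWord ws))))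

  -- The first letter `i` of `a` gives a left inversion of the product, so `gen i` is a letter of
  -- `b` conjugated by a prefix of `b`, and `Parabolic-gen⁻` puts `i` into `b`. Deleting that letter
  -- of `b` matches the tail of `a`.
  support : ∀ a b → IsReduced a → evalWord a ≡ evalWord b → All (_∈ b) a
  support [] b _ _ = []
  support (i ∷ a) b r p with η-split b (gen i) (<⇒η (Reflection-gen i)
    (subst (λ z → ℓ (gen i · z) < ℓ z) p (subst₂ _<_ (cong ℓ (sym (gen·gen· i _))) (sym r) (s≤s (ℓ≤length a)))))
  ... | b₁ , k , b₂ , refl , t , del = Parabolic-gen⁻ (subst (Parabolic _) (sym t)
          (Parabolic-conj-split b₁ k (All.tabulate ∈-++⁺ˡ) (∈-insert b₁)))
        ∷ All.map (Sub.lookup (delete⊆ b₁)) (support a (b₁ ++ b₂) (IsReduced-tail {i} {a} r)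
            (trans (sym (gen·gen· i _)) (trans (cong (gen i ·_) p) del)))

  -- Absolute length.

  reflection-word : ∀ {t} → Reflection t → ∃ λ g → ∃ λ i → t ≡ conj (evalWord g) (gen i)
  reflection-word (z , i , q) with generates z
  ... | g , refl = g , i , q

  module Dihedral {t t₁ : W} (rt : Reflection t) (rt₁ : Reflection t₁) where
    private
      τs : Vec Involution 2
      τs = refl-involution rt ∷ refl-involution rt₁ ∷ []

    y : W
    y = t · t₁

    -- The reflections of the subgroup generated by `t` and `t₁`: the orbits of both under
    -- conjugation by the rotation `y`. On a reflection this conjugation is multiplication by
    -- `y · y`; a single factor `y` passes from one orbit to the other, see `rotate`.
    data Ref : W → Set where
      base₁ : Ref t₁
      base  : Ref t
      up    : ∀ {ρ} → Ref ρ → Ref (conj y ρ)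
      down  : ∀ {ρ} → Ref ρ → Ref (conj (y ⁻¹) ρ)

    Ref⇒Reflection : ∀ {ρ} → Ref ρ → Reflection ρ
    Ref⇒Reflection base₁ = rt₁
    Ref⇒Reflection base = rt
    Ref⇒Reflection (up r) = Reflection-conj y (Ref⇒Reflection r)
    Ref⇒Reflection (down r) = Reflection-conj (y ⁻¹) (Ref⇒Reflection r)

    rotate : ∀ {ρ} → Ref ρ → Ref (y · ρ)
    rotate base₁ = subst Ref (group [] τs r₀ (r₀ ⊗ r₁ ⊗ r₁) refl) base
    rotate base = subst Ref (group [] τs (r₀ ⊗ r₁ ⊗ r₁ ⊗ (r₀ ⊗ r₁) ⁻) (r₀ ⊗ r₁ ⊗ r₀) refl) (up base₁)
    rotate (up {ρ} r) = subst Ref (group (y ∷ ρ ∷ []) [] (x₀ ⊗ (x₀ ⊗ x₁) ⊗ x₀ ⁻) (x₀ ⊗ (x₀ ⊗ x₁ ⊗ x₀ ⁻)) refl)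
        (up (rotate r))
    rotate (down {ρ} r) = subst Ref (group (y ∷ ρ ∷ []) [] (x₀ ⁻ ⊗ (x₀ ⊗ x₁) ⊗ x₀ ⁻ ⁻) (x₀ ⊗ (x₀ ⁻ ⊗ x₁ ⊗ x₀ ⁻ ⁻))
        refl) (down (rotate r))

    rotate⁻¹ : ∀ {ρ} → Ref ρ → Ref (y ⁻¹ · ρ)
    rotate⁻¹ base₁ = subst Ref (group [] τs ((r₀ ⊗ r₁) ⁻ ⊗ r₀ ⊗ (r₀ ⊗ r₁) ⁻ ⁻) ((r₀ ⊗ r₁) ⁻ ⊗ r₁) refl)
        (down base)
    rotate⁻¹ base = subst Ref (group [] τs r₁ ((r₀ ⊗ r₁) ⁻ ⊗ r₀) refl) base₁
    rotate⁻¹ (up {ρ} r) = subst Ref (group (y ∷ ρ ∷ []) [] (x₀ ⊗ (x₀ ⁻ ⊗ x₁) ⊗ x₀ ⁻) (x₀ ⁻ ⊗ (x₀ ⊗ x₁ ⊗ x₀ ⁻))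
        refl) (up (rotate⁻¹ r))
    rotate⁻¹ (down {ρ} r) = subst Ref (group (y ∷ ρ ∷ []) [] (x₀ ⁻ ⊗ (x₀ ⁻ ⊗ x₁) ⊗ x₀ ⁻ ⁻)
        (x₀ ⁻ ⊗ (x₀ ⁻ ⊗ x₁ ⊗ x₀ ⁻ ⁻)) refl) (down (rotate⁻¹ r))

    swap-y : ∀ {ρ} → Ref ρ → y ⁻¹ · ρ ≡ ρ · y
    swap-y base₁ = group [] τs ((r₀ ⊗ r₁) ⁻ ⊗ r₁) (r₁ ⊗ (r₀ ⊗ r₁)) refl
    swap-y base = group [] τs ((r₀ ⊗ r₁) ⁻ ⊗ r₀) (r₀ ⊗ (r₀ ⊗ r₁)) refl
    swap-y (up {ρ} r) = trans (group (y ∷ ρ ∷ []) [] (x₀ ⁻ ⊗ (x₀ ⊗ x₁ ⊗ x₀ ⁻)) (x₀ ⊗ (x₀ ⁻ ⊗ x₁) ⊗ x₀ ⁻) refl)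
      (trans (cong (λ z → y · z · y ⁻¹) (swap-y r)) (group (y ∷ ρ ∷ []) [] (x₀ ⊗ (x₁ ⊗ x₀) ⊗ x₀ ⁻)
          (x₀ ⊗ x₁ ⊗ x₀ ⁻ ⊗ x₀) refl))
    swap-y (down {ρ} r) = trans (group (y ∷ ρ ∷ []) [] (x₀ ⁻ ⊗ (x₀ ⁻ ⊗ x₁ ⊗ x₀ ⁻ ⁻)) (x₀ ⁻ ⊗ (x₀ ⁻ ⊗ x₁) ⊗ x₀)
        refl)
      (trans (cong (λ z → y ⁻¹ · z · y) (swap-y r)) (group (y ∷ ρ ∷ []) [] (x₀ ⁻ ⊗ (x₁ ⊗ x₀) ⊗ x₀)
          (x₀ ⁻ ⊗ x₁ ⊗ x₀ ⁻ ⁻ ⊗ x₀) refl))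

    rotateʳ : ∀ {ρ} → Ref ρ → Ref (ρ · y)
    rotateʳ r = subst Ref (swap-y r) (rotate⁻¹ r)

    -- Descent on the length of g in ρ = g s g⁻¹: if y inverts no reflection of the dihedral
    -- group then ρ inverts ρ y, which produces a reflection with a shorter g.
    y-inverts : y ≢ e → (∀ {ρ} → Ref ρ → η y ρ ≡ false) →
      ∀ n {ρ} → Ref ρ → ∀ g s → length g < n → ρ ≡ conj (evalWord g) (gen s) → ⊥
    y-inverts y≢e none (suc n) {ρ} r g s (s≤s len) refl = cases (η G σ) refl (δ (G ⁻¹ · σ · G) (gen s)) refl
        (η G (y · ρ)) refl total
      where
      G σ : W
      G = evalWord g
      σ = ρ · y

      total : (η G σ xor δ (G ⁻¹ · σ · G) (gen s)) xor η G (y · ρ) ≡ true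
      total = begin
        (η G σ xor δ (G ⁻¹ · σ · G) (gen s)) xor η G (y · ρ)
          ≡⟨ cong₂ (λ p q → (η G σ xor p) xor q) (sym (η-gen s _)) (sym (η-inv G (y · ρ))) ⟩
        (η G σ xor η (gen s) (G ⁻¹ · σ · G)) xor η (G ⁻¹) (G ⁻¹ · (y · ρ) · G)
          ≡⟨ cong₂ _xor_ (sym (η-· G (gen s) σ)) (cong (η (G ⁻¹))
               (group (G ∷ y ∷ []) (simple s ∷ []) (x₀ ⁻ ⊗ (x₁ ⊗ (x₀ ⊗ r₀ ⊗ x₀ ⁻)) ⊗ x₀)
                   ((x₀ ⊗ r₀) ⁻ ⊗ (x₀ ⊗ r₀ ⊗ x₀ ⁻ ⊗ x₁) ⊗ (x₀ ⊗ r₀)) refl)) ⟩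
        η (G · gen s) σ xor η (G ⁻¹) ((G · gen s) ⁻¹ · σ · (G · gen s)) ≡⟨ sym (η-· (G · gen s) (G ⁻¹) σ) ⟩
        η ρ σ ≡⟨ sym (xor-identityʳ _) ⟩
        η ρ σ xor false ≡⟨ cong (η ρ σ xor_) (sym (none (rotate r))) ⟩
        η ρ σ xor η y (y · ρ) ≡⟨ cong (λ z → η ρ σ xor η y z)
            (group (ρ ∷ y ∷ []) [] (x₁ ⊗ x₀) (x₀ ⁻ ⊗ (x₀ ⊗ x₁) ⊗ x₀) refl) ⟩
        η ρ σ xor η y (ρ ⁻¹ · σ · ρ) ≡⟨ sym (η-· ρ y σ) ⟩
        η σ σ ≡⟨ η-self (Ref⇒Reflection (rotateʳ r)) ⟩
        true ∎
        where open ≡-Reasoning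

      shorter : ∀ {μ} → Ref μ → η G μ ≡ true → ⊥
      shorter {μ} rμ p with η-split g μ p
      ... | a , k , b , g≡ , q , _ = y-inverts y≢e none n rμ a k
        (ℕₚ.<-≤-trans (subst (λ z → length a < length z) (sym g≡)
            (ℕₚ.≤-trans (s≤s (Subₚ.length-mono-≤ (Subₚ.++⁺ʳ b (⊆-refl {x = a}))))
           (ℕₚ.≤-reflexive (sym (length-delete a k b))))) len) q

      cases : ∀ a → η G σ ≡ a → ∀ b → δ (G ⁻¹ · σ · G) (gen s) ≡ b → ∀ c → η G (y · ρ) ≡ c →
          (η G σ xor δ (G ⁻¹ · σ · G) (gen s)) xor η G (y · ρ) ≡ true → ⊥
      cases true p _ _ _ _ _ = shorter (rotateʳ r) p
      cases false p _ _ true q _ = shorter (rotate r) q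
      cases false _ true q false _ _ = y≢e (·-cancelˡ ρ (trans σ≡ρ (sym (identityʳ ρ))))
        where
        σ≡ρ : σ ≡ ρ
        σ≡ρ = trans (group (G ∷ σ ∷ []) [] x₁ (x₀ ⊗ (x₀ ⁻ ⊗ x₁ ⊗ x₀) ⊗ x₀ ⁻) refl) (cong (conj G) (δ-true q))
      cases false p false q false s tot rewrite p | q | s with tot
      ... | ()

    -- If every `ρ · x` were at least as long as the peak, neither `x` nor `y · x` would have an
    -- inversion in `Ref`; by the cocycle rule neither would `y`, against `y-inverts`.
    peak : t ≢ t₁ → ∀ x → ℓ x < ℓ (t₁ · x) → ℓ (t · (t₁ · x)) < ℓ (t₁ · x) →
      (∀ {ρ} → Ref ρ → ¬ (ℓ (ρ · x) < ℓ (t₁ · x))) → ⊥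
    peak t≢t₁ x x< d< min with reflection-word rt₁
    ... | g , i , q = y-inverts y≢e none (suc (length g)) base₁ g i ℕₚ.≤-refl q
      where
      y≢e : y ≢ e
      y≢e p = t≢t₁ (trans (group [] τs r₀ (r₀ ⊗ r₁ ⊗ r₁) refl) (trans (cong (_· t₁) p) (identityˡ t₁)))
      no-inv : ∀ {ρ} → Ref ρ → η x ρ ≡ false
      no-inv {ρ} r with η x ρ in eq
      ... | false = refl
      ... | true = ⊥-elim (min r (ℕₚ.<-trans (η⇒< eq) x<))
      no-inv-y : ∀ {ρ} → Ref ρ → η (y · x) ρ ≡ false
      no-inv-y {ρ} r with η (y · x) ρ in eq
      ... | false = refl
      ... | true = ⊥-elim (min (rotateʳ r) (subst (λ z → ℓ z < ℓ (t₁ · x)) (sym (assoc ρ y x))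
        (ℕₚ.<-trans (η⇒< eq) (subst (λ z → ℓ z < ℓ (t₁ · x)) (sym (assoc t t₁ x)) d<))))
      none : ∀ {ρ} → Ref ρ → η y ρ ≡ false
      none {ρ} r = trans (sym (xor-identityʳ _)) (trans (cong (η y ρ xor_) (sym (no-inv (subst Ref
        (cong (y ⁻¹ · ρ ·_) (inv-inv y)) (down r))))) (trans (sym (η-· y x ρ)) (no-inv-y r)))

  -- The index bounds the number of ascents instead of counting them, because two equal neighbouring
  -- reflections cancel.
  data Path : W → ℕ → Set where
    start : ∀ {k} → Path e k
    step  : ∀ {w k t} → Path w k → Reflection t → ℓ w < ℓ (t · w) → Path (t · w) (suc k)

  Path-suc : ∀ {w k} → Path w k → Path w (suc k)
  Path-suc start = start
  Path-suc (step p r l) = step (Path-suc p) r l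

  -- Peaks of a path are removed inside dihedral reflection subgroups.
  Path-down : ∀ n {w k t} → ℓ w < n → Path w k → Reflection t → ℓ (t · w) < ℓ w → ¬ ¬ Path (t · w) (suc k)
  Path-down (suc n) {t = t} _ start r l _ with subst (ℓ (t · e) <_) ℓ-e l
  ... | ()
  Path-down (suc n) {t = t} (s≤s len) (step {x} {k} {t₁} p r₁' x<) r l ¬goal with t ≟ t₁
  ... | yes refl = ¬goal (subst (λ z → Path z _) (sym (refl·refl· r x)) (Path-suc (Path-suc p)))
  -- `ρ` and then `y · ρ` lead from `x` to the same end through `ρ · x`, which is lower than the
  -- peak; a descent met on the way is removed by recursion on the height.
  ... | no t≢t₁ = peak t≢t₁ x x< l λ {ρ} rρ b< →
    let refρ = Ref⇒Reflection rρ
        finish : ¬ Path (ρ · x) (suc k)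
        finish pb =
          let eq : y · ρ · (ρ · x) ≡ t · (t₁ · x)
              eq = group (t ∷ t₁ ∷ x ∷ []) (refl-involution refρ ∷ []) (x₀ ⊗ x₁ ⊗ r₀ ⊗ (r₀ ⊗ x₂)) (x₀ ⊗ (x₁ ⊗ x₂)) refl
              refσ = Ref⇒Reflection (rotate rρ)
          in case⊎ (refl-dichotomy refσ (ρ · x))
               (λ u → ¬goal (subst (λ z → Path z _) eq (step pb refσ u)))
               (λ d → Path-down n (ℕₚ.<-≤-trans b< len) pb refσ d λ q → ¬goal (subst (λ z → Path z _) eq q))
    in case⊎ (refl-dichotomy refρ x)
         (λ u → finish (step p refρ u))
         (λ d → Path-down n (ℕₚ.<-≤-trans x< len) p refρ d finish)
    where
    open Dihedral r r₁'
    case⊎ : {A B : Set} → A ⊎ B → (A → ⊥) → (B → ⊥) → ⊥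
    case⊎ (inj₁ a) f g = f a
    case⊎ (inj₂ b) f g = g b

  -- `peak` refutes the absence of a lower detour without naming one, hence the double negation;
  -- `absolute-length-≥` discharges it at a decidable inequality.
  Path-prod : ∀ {ts} → All Reflection ts → ¬ ¬ Path (prod ts) (length ts)
  Path-prod [] k = k start
  Path-prod {t ∷ ts} (r ∷ rs) ¬goal = Path-prod rs λ p → lem p (refl-dichotomy r (prod ts))
    where
    lem : Path (prod ts) (length ts) → ℓ (prod ts) < ℓ (t · prod ts) ⊎ ℓ (t · prod ts) < ℓ (prod ts) → ⊥
    lem p (inj₁ u) = ¬goal (step p r u)
    lem p (inj₂ d) = Path-down _ ℕₚ.≤-refl p r d ¬goal

  -- Walking the path back to `e`, strong exchange deletes one letter of the given word for each
  -- step.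
  Path-delete : ∀ {w k} → Path w k → ∀ ws → evalWord ws ≡ w →
    ∃ λ us → us ⊆ ws × evalWord us ≡ e × length ws ≤ k + length us
  Path-delete {k = k} start ws p = ws , ⊆-refl , p , ℕₚ.m≤n+m _ k
  Path-delete (step {w} {t = t} p r u) ws q with η-split ws t (subst (λ z → η z t ≡ true) (sym q)
    (trans (η-flip r w) (cong not (>⇒¬η u))))
  ... | a , k , b , refl , _ , del with Path-delete p (a ++ b)
      (trans (sym del) (trans (cong (t ·_) q) (refl·refl· r w)))
  ... | us , s , z , l = us , ⊆-trans s (delete⊆ a) , z , subst (_≤ _) (sym (length-delete a k b)) (s≤s l)

  Unique-⊆ : ∀ {us ws : Word} → us ⊆ ws → Unique ws → Unique us
  Unique-⊆ [] u = u
  Unique-⊆ (_ ∷ʳ s) (_ ∷ u) = Unique-⊆ s u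
  Unique-⊆ (refl ∷ s) (a ∷ u) = Subₚ.All-resp-⊆ s a ∷ Unique-⊆ s u

  -- Otherwise the first letter would be the inverse of the product of the others, and
  -- `letter-unique` would find it among them.
  Unique-eval≢e : ∀ {us} → Unique us → evalWord us ≡ e → us ≡ []
  Unique-eval≢e {[]} _ _ = refl
  Unique-eval≢e {i ∷ us} u p = ⊥-elim (Unique[x∷xs]⇒x∉xs u (Anyₚ.reverse⁻ (letter-unique i (reverse us)
    (trans (evalWord-reverse us) (trans (cong _⁻¹ (inv-unique _ _ p)) (inv-inv _))))))

  -- `Path-delete` leaves a word for `e` with distinct letters, hence the empty one: every letter
  -- was deleted, at most one per reflection.
  absolute-length-≥ : ∀ {ws ts} → Unique ws → All Reflection ts → prod ts ≡ evalWord ws → length ws ≤ length ts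
  absolute-length-≥ {ws} {ts} u rs q = decidable-stable (_ ℕₚ.≤? _) λ ¬le → Path-prod rs λ p → ¬le (bound p)
    where
    bound : Path (prod ts) (length ts) → length ws ≤ length ts
    bound p with Path-delete p ws (sym q)
    ... | us , s , z , l with Unique-eval≢e (Unique-⊆ s u) z
    ... | refl = subst (length ws ≤_) (ℕₚ.+-identityʳ _) l

  -- Reduced extensions and Demazure products.

  ℓ-·eval : ∀ x ws → ℓ (x · evalWord ws) ≤ ℓ x + length ws
  ℓ-·eval x ws = ℕₚ.≤-trans (ℓ-· x (evalWord ws)) (ℕₚ.+-monoʳ-≤ (ℓ x) (ℓ≤length ws))

  Red : W → Word → Set
  Red x ws = ℓ (x · evalWord ws) ≡ ℓ x + length ws

  module _ (x : W) (a b : Word) where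
    private
      xab : x · evalWord (a ++ b) ≡ x · evalWord a · evalWord b
      xab = trans (cong (x ·_) (evalWord-++ a b)) (sym (assoc _ _ _))

      len : ℓ x + length (a ++ b) ≡ ℓ x + length a + length b
      len = trans (cong (ℓ x +_) (Listₚ.length-++ a)) (sym (ℕₚ.+-assoc (ℓ x) _ _))

    Red-++⁻ˡ : Red x (a ++ b) → Red x a
    Red-++⁻ˡ r = ℕₚ.≤-antisym (ℓ-·eval x a) (ℕₚ.+-cancelʳ-≤ (length b) _ _
      (subst (_≤ ℓ (x · evalWord a) + length b) (trans (cong ℓ (sym xab)) (trans r len))
          (ℓ-·eval (x · evalWord a) b)))

    Red-++⁻ʳ : Red x (a ++ b) → Red (x · evalWord a) b
    Red-++⁻ʳ r = trans (cong ℓ (sym xab)) (trans r (trans len (cong (_+ length b) (sym (Red-++⁻ˡ r)))))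

    Red-++⁺ : Red x a → Red (x · evalWord a) b → Red x (a ++ b)
    Red-++⁺ p q = trans (cong ℓ xab) (trans q (trans (cong (_+ length b) p) (sym len)))

  Red-∷⁻ : ∀ x k ws → Red x (k ∷ ws) → ℓ (x · gen k) ≡ suc (ℓ x) × Red (x · gen k) ws
  Red-∷⁻ x k ws r =
      trans (cong (λ z → ℓ (x · z)) (sym evalWord-[ k ])) (trans (Red-++⁻ˡ x (k ∷ []) ws r) (ℕₚ.+-comm (ℓ x) 1))
    , subst (λ z → Red (x · z) ws) evalWord-[ k ] (Red-++⁻ʳ x (k ∷ []) ws r)

  Red-∷⁺ : ∀ x k ws → ℓ (x · gen k) ≡ suc (ℓ x) → Red (x · gen k) ws → Red x (k ∷ ws)
  Red-∷⁺ x k ws p q = Red-++⁺ x (k ∷ []) ws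
    (trans (cong (λ z → ℓ (x · z)) evalWord-[ k ]) (trans p (ℕₚ.+-comm 1 (ℓ x))))
    (subst (λ z → Red (x · z) ws) (sym evalWord-[ k ]) q)

  Red-e : ∀ {ws} → IsReduced ws → Red e ws
  Red-e {ws} r = trans (cong ℓ (identityˡ _)) (trans r (cong (_+ length ws) (sym ℓ-e)))

  Red-e⁻ : ∀ {ws} → Red e ws → IsReduced ws
  Red-e⁻ {ws} r = trans (cong ℓ (sym (identityˡ _))) (trans r (cong (_+ length ws) ℓ-e))

  IsReduced-++ʳ : ∀ a {b} → IsReduced (a ++ b) → IsReduced b
  IsReduced-++ʳ [] r = r
  IsReduced-++ʳ (i ∷ a) {b} r = IsReduced-++ʳ a (IsReduced-tail {i} {a ++ b} r)

  _⟶_ : W → W → Set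
  a ⟶ b = ∃ λ t → Reflection t × b ≡ t · a × ℓ a < ℓ b

  _≼_ : W → W → Set
  _≼_ = Star _⟶_

  ≼-ℓ : ∀ {a b} → a ≼ b → ℓ a ≤ ℓ b
  ≼-ℓ ε = ℕₚ.≤-refl
  ≼-ℓ ((_ , _ , _ , l) ◅ s) = ℕₚ.≤-trans (ℕₚ.<⇒≤ l) (≼-ℓ s)

  ≼-≡ : ∀ {a b} → a ≼ b → ℓ b ≤ ℓ a → a ≡ b
  ≼-≡ ε _ = refl
  ≼-≡ ((_ , _ , _ , l) ◅ s) q = ⊥-elim (ℕₚ.<⇒≱ l (ℕₚ.≤-trans (≼-ℓ s) q))

  η-·gen : ∀ w k t → η (w · gen k) t ≡ η w t xor δ (w ⁻¹ · t · w) (gen k)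
  η-·gen w k t = trans (η-· w (gen k) t) (cong (η w t xor_) (η-gen k _))

  ⟶-gen : ∀ x k → ℓ (x · gen k) ≡ suc (ℓ x) → x ⟶ (x · gen k)
  ⟶-gen x k p = conj x (gen k) , Reflection-conj x (Reflection-gen k)
    , group (x ∷ gen k ∷ []) [] (x₀ ⊗ x₁) (x₀ ⊗ x₁ ⊗ x₀ ⁻ ⊗ x₀) refl , ℕₚ.≤-reflexive (sym p)

  infixl 6 _⊳_ _⊳*_

  longer : ∀ x k → ℓ (x · gen k) ≡ suc (ℓ x) ⊎ ℓ x ≡ suc (ℓ (x · gen k)) → W
  longer x k (inj₁ _) = x · gen k
  longer x k (inj₂ _) = x

  -- The right action of the 0-Hecke monoid, iterated by `_⊳*_` to Demazure products. `longer` takes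
  -- the dichotomy as an argument so that proofs can split on it.
  _⊳_ : W → Fin rank → W
  x ⊳ k = longer x k (gen-dichotomyʳ x k)

  _⊳*_ : W → Word → W
  x ⊳* [] = x
  x ⊳* (k ∷ q) = (x ⊳ k) ⊳* q

  -- Multiplying `a` by `gen k` changes the status of one left inversion only, `conj a (gen k)`. So
  -- either `t` is this reflection and `t · a` equals `a · gen k`, or `t` still lengthens
  -- `a · gen k`.
  ⊳-mono-⟶ : ∀ {a b} k → a ⟶ b → (a ⊳ k) ≼ (b ⊳ k)
  ⊳-mono-⟶ {a} {b} k (t , r , refl , l) with gen-dichotomyʳ a k | gen-dichotomyʳ (t · a) k
  ... | inj₂ _ | inj₂ _ = (t , r , refl , l) ◅ ε
  ... | inj₂ _ | inj₁ q = (t , r , refl , l) ◅ ⟶-gen (t · a) k q ◅ ε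
  ... | inj₁ p | d with a ⁻¹ · t · a ≟ gen k
  ...   | yes q = lem d
    where
    ta≡ak : t · a ≡ a · gen k
    ta≡ak = trans (group (t ∷ a ∷ []) [] (x₀ ⊗ x₁) (x₁ ⊗ (x₁ ⁻ ⊗ x₀ ⊗ x₁)) refl) (cong (a ·_) q)
    lem : (d : ℓ (t · a · gen k) ≡ suc (ℓ (t · a)) ⊎ ℓ (t · a) ≡ suc (ℓ (t · a · gen k))) →
      (a · gen k) ≼ longer (t · a) k d
    lem (inj₁ u) = subst (_≼ (t · a · gen k)) ta≡ak (⟶-gen (t · a) k u ◅ ε)
    lem (inj₂ _) = subst (_≼ (t · a)) ta≡ak ε
  ...   | no ¬q = lem d
    where
    edge : (a · gen k) ⟶ (t · a · gen k)
    edge = t , r , assoc _ _ _ , subst (λ z → ℓ (a · gen k) < ℓ z) (sym (assoc t a (gen k)))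
      (¬η⇒> r (trans (η-·gen a k t) (trans (cong₂ _xor_ (>⇒¬η l) (δ-false ¬q)) refl)))
    lem : (d : ℓ (t · a · gen k) ≡ suc (ℓ (t · a)) ⊎ ℓ (t · a) ≡ suc (ℓ (t · a · gen k))) →
      (a · gen k) ≼ longer (t · a) k d
    lem (inj₁ u) = edge ◅ ε
    lem (inj₂ u) = edge ◅ subst (λ z → (t · a · gen k) ⟶ z)
        (group (t · a ∷ []) (simple k ∷ []) (x₀ ⊗ r₀ ⊗ r₀) x₀ refl)
      (⟶-gen (t · a · gen k) k (trans (cong ℓ (group (t · a ∷ []) (simple k ∷ []) (x₀ ⊗ r₀ ⊗ r₀) x₀ refl)) u)) ◅ ε

  ⊳-mono : ∀ {a b} k → a ≼ b → (a ⊳ k) ≼ (b ⊳ k)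
  ⊳-mono k ε = ε
  ⊳-mono k (x ◅ s) = ⊳-mono-⟶ k x ◅◅ ⊳-mono k s

  ⊳*-mono : ∀ {a b} q → a ≼ b → (a ⊳* q) ≼ (b ⊳* q)
  ⊳*-mono [] s = s
  ⊳*-mono (k ∷ q) s = ⊳*-mono q (⊳-mono k s)

  ⊳*-Red : ∀ x q → Red x q → x ⊳* q ≡ x · evalWord q
  ⊳*-Red x [] r = sym (identityʳ x)
  ⊳*-Red x (k ∷ q) r with gen-dichotomyʳ x k | Red-∷⁻ x k q r
  ... | inj₁ _ | _ , r' = trans (⊳*-Red (x · gen k) q r') (assoc _ _ _)
  ... | inj₂ u | p , _ = ⊥-elim (ℕₚ.<-asym (ℕₚ.≤-reflexive (sym p)) (ℕₚ.≤-reflexive (sym u)))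

  ⊳*-subword : ∀ x q → ∃ λ q' → q' ⊆ q × x ⊳* q ≡ x · evalWord q'
  ⊳*-subword x [] = [] , [] , sym (identityʳ x)
  ⊳*-subword x (k ∷ q) with gen-dichotomyʳ x k
  ... | inj₁ _ with ⊳*-subword (x · gen k) q
  ...   | q' , s , p = k ∷ q' , refl ∷ s , trans p (assoc _ _ _)
  ⊳*-subword x (k ∷ q) | inj₂ _ with ⊳*-subword x q
  ...   | q' , s , p = q' , k ∷ʳ s , p

  ⊳*-ℓ : ∀ x q → ℓ (x ⊳* q) ≤ ℓ x + length q
  ⊳*-ℓ x q with ⊳*-subword x q
  ... | q' , s , p = ℕₚ.≤-trans (subst (λ z → ℓ z ≤ ℓ x + length q') (sym p) (ℓ-·eval x q'))
      (ℕₚ.+-monoʳ-≤ (ℓ x) (Subₚ.length-mono-≤ s))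

  Red-or-shorter : ∀ x q → Red x q ⊎ ℓ (x ⊳* q) < ℓ x + length q
  Red-or-shorter x [] = inj₁ (trans (cong ℓ (identityʳ x)) (sym (ℕₚ.+-identityʳ _)))
  Red-or-shorter x (k ∷ q) with gen-dichotomyʳ x k
  ... | inj₂ _ = inj₂ (subst (ℓ (x ⊳* q) <_) (sym (ℕₚ.+-suc (ℓ x) (length q))) (s≤s (⊳*-ℓ x q)))
  ... | inj₁ p with Red-or-shorter (x · gen k) q
  ...   | inj₁ r = inj₁ (Red-∷⁺ x k q p r)
  ...   | inj₂ l = inj₂ (subst (ℓ (x · gen k ⊳* q) <_) (trans (cong (_+ length q) p)
      (sym (ℕₚ.+-suc (ℓ x) (length q)))) l)

  -- If x s q were not reduced, the Demazure product of x s with q would be an element x s q' above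
  -- x q of the same length, hence equal to it, which expresses s by letters of q.
  Red-insert : ∀ x s q → Red x q → ℓ (x · gen s) ≡ suc (ℓ x) → s ∉ q → Red x (s ∷ q)
  Red-insert x s q r p s∉q with Red-or-shorter (x · gen s) q
  ... | inj₁ r' = Red-∷⁺ x s q p r'
  ... | inj₂ l with ⊳*-subword (x · gen s) q
  ...   | q' , sub , eq = ⊥-elim (s∉q (Parabolic-gen⁻ (subst (Parabolic q) s≡ (Parabolic-·
            (Parabolic-eval (All.tabulate λ i∈q → i∈q)) (Parabolic-inv
                (Parabolic-eval (All.tabulate (Sub.lookup sub))))))))
    where
    xq≡ : x · evalWord q ≡ x · gen s · evalWord q'
    xq≡ = trans (trans (sym (⊳*-Red x q r)) (≼-≡ (⊳*-mono q (⟶-gen x s p ◅ ε))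
      (ℕₚ.≤-pred (subst (ℓ (x · gen s ⊳* q) <_) (trans (cong (_+ length q) p)
          (cong suc (trans (sym r) (cong ℓ (sym (⊳*-Red x q r)))))) l)))) eq
    s≡ : evalWord q · evalWord q' ⁻¹ ≡ gen s
    s≡ = trans (group (x ∷ evalWord q ∷ evalWord q' ∷ []) [] (x₁ ⊗ x₂ ⁻) (x₀ ⁻ ⊗ (x₀ ⊗ x₁) ⊗ x₂ ⁻) refl)
      (trans (cong (λ z → x ⁻¹ · z · evalWord q' ⁻¹) xq≡)
        (group (x ∷ gen s ∷ evalWord q' ∷ []) [] (x₀ ⁻ ⊗ (x₀ ⊗ x₁ ⊗ x₂) ⊗ x₂ ⁻) x₁ refl))

  -- Saturated chains, given by the reflections multiplied on the left.

  Asc : List W → W → Set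
  Asc [] x = ⊤
  Asc (τ ∷ ts) x = ℓ (τ · x) ≡ suc (ℓ x) × Asc ts (τ · x)

  end : List W → W → W
  end [] x = x
  end (τ ∷ ts) x = end ts (τ · x)

  On : W → List W → W → Set
  On v [] x = v ≡ x
  On v (τ ∷ ts) x = v ≡ x ⊎ On v ts (τ · x)

  On-start : ∀ ts {x} → On x ts x
  On-start [] = refl
  On-start (_ ∷ _) = inj₁ refl

  On-end-++ : ∀ as bs {x} → On (end as x) (as ++ bs) x
  On-end-++ [] bs = On-start bs
  On-end-++ (_ ∷ as) bs = inj₂ (On-end-++ as bs)

  end-++ : ∀ as bs x → end (as ++ bs) x ≡ end bs (end as x)
  end-++ [] bs x = refl
  end-++ (τ ∷ as) bs x = end-++ as bs (τ · x)

  Asc-++⁺ : ∀ as {bs x} → Asc as x → Asc bs (end as x) → Asc (as ++ bs) x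
  Asc-++⁺ [] _ q = q
  Asc-++⁺ (_ ∷ as) (l , p) q = l , Asc-++⁺ as p q

  Asc-++⁻ˡ : ∀ as {bs x} → Asc (as ++ bs) x → Asc as x
  Asc-++⁻ˡ [] _ = tt
  Asc-++⁻ˡ (_ ∷ as) (l , p) = l , Asc-++⁻ˡ as p

  Asc-++⁻ʳ : ∀ as {bs x} → Asc (as ++ bs) x → Asc bs (end as x)
  Asc-++⁻ʳ [] p = p
  Asc-++⁻ʳ (_ ∷ as) (l , p) = Asc-++⁻ʳ as p

  Asc-ℓ : ∀ ts {x} → Asc ts x → ℓ (end ts x) ≡ ℓ x + length ts
  Asc-ℓ [] _ = sym (ℕₚ.+-identityʳ _)
  Asc-ℓ (τ ∷ ts) {x} (l , p) = trans (Asc-ℓ ts p) (trans (cong (_+ length ts) l) (sym (ℕₚ.+-suc (ℓ x) _)))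

  -- Left translation of chains, and stripping a simple reflection

  conj-· : ∀ x t y → conj x t · (x · y) ≡ x · (t · y)
  conj-· x t y = group (x ∷ t ∷ y ∷ []) [] (x₀ ⊗ x₁ ⊗ x₀ ⁻ ⊗ (x₀ ⊗ x₂)) (x₀ ⊗ (x₁ ⊗ x₂)) refl

  conj-conj : ∀ x y t → conj x (conj y t) ≡ conj (x · y) t
  conj-conj x y t = group (x ∷ y ∷ t ∷ []) [] (x₀ ⊗ (x₁ ⊗ x₂ ⊗ x₁ ⁻) ⊗ x₀ ⁻) (x₀ ⊗ x₁ ⊗ x₂ ⊗ (x₀ ⊗ x₁) ⁻) refl

  conj-e : ∀ t → conj e t ≡ t
  conj-e t = group (t ∷ []) [] (ε ⊗ x₀ ⊗ ε ⁻) x₀ refl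

  conj-gen-gen : ∀ s t → conj (gen s) (conj (gen s) t) ≡ t
  conj-gen-gen s t = group (t ∷ []) (simple s ∷ []) (r₀ ⊗ (r₀ ⊗ x₀ ⊗ r₀ ⁻) ⊗ r₀ ⁻) x₀ refl

  map-conj-conj : ∀ x y ts → map (conj x) (map (conj y) ts) ≡ map (conj (x · y)) ts
  map-conj-conj x y ts = trans (sym (Listₚ.map-∘ ts)) (Listₚ.map-cong (conj-conj x y) ts)

  map-conj-e : ∀ ts → map (conj e) ts ≡ ts
  map-conj-e ts = trans (Listₚ.map-cong conj-e ts) (Listₚ.map-id ts)

  map-conj-gen-gen : ∀ s ts → map (conj (gen s)) (map (conj (gen s)) ts) ≡ ts
  map-conj-gen-gen s ts = trans (sym (Listₚ.map-∘ ts)) (trans (Listₚ.map-cong (conj-gen-gen s) ts)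
      (Listₚ.map-id ts))

  end-conj : ∀ x ts y → end (map (conj x) ts) (x · y) ≡ x · end ts y
  end-conj x [] y = refl
  end-conj x (τ ∷ ts) y = trans (cong (end (map (conj x) ts)) (conj-· x τ y)) (end-conj x ts (τ · y))

  All-conj : ∀ x {ts} → All Reflection ts → All Reflection (map (conj x) ts)
  All-conj x [] = []
  All-conj x (r ∷ rs) = Reflection-conj x r ∷ All-conj x rs

  -- The lifting property. In a reduced word of `τ · x` that starts with `s`, exchange by `τ`
  -- deletes either the first letter, and then `τ = gen s`, or a later one, and then `s` is a left
  -- descent of `x`, against the hypothesis.
  step-left : ∀ {τ x} s → Reflection τ → ℓ (τ · x) ≡ suc (ℓ x) → ℓ (gen s · (τ · x)) < ℓ (τ · x) →
    ℓ (gen s · x) ≡ suc (ℓ x) → τ ≡ gen s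
  step-left {τ} {x} s r up d u with reducedWord (gen s · (τ · x))
  ... | b , lb , q with η-split (s ∷ b) τ (subst (λ z → η z τ ≡ true) y≡
      (trans (η-flip r x) (cong not (>⇒¬η (ℕₚ.≤-reflexive (sym up))))))
    where
    y≡ : τ · x ≡ evalWord (s ∷ b)
    y≡ = trans (sym (gen·gen· s _)) (cong (gen s ·_) (sym q))
  ... | [] , k , b' , refl , t , _ = trans t (group [] (simple s ∷ []) (ε ⊗ r₀ ⊗ ε ⁻) r₀ refl)
  ... | i ∷ a , k , b' , refl , _ , del = ⊥-elim (ℕₚ.<-irrefl refl (begin-strict
      suc (ℓ x) ≡⟨ sym u ⟩
      ℓ (gen s · x) ≡⟨ cong ℓ (trans (cong (gen s ·_) x≡) (gen·gen· s _)) ⟩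
      ℓ (evalWord (a ++ b')) ≤⟨ ℓ≤length (a ++ b') ⟩
      length (a ++ b') <⟨ ℕₚ.≤-reflexive (sym (length-delete a k b')) ⟩
      length (a ++ k ∷ b') ≡⟨ lb ⟩
      ℓ (gen s · (τ · x)) <⟨ d ⟩
      ℓ (τ · x) ≡⟨ up ⟩
      suc (ℓ x) ∎))
    where
    open ℕₚ.≤-Reasoning
    x≡ : x ≡ evalWord (s ∷ a ++ b')
    x≡ = trans (sym (refl·refl· r x)) (trans (cong (τ ·_) (trans (sym (gen·gen· s _)) (cong (gen s ·_) (sym q))))
        del)

  -- The descent `s` travels from the end of the chain to its start by `step-left`, which could stop
  -- only at a step `gen s`. Left multiplication by `gen s` then lowers the whole chain by one.
  strip : ∀ s {ts x} → All Reflection ts → Asc ts x → gen s ∉ ts → ℓ (gen s · end ts x) < ℓ (end ts x) →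
    Asc (map (conj (gen s)) ts) (gen s · x) × ℓ x ≡ suc (ℓ (gen s · x))
  strip s {[]} {x} _ _ _ d with gen-dichotomy s x
  ... | inj₂ p = tt , p
  ... | inj₁ p = ⊥-elim (ℕₚ.<-asym d (ℕₚ.≤-reflexive (sym p)))
  strip s {τ ∷ ts} {x} (r ∷ rs) (l , p) s∉ d with strip s rs p (λ q → s∉ (there q)) d
  ... | q , l' with gen-dichotomy s x
  ...   | inj₁ u = ⊥-elim (s∉ (here (sym (step-left s r l (ℕₚ.≤-reflexive (sym l')) u))))
  ...   | inj₂ u = (trans (cong ℓ (conj-· (gen s) τ x)) (ℕₚ.suc-injective (trans (sym l') (trans l (cong suc u))))
                   , subst (Asc (map (conj (gen s)) ts)) (sym (conj-· (gen s) τ x)) q) , u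

  -- The translated chain stays exactly one above the original, so a step by `gen s` on it would
  -- fall back onto the original chain and go down.
  no-step : ∀ s ts {y} → Asc ts y → Asc (map (conj (gen s)) ts) (gen s · y) → ℓ (gen s · y) ≡ suc (ℓ y) →
    gen s ∉ map (conj (gen s)) ts
  no-step s (τ ∷ ts) {y} (l , p) (l' , p') u (here q) = ℕₚ.<-irrefl (trans (cong ℓ (sym y≡)) l')
      (ℕₚ.<-trans (ℕₚ.n<1+n _) (s≤s (ℕₚ.≤-reflexive (sym u))))
    where
    y≡ : conj (gen s) τ · (gen s · y) ≡ y
    y≡ = trans (cong (_· (gen s · y)) (sym q)) (gen·gen· s y)
  no-step s (τ ∷ ts) {y} (l , p) (l' , p') u (there q) = no-step s ts p
      (subst (Asc (map (conj (gen s)) ts)) (conj-· (gen s) τ y) p')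
    (trans (cong ℓ (sym (conj-· (gen s) τ y))) (trans l' (cong suc (trans u (sym l))))) q

  -- The end is longer than `x` by the number of letters of `s ∷ cs`; without `s`, the letters of
  -- `cs` can add no more than `length cs`.
  end-descent : ∀ s cs ts {x} → Asc ts x → end ts x ≡ evalWord (s ∷ cs) · x → length ts ≡ suc (length cs) →
    ℓ (gen s · end ts x) < ℓ (end ts x)
  end-descent s cs ts {x} p q l = begin-strict
    ℓ (gen s · end ts x) ≡⟨ cong (λ z → ℓ (gen s · z)) q ⟩
    ℓ (gen s · (evalWord (s ∷ cs) · x)) ≡⟨ cong ℓ (group (evalWord cs ∷ x ∷ []) (simple s ∷ [])
        (r₀ ⊗ (r₀ ⊗ x₀ ⊗ x₁)) (x₀ ⊗ x₁) refl) ⟩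
    ℓ (evalWord cs · x) ≤⟨ ℓ-· _ _ ⟩
    ℓ (evalWord cs) + ℓ x ≤⟨ ℕₚ.+-monoˡ-≤ (ℓ x) (ℓ≤length cs) ⟩
    length cs + ℓ x <⟨ ℕₚ.n<1+n _ ⟩
    suc (length cs) + ℓ x ≡⟨ cong (_+ ℓ x) (sym l) ⟩
    length ts + ℓ x ≡⟨ ℕₚ.+-comm (length ts) _ ⟩
    ℓ x + length ts ≡⟨ sym (Asc-ℓ ts p) ⟩
    ℓ (end ts x) ∎
    where open ℕₚ.≤-Reasoning

  Unique-↭ : ∀ {as bs : Word} → as ↭ bs → Unique as → Unique bs
  Unique-↭ p = Permₛ.Unique-resp-↭ (setoid _) (↭⇒↭ₛ p)

  Unique-rotate : ∀ {s} {cs : Word} → Unique (s ∷ cs) → Unique (cs ++ s ∷ [])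
  Unique-rotate {s} {cs} = Unique-↭ (∷↭∷ʳ s cs)

  -- Nest c us: us is a subword of c c c ⋯ in which a letter, once skipped, is never used again.

  data Nest : Word → Word → Set where
    nil  : Nest [] []
    take : ∀ {s cs us} → Nest (cs ++ s ∷ []) us → Nest (s ∷ cs) (s ∷ us)
    skip : ∀ {s cs us} → Nest cs us → Nest (s ∷ cs) us

  Nest-letters : ∀ {cs us} → Nest cs us → All (_∈ cs) us
  Nest-letters nil = []
  Nest-letters (skip n) = All.map there (Nest-letters n)
  Nest-letters (take {s} {cs} n) = here refl ∷ All.map lem (Nest-letters n)
    where
    lem : ∀ {k} → k ∈ cs ++ s ∷ [] → k ∈ s ∷ cs
    lem q with ∈-++⁻ cs q
    ... | inj₁ r = there r
    ... | inj₂ (here r) = here r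

  -- The chain from u to c u which inserts each letter of c into u at the place where it is first skipped.
  chain : ∀ {cs us} → Nest cs us → List W
  chain nil = []
  chain (take {s} n) = map (conj (gen s)) (chain n)
  chain (skip {s} n) = gen s ∷ map (conj (gen s)) (chain n)

  chain-reflections : ∀ {cs us} (n : Nest cs us) → All Reflection (chain n)
  chain-reflections nil = []
  chain-reflections (take n) = All-conj _ (chain-reflections n)
  chain-reflections (skip n) = Reflection-gen _ ∷ All-conj _ (chain-reflections n)

  chain-length : ∀ {cs us} (n : Nest cs us) → length (chain n) ≡ length cs
  chain-length nil = refl
  chain-length (take {s} {cs} n) = trans (Listₚ.length-map _ (chain n)) (trans (chain-length n)
    (trans (Listₚ.length-++ cs) (ℕₚ.+-comm _ 1)))
  chain-length (skip n) = cong suc (trans (Listₚ.length-map _ (chain n)) (chain-length n))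

  chain-end : ∀ {cs us} (n : Nest cs us) x → end (chain n) x ≡ evalWord cs · x
  chain-end nil x = sym (identityˡ x)
  chain-end (take {s} {cs} n) x = begin
    end (map (conj (gen s)) (chain n)) x ≡⟨ cong (end (map (conj (gen s)) (chain n))) (sym (gen·gen· s x)) ⟩
    end (map (conj (gen s)) (chain n)) (gen s · (gen s · x)) ≡⟨ end-conj (gen s) (chain n) _ ⟩
    gen s · end (chain n) (gen s · x) ≡⟨ cong (gen s ·_) (chain-end n (gen s · x)) ⟩
    gen s · (evalWord (cs ++ s ∷ []) · (gen s · x)) ≡⟨ cong (λ z → gen s · (z · (gen s · x)))
        (trans (evalWord-++ cs (s ∷ [])) (cong (evalWord cs ·_) evalWord-[ s ])) ⟩
    gen s · (evalWord cs · gen s · (gen s · x)) ≡⟨ group (evalWord cs ∷ x ∷ []) (simple s ∷ [])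
        (r₀ ⊗ (x₀ ⊗ r₀ ⊗ (r₀ ⊗ x₁))) (r₀ ⊗ x₀ ⊗ x₁) refl ⟩
    evalWord (s ∷ cs) · x ∎
    where open ≡-Reasoning
  chain-end (skip {s} n) x = trans (end-conj (gen s) (chain n) x)
      (trans (cong (gen s ·_) (chain-end n x)) (sym (assoc _ _ _)))

  ∉-++ : ∀ {s : Fin rank} {as bs : Word} → s ∉ as → s ∉ bs → s ∉ as ++ bs
  ∉-++ {as = as} p q r with ∈-++⁻ as r
  ... | inj₁ i = p i
  ... | inj₂ i = q i

  -- `x` collects the letters taken so far. A skipped `s` does not occur in `us`, and it lengthens
  -- `x` because `s ∷ cs ++ us` is a reduced extension of `x`; so `Red-insert` makes the next
  -- element longer by one.
  chain-Asc : ∀ {cs us} (n : Nest cs us) → Unique cs → ∀ x → Red x us → Red x (cs ++ us) →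
    Asc (map (conj x) (chain n)) (x · evalWord us)
  chain-Asc nil _ _ _ _ = tt
  chain-Asc (take {s} {cs} {us} n) u x r r' = subst₂ Asc (sym (map-conj-conj x (gen s) (chain n))) (assoc _ _ _)
    (chain-Asc n (Unique-rotate u) (x · gen s) (proj₂ (Red-∷⁻ x s us r))
      (subst (Red (x · gen s)) (sym (Listₚ.++-assoc cs (s ∷ []) us)) (proj₂ (Red-∷⁻ x s (cs ++ s ∷ us) r'))))
  chain-Asc (skip {s} {cs} {us} n) u@(_ ∷ u') x r r' =
      (trans (cong ℓ eq) (trans r″ (trans (ℕₚ.+-suc (ℓ x) (length us)) (cong suc (sym r)))))
    , subst₂ Asc (sym (map-conj-conj x (gen s) (chain n))) (trans (assoc _ _ _) (sym eq))
        (chain-Asc n u' (x · gen s) (proj₂ (Red-∷⁻ x s us r″)) (proj₂ (Red-∷⁻ x s (cs ++ us) r')))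
    where
    eq : conj x (gen s) · (x · evalWord us) ≡ x · evalWord (s ∷ us)
    eq = conj-· x (gen s) (evalWord us)
    r″ : Red x (s ∷ us)
    r″ = Red-insert x s us r (proj₁ (Red-∷⁻ x s (cs ++ us) r'))
        (λ q → Unique[x∷xs]⇒x∉xs u (All.lookup (Nest-letters n) q))

  chain-Asc-e : ∀ {cs us} (n : Nest cs us) → Unique cs → IsReduced us → IsReduced (cs ++ us) → Asc (chain n)
      (evalWord us)
  chain-Asc-e {cs} {us} n u r r' = subst₂ Asc (map-conj-e (chain n)) (identityˡ _)
    (chain-Asc n u e (Red-e {us} r) (Red-e {cs ++ us} r'))

  Red-gen : ∀ {s ws} → IsReduced (s ∷ ws) → Red (gen s) ws
  Red-gen {s} {ws} r = trans r (cong (_+ length ws) (sym (ℓ-gen s)))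

  -- `no-step` is applied to the chain that starts at `evalWord us`, but its conclusion concerns the
  -- reflections alone and permits stripping `s` from the chain at any other start `x`. A taken
  -- letter is thereby split off `x` on the left; a skipped one leaves `x` as it is, since the first
  -- step has already multiplied by `gen s`.
  chain-minimal : ∀ {cs us} (n : Nest cs us) → Unique cs → IsReduced us → IsReduced (cs ++ us) →
    ∀ x → Asc (chain n) x → ℓ x ≡ length us + ℓ (evalWord us ⁻¹ · x)
  chain-minimal nil _ _ _ x _ = cong ℓ (group (x ∷ []) [] x₀ (ε ⁻ ⊗ x₀) refl)
  chain-minimal (take {s} {cs} {us} n) u r r' x p = trans (proj₂ st) (cong suc (trans
      (chain-minimal n (Unique-rotate u) rt rt' (gen s · x)
          (subst (λ z → Asc z (gen s · x)) (map-conj-gen-gen s (chain n)) (proj₁ st)))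
      (cong (λ z → length us + ℓ z) (group (evalWord us ∷ x ∷ []) (simple s ∷ []) (x₀ ⁻ ⊗ (r₀ ⊗ x₁))
          ((r₀ ⊗ x₀) ⁻ ⊗ x₁) refl))))
    where
    rt = IsReduced-tail {s} {us} r
    eqc = Listₚ.++-assoc cs (s ∷ []) us
    r″ : IsReduced (s ∷ (cs ++ s ∷ []) ++ us)
    r″ = subst (λ z → IsReduced (s ∷ z)) (sym eqc) r'
    rt' : IsReduced ((cs ++ s ∷ []) ++ us)
    rt' = IsReduced-tail {s} {(cs ++ s ∷ []) ++ us} r″
    ascs = chain-Asc n (Unique-rotate u) (gen s) (Red-gen {s} {us} r) (Red-gen {s} {(cs ++ s ∷ []) ++ us} r″)
    nos = no-step s (chain n) (chain-Asc-e n (Unique-rotate u) rt rt') ascs (trans r (cong suc (sym rt)))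
    st = strip s (All-conj _ (chain-reflections n)) p nos
      (end-descent s cs (chain (take n)) p (chain-end (take n) x) (chain-length (take n)))
  chain-minimal (skip {s} {cs} {us} n) u@(_ ∷ u') r r' x (l , p) =
    chain-minimal n u' r rt' x (subst₂ Asc (map-conj-gen-gen s (chain n)) (gen·gen· s x) (proj₁ st))
    where
    rt' = IsReduced-tail {s} {cs ++ us} r'
    ds : ℓ (e · gen s) ≡ suc (ℓ e)
    ds = proj₁ (Red-∷⁻ e s (cs ++ us) (Red-e {s ∷ cs ++ us} r'))
    rs : IsReduced (s ∷ us)
    rs = Red-e⁻ {s ∷ us} (Red-insert e s us (Red-e {us} r) ds
        (λ q → Unique[x∷xs]⇒x∉xs u (All.lookup (Nest-letters n) q)))
    ascs = chain-Asc n u' (gen s) (Red-gen {s} {us} rs) (Red-gen {s} {cs ++ us} r')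
    nos = no-step s (chain n) (chain-Asc-e n u' r rt') ascs (trans rs (cong suc (sym r)))
    st = strip s (All-conj _ (chain-reflections n)) p nos
      (end-descent s cs (chain (skip n)) {x} (l , p) (chain-end (skip n) x) (chain-length (skip n)))

  -- Inserting the letters left out of the first round

  insertions : ∀ {is cs : Word} → is ⊆ cs → List W
  insertions [] = []
  insertions (k ∷ʳ p) = gen k ∷ map (conj (gen k)) (insertions p)
  insertions (_∷_ {s} _ p) = map (conj (gen s)) (insertions p)

  insertions-reflections : ∀ {is cs} (p : is ⊆ cs) → All Reflection (insertions p)
  insertions-reflections [] = []
  insertions-reflections (k ∷ʳ p) = Reflection-gen k ∷ All-conj _ (insertions-reflections p)
  insertions-reflections (_ ∷ p) = All-conj _ (insertions-reflections p)

  insertions-end : ∀ {is cs} (p : is ⊆ cs) x → end (insertions p) (evalWord is · x) ≡ evalWord cs · x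
  insertions-end [] x = refl
  insertions-end (k ∷ʳ p) x = trans (end-conj (gen k) (insertions p) _)
      (trans (cong (gen k ·_) (insertions-end p x)) (sym (assoc _ _ _)))
  insertions-end (_∷_ {s} refl p) x = trans (cong (end (map (conj (gen s)) (insertions p))) (assoc _ _ _))
    (trans (end-conj (gen s) (insertions p) _) (trans (cong (gen s ·_) (insertions-end p x)) (sym (assoc _ _ _))))

  -- The hypothesis on `us` keeps a letter left out of `is` from occurring in `us`, so `Red-insert`
  -- applies; reducedness of `cs` after `x` provides the ascent.
  insertions-Asc : ∀ {is cs us} (p : is ⊆ cs) → Unique cs → (∀ {k} → k ∈ us → k ∈ cs → k ∈ is) →
    ∀ x → Red x cs → Red x (is ++ us) → Asc (map (conj x) (insertions p)) (x · evalWord (is ++ us))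
  insertions-Asc [] _ _ _ _ _ = tt
  insertions-Asc {is} {k ∷ cs} {us} (k ∷ʳ p) u@(_ ∷ u') f x r r' =
      (trans (cong ℓ eq) (trans r″ (trans (ℕₚ.+-suc (ℓ x) (length (is ++ us))) (cong suc (sym r')))))
    , subst₂ Asc (sym (map-conj-conj x (gen k) (insertions p))) (trans (assoc _ _ _) (sym eq))
        (insertions-Asc p u' (λ q i → f q (there i)) (x · gen k) (proj₂ (Red-∷⁻ x k cs r))
            (proj₂ (Red-∷⁻ x k (is ++ us) r″)))
    where
    k∉is : k ∉ is
    k∉is q = Unique[x∷xs]⇒x∉xs u (Sub.lookup p q)
    eq : conj x (gen k) · (x · evalWord (is ++ us)) ≡ x · evalWord (k ∷ is ++ us)
    eq = conj-· x (gen k) (evalWord (is ++ us))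
    r″ : Red x (k ∷ is ++ us)
    r″ = Red-insert x k (is ++ us) r' (proj₁ (Red-∷⁻ x k cs r)) (∉-++ k∉is (λ q → k∉is (f q (here refl))))
  insertions-Asc {s ∷ is} {s ∷ cs} {us} (refl ∷ p) u@(_ ∷ u') f x r r' =
    subst₂ Asc (sym (map-conj-conj x (gen s) (insertions p))) (assoc _ _ _)
      (insertions-Asc p u' f' (x · gen s) (proj₂ (Red-∷⁻ x s cs r)) (proj₂ (Red-∷⁻ x s (is ++ us) r')))
    where
    f' : ∀ {k} → k ∈ us → k ∈ cs → k ∈ is
    f' q i with f q (there i)
    ... | there j = j
    ... | here refl = ⊥-elim (Unique[x∷xs]⇒x∉xs u i)

  insertions-length : ∀ {is cs} (p : is ⊆ cs) → length is + length (insertions p) ≡ length cs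
  insertions-length [] = refl
  insertions-length {is} (k ∷ʳ p) = trans (ℕₚ.+-suc (length is) _) (cong suc
    (trans (cong (length is +_) (Listₚ.length-map _ (insertions p))) (insertions-length p)))
  insertions-length {s ∷ is} (refl ∷ p) = cong suc
    (trans (cong (length is +_) (Listₚ.length-map _ (insertions p))) (insertions-length p))

  -- `ds` accumulates the letters that were taken earlier in the round and queue up for the next
  -- one. With `ds` empty at the outset, exactly the letters of `is` survive the round.
  Nest-round : ∀ cs {ds vs} → Nest (cs ++ ds) vs → ∃ λ is → ∃ λ us → is ⊆ cs × vs ≡ is ++ us × Nest (ds ++ is) us
  Nest-round [] {ds} {vs} n = [] , vs , [] , refl , subst (λ z → Nest z vs) (sym (Listₚ.++-identityʳ ds)) n
  Nest-round (c ∷ cs) (skip n) with Nest-round cs n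
  ... | is , us , p , q , n' = is , us , c ∷ʳ p , q , n'
  Nest-round (c ∷ cs) {ds} (take {us = vs} n) with Nest-round cs
      (subst (λ z → Nest z vs) (Listₚ.++-assoc cs ds (c ∷ [])) n)
  ... | is , us , p , q , n' = c ∷ is , us , refl ∷ p , cong (c ∷_) q , subst (λ z → Nest z us)
      (Listₚ.++-assoc ds (c ∷ []) is) n'

  Unique⇒IsReduced : ∀ {cs} → Unique cs → IsReduced cs
  Unique⇒IsReduced {[]} _ = ℓ-e
  Unique⇒IsReduced {s ∷ cs} u@(_ ∷ u') = Red-e⁻ {s ∷ cs} (Red-insert e s cs (Red-e {cs} (Unique⇒IsReduced u'))
    (trans (cong ℓ (identityˡ _)) (trans (ℓ-gen s) (cong suc (sym ℓ-e)))) (Unique[x∷xs]⇒x∉xs u))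

  -- `minimal` is the left weak order after inversion: `u` is a prefix of `x`, expressed by lengths.
  -- `target` holds at every `x`; at `e` it yields the product of the reflections.
  record MinimalChain (cs : Word) (v : W) : Set where
    field
      ts      : List W
      u       : W
      refls   : All Reflection ts
      asc     : Asc ts u
      size    : length ts ≡ length cs
      target  : ∀ x → end ts x ≡ evalWord cs · x
      on      : On v ts u
      minimal : ∀ x → Asc ts x → ℓ x ≡ ℓ u + ℓ (u ⁻¹ · x)

  -- With is the letters used in the first round, first the letters of is are inserted into the remaining
  -- rounds, which reaches v, and then the unused letters.
  minimalChain : ∀ {cs vs} → Unique cs → Nest cs vs → IsReduced vs → MinimalChain cs (evalWord vs)
  minimalChain {cs} u n r with Nest-round cs (subst (λ z → Nest z _) (sym (Listₚ.++-identityʳ cs)) n)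
  ... | is , us , p , refl , n' = record
    { ts = chain n' ++ insertions p
    ; u = evalWord us
    ; refls = Allₚ.++⁺ (chain-reflections n') (insertions-reflections p)
    ; asc = Asc-++⁺ (chain n') (chain-Asc-e n' uᵢ rᵤ r) (subst₂ Asc (map-conj-e (insertions p))
        (trans (identityˡ _) (trans (evalWord-++ is us) (sym (chain-end n' (evalWord us)))))
        (insertions-Asc p u (λ q _ → All.lookup (Nest-letters n') q) e (Red-e {cs} (Unique⇒IsReduced u))
            (Red-e {is ++ us} r)))
    ; size = trans (Listₚ.length-++ (chain n')) (trans (cong (_+ length (insertions p)) (chain-length n'))
        (insertions-length p))
    ; target = λ x → trans (end-++ (chain n') (insertions p) x)
        (trans (cong (end (insertions p)) (chain-end n' x)) (insertions-end p x))
    ; on = subst (λ z → On z (chain n' ++ insertions p) (evalWord us))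
        (trans (chain-end n' (evalWord us)) (sym (evalWord-++ is us))) (On-end-++ (chain n') (insertions p))
    ; minimal = λ x a → trans (chain-minimal n' uᵢ rᵤ r x (Asc-++⁻ˡ (chain n') a))
        (cong (_+ ℓ (evalWord us ⁻¹ · x)) (sym rᵤ))
    }
    where
    uᵢ = Unique-⊆ p u
    rᵤ = IsReduced-++ʳ is r

  -- Steps and elements of a chain

  Step : Fin rank → List W → W → Set
  Step d [] x = ⊥
  Step d (τ ∷ ts) x = τ · x ≡ x · gen d ⊎ Step d ts (τ · x)

  Step-++⁺ˡ : ∀ d as {bs x} → Step d as x → Step d (as ++ bs) x
  Step-++⁺ˡ d (_ ∷ as) (inj₁ p) = inj₁ p
  Step-++⁺ˡ d (_ ∷ as) (inj₂ p) = inj₂ (Step-++⁺ˡ d as p)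

  Step-++⁺ʳ : ∀ d as {bs x} → Step d bs (end as x) → Step d (as ++ bs) x
  Step-++⁺ʳ d [] p = p
  Step-++⁺ʳ d (_ ∷ as) p = inj₂ (Step-++⁺ʳ d as p)

  Step-++⁻ : ∀ d as {bs x} → Step d (as ++ bs) x → Step d as x ⊎ Step d bs (end as x)
  Step-++⁻ d [] p = inj₂ p
  Step-++⁻ d (_ ∷ as) (inj₁ p) = inj₁ (inj₁ p)
  Step-++⁻ d (_ ∷ as) (inj₂ p) with Step-++⁻ d as p
  ... | inj₁ q = inj₁ (inj₂ q)
  ... | inj₂ q = inj₂ q

  Step-conj : ∀ d y ts {x} → Step d ts x → Step d (map (conj y) ts) (y · x)
  Step-conj d y (τ ∷ ts) {x} (inj₁ p) = inj₁ (trans (conj-· y τ x) (trans (cong (y ·_) p) (sym (assoc _ _ _))))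
  Step-conj d y (τ ∷ ts) {x} (inj₂ p) = inj₂ (subst (Step d (map (conj y) ts)) (sym (conj-· y τ x))
      (Step-conj d y ts p))

  On-conj : ∀ y ts {v x} → On v ts x → On (y · v) (map (conj y) ts) (y · x)
  On-conj y [] p = cong (y ·_) p
  On-conj y (τ ∷ ts) (inj₁ p) = inj₁ (cong (y ·_) p)
  On-conj y (τ ∷ ts) {v} {x} (inj₂ p) = inj₂ (subst (On (y · v) (map (conj y) ts)) (sym (conj-· y τ x))
      (On-conj y ts p))

  On-++⁺ˡ : ∀ as {bs v x} → On v as x → On v (as ++ bs) x
  On-++⁺ˡ [] {bs} refl = On-start bs
  On-++⁺ˡ (_ ∷ as) (inj₁ p) = inj₁ p
  On-++⁺ˡ (_ ∷ as) (inj₂ p) = inj₂ (On-++⁺ˡ as p)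

  On-++⁺ʳ : ∀ as {bs v x} → On v bs (end as x) → On v (as ++ bs) x
  On-++⁺ʳ [] p = p
  On-++⁺ʳ (_ ∷ as) p = inj₂ (On-++⁺ʳ as p)

  On-++⁻ : ∀ as {bs v x} → On v (as ++ bs) x → On v as x ⊎ On v bs (end as x)
  On-++⁻ [] p = inj₂ p
  On-++⁻ (_ ∷ as) (inj₁ p) = inj₁ (inj₁ p)
  On-++⁻ (_ ∷ as) (inj₂ p) with On-++⁻ as p
  ... | inj₁ q = inj₁ (inj₂ q)
  ... | inj₂ q = inj₂ q

  On-end : ∀ as {x} → On (end as x) as x
  On-end [] = refl
  On-end (_ ∷ as) = inj₂ (On-end as)

  strip-On : ∀ s ts {x v} → All Reflection ts → Asc ts x → gen s ∉ ts → ℓ (gen s · end ts x) < ℓ (end ts x) →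
    On v ts x → ℓ v ≡ suc (ℓ (gen s · v))
  strip-On s [] rs p s∉ d refl = proj₂ (strip s rs p s∉ d)
  strip-On s (τ ∷ ts) rs p s∉ d (inj₁ refl) = proj₂ (strip s rs p s∉ d)
  strip-On s (τ ∷ ts) (r ∷ rs) (l , p) s∉ d (inj₂ o) = strip-On s ts rs p (λ q → s∉ (there q)) d o

  no-descent-step : ∀ d ts {x} → Asc ts x → (∀ v → On v ts x → ℓ (v · gen d) < ℓ v) → ¬ Step d ts x
  no-descent-step d (τ ∷ ts) {x} (l , p) f (inj₁ q) = ℕₚ.<-asym
      (subst (λ z → ℓ z < ℓ x) (sym q) (f x (inj₁ refl))) (ℕₚ.≤-reflexive (sym l))
  no-descent-step d (τ ∷ ts) (l , p) f (inj₂ q) = no-descent-step d ts p (λ v o → f v (inj₂ o)) q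

  right-descent : ∀ u → u ≡ e ⊎ ∃ λ d → ℓ (u · gen d) < ℓ u
  right-descent u with reducedWord (u ⁻¹)
  ... | [] , l , p = inj₁ (trans (sym (inv-inv u)) (trans (cong _⁻¹ (sym p)) inv-e))
  ... | d ∷ ws , l , p = inj₂ (d , subst₂ _<_ (sym (ℓ-·gen u d)) (trans l (ℓ-inv u))
    (subst (λ z → ℓ z < suc (length ws)) (trans (sym (gen·gen· d _)) (cong (gen d ·_) p)) (s≤s (ℓ≤length ws))))

  ++-split : ∀ (as : Word) {bs a k b} → as ++ bs ≡ a ++ k ∷ b →
    (∃ λ c → as ≡ a ++ k ∷ c × b ≡ c ++ bs) ⊎ (∃ λ c → a ≡ as ++ c × bs ≡ c ++ k ∷ b)
  ++-split [] {a = a} p = inj₂ (a , refl , p)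
  ++-split (x ∷ as) {a = []} refl = inj₁ (as , refl , refl)
  ++-split (x ∷ as) {a = y ∷ a} p with Listₚ.∷-injective p
  ... | refl , q with ++-split as q
  ...   | inj₁ (c , r , r') = inj₁ (c , cong (x ∷_) r , r')
  ...   | inj₂ (c , r , r') = inj₂ (c , cong (x ∷_) r , r')

  ⊆-++⁻ : ∀ (as : Word) {bs us} → us ⊆ as ++ bs → ∃ λ us₁ → ∃ λ us₂ → us ≡ us₁ ++ us₂ × us₁ ⊆ as × us₂ ⊆ bs
  ⊆-++⁻ [] p = [] , _ , refl , [] , p
  ⊆-++⁻ (a ∷ as) (_ ∷ʳ p) with ⊆-++⁻ as p
  ... | us₁ , us₂ , q , p₁ , p₂ = us₁ , us₂ , q , a ∷ʳ p₁ , p₂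
  ⊆-++⁻ (a ∷ as) (refl ∷ p) with ⊆-++⁻ as p
  ... | us₁ , us₂ , q , p₁ , p₂ = a ∷ us₁ , us₂ , cong (a ∷_) q , refl ∷ p₁ , p₂

  -- Cosets of a parabolic subgroup.

  module Coset (J : Word) where

    parabolic-word : ∀ {v} → Parabolic J v → ∃ λ a → All (_∈ J) a × IsReduced a × evalWord a ≡ v
    parabolic-word (ws , p , refl) with reducedSubword ws
    ... | us , s , q , l = us , Subₚ.All-resp-⊆ s p , trans (cong ℓ q) (sym l) , q

    descent-in : ∀ x (K : Word) → (∃ λ j → j ∈ K × ℓ x ≡ suc (ℓ (gen j · x))) ⊎
        (∀ j → j ∈ K → ℓ (gen j · x) ≡ suc (ℓ x))
    descent-in x [] = inj₂ λ _ ()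
    descent-in x (j ∷ K) with gen-dichotomy j x | descent-in x K
    ... | inj₂ d | _ = inj₁ (j , here refl , d)
    ... | inj₁ _ | inj₁ (i , i∈ , d) = inj₁ (i , there i∈ , d)
    ... | inj₁ u | inj₂ f = inj₂ λ { _ (here refl) → u ; i (there i∈) → f i i∈ }

    Minimal : W → Set
    Minimal y = ∀ v → Parabolic J v → ℓ y ≤ ℓ (v · y)

    -- Write `y` as `v ⁻¹` times `v · y` and take a reduced subword. It uses no letter of `v ⁻¹`,
    -- since its first letter would then be a left descent of `y` in `J`; so it is a subword of a
    -- reduced word of `v · y`.
    ascents⇒Minimal : ∀ y → (∀ j → j ∈ J → ℓ (gen j · y) ≡ suc (ℓ y)) → Minimal y
    ascents⇒Minimal y asc v pv with Parabolic-inv pv | reducedWord (v · y)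
    ... | a , pa , qa | b , lb , qb with reducedSubword (a ++ b)
    ...   | us , s , q , l with ⊆-++⁻ a s
    ...     | [] , us₂ , refl , _ , s₂ = subst₂ _≤_ (trans l (cong ℓ y≡)) lb (Subₚ.length-mono-≤ s₂)
      where
      y≡ : evalWord (a ++ b) ≡ y
      y≡ = trans (evalWord-++ a b) (trans (cong₂ _·_ qa qb) (cancelˡ v y))
    ...     | j ∷ us₁ , us₂ , refl , s₁ , _ = ⊥-elim (ℕₚ.<-asym
        (ℕₚ.≤-reflexive (sym (asc j (All.lookup pa (Sub.lookup s₁ (here refl))))))
        (subst₂ _<_ (cong ℓ (trans (sym (gen·gen· j _)) (cong (gen j ·_) (trans q y≡)))) (trans l (cong ℓ y≡))
            (s≤s (ℓ≤length (us₁ ++ us₂)))))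
      where
      y≡ : evalWord (a ++ b) ≡ y
      y≡ = trans (evalWord-++ a b) (trans (cong₂ _·_ qa qb) (cancelˡ v y))

    factor : ∀ n u → ℓ u < n → ∃ λ y → Parabolic J (u · y ⁻¹) × Minimal y
    factor (suc n) u (s≤s l) with descent-in u J
    ... | inj₂ f = u , subst (Parabolic J) (sym (inverseʳ u)) Parabolic-e , ascents⇒Minimal u f
    ... | inj₁ (j , j∈ , d) with factor n (gen j · u) (ℕₚ.<-≤-trans (ℕₚ.≤-reflexive (sym d)) l)
    ...   | y , p , min = y , subst (Parabolic J) (group (u ∷ y ∷ []) (simple j ∷ []) (r₀ ⊗ (r₀ ⊗ x₀ ⊗ x₁ ⁻))
        (x₀ ⊗ x₁ ⁻) refl)
        (Parabolic-· (Parabolic-gen j∈) p) , min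

    -- If `j` shortened `evalWord a · y`, exchange would delete a letter of `a`, and `j ∷ a` would
    -- not be reduced, or one of `y`, which yields a shorter element of its coset.
    Minimal-· : ∀ y → Minimal y → ∀ a → All (_∈ J) a → IsReduced a → ℓ (evalWord a · y) ≡ length a + ℓ y
    Minimal-· y min [] _ _ = cong ℓ (identityˡ y)
    Minimal-· y min (j ∷ a) (j∈ ∷ pa) r with gen-dichotomy j (evalWord a · y) | Minimal-· y min a pa
        (IsReduced-tail {j} {a} r)
    ... | inj₁ u | ih = trans (cong ℓ (assoc _ _ _)) (trans u (cong suc ih))
    ... | inj₂ d | ih with reducedWord y
    ...   | b , lb , refl with η-split (a ++ b) (gen j) (subst (λ z → η z (gen j) ≡ true) (sym (evalWord-++ a b))
              (<⇒η (Reflection-gen j) (ℕₚ.≤-reflexive (sym d))))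
    ...     | a₁ , k , b₁ , eq , _ , del with ++-split a eq
    ...       | inj₁ (c , refl , refl) = ⊥-elim (ℕₚ.<-irrefl refl
        (ℕₚ.≤-trans (s≤s (subst (_≤ length (a₁ ++ c)) (trans (cong ℓ (sym ja)) r) (ℓ≤length (a₁ ++ c))))
          (ℕₚ.≤-trans (ℕₚ.≤-reflexive (sym (length-delete a₁ k c))) (ℕₚ.n≤1+n _))))
      where
      ja : gen j · evalWord (a₁ ++ k ∷ c) ≡ evalWord (a₁ ++ c)
      ja = ·-cancelʳ (evalWord b) (trans (assoc _ _ _) (trans
          (cong (gen j ·_) (sym (evalWord-++ (a₁ ++ k ∷ c) b)))
        (trans del (trans (cong evalWord (sym (Listₚ.++-assoc a₁ c b))) (evalWord-++ (a₁ ++ c) b)))))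
    ...       | inj₂ (c , refl , refl) = ⊥-elim (ℕₚ.<⇒≱ (subst (ℓ (evalWord (c ++ b₁)) <_)
        (trans (sym (length-delete c k b₁)) lb) (s≤s (ℓ≤length (c ++ b₁))))
          (subst (λ z → ℓ (evalWord (c ++ k ∷ b₁)) ≤ ℓ z) (sym y'≡)
              (min _ (Parabolic-· (Parabolic-· (Parabolic-inv A∈) (Parabolic-gen j∈)) A∈))))
      where
      A = evalWord a
      Y = evalWord (c ++ k ∷ b₁)
      A∈ : Parabolic J A
      A∈ = Parabolic-eval pa
      y'≡ : evalWord (c ++ b₁) ≡ A ⁻¹ · gen j · A · Y
      y'≡ = ·-cancelˡ A (trans (sym acb)
        (trans (sym del) (trans (cong (gen j ·_) (evalWord-++ a (c ++ k ∷ b₁)))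
          (group (A ∷ Y ∷ []) (simple j ∷ []) (r₀ ⊗ (x₀ ⊗ x₁)) (x₀ ⊗ (x₀ ⁻ ⊗ r₀ ⊗ x₀ ⊗ x₁)) refl))))
        where
        acb : evalWord ((a ++ c) ++ b₁) ≡ A · evalWord (c ++ b₁)
        acb = trans (cong evalWord (Listₚ.++-assoc a c b₁)) (evalWord-++ a (c ++ b₁))

    InCoset : W → W → Set
    InCoset y x = Parabolic J (x · y ⁻¹)

    coset-descent : ∀ {y} → Minimal y → ∀ d → ℓ (y · gen d) < ℓ y → ∀ {x} → InCoset y x → ℓ (x · gen d) < ℓ x
    coset-descent {y} min d l {x} p with parabolic-word p
    ... | a , pa , r , q = begin-strict
      ℓ (x · gen d) ≡⟨ cong (λ z → ℓ (z · gen d)) x≡ ⟩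
      ℓ (evalWord a · y · gen d) ≡⟨ cong ℓ (assoc _ _ _) ⟩
      ℓ (evalWord a · (y · gen d)) ≤⟨ ℓ-· _ _ ⟩
      ℓ (evalWord a) + ℓ (y · gen d) <⟨ ℕₚ.+-monoʳ-< (ℓ (evalWord a)) l ⟩
      ℓ (evalWord a) + ℓ y ≡⟨ cong (_+ ℓ y) r ⟩
      length a + ℓ y ≡⟨ sym (Minimal-· y min a pa r) ⟩
      ℓ (evalWord a · y) ≡⟨ cong ℓ (sym x≡) ⟩
      ℓ x ∎
      where
      open ℕₚ.≤-Reasoning
      x≡ : x ≡ evalWord a · y
      x≡ = trans (group (x ∷ y ∷ []) [] x₀ (x₀ ⊗ x₁ ⁻ ⊗ x₁) refl) (cong (_· y) (sym q))

    -- Exchange in a word of `v` followed by one of `z`: deleting a letter of `v` stays in the coset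
    -- of `z`, deleting one of `z` leads to a coset with a shorter element.
    coset-down : ∀ {v z τ} → Parabolic J v → η (v · z) τ ≡ true →
      InCoset z (τ · (v · z)) ⊎ ∃ λ z' → τ · (v · z) ≡ v · z' × ℓ z' < ℓ z
    coset-down {z = z} {τ} (a , pa , refl) h with reducedWord z
    ... | b , lb , refl with η-split (a ++ b) τ (subst (λ z → η z τ ≡ true) (sym (evalWord-++ a b)) h)
    ... | a₁ , k , b₁ , eq , _ , del with ++-split a eq
    ...   | inj₁ (c , refl , refl) = inj₁ (subst (Parabolic J) (sym x≡)
        (Parabolic-eval (Subₚ.All-resp-⊆ (delete⊆ a₁) pa)))
      where
      x≡ : τ · (evalWord (a₁ ++ k ∷ c) · evalWord b) · evalWord b ⁻¹ ≡ evalWord (a₁ ++ c)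
      x≡ = trans (cong (λ w → τ · w · evalWord b ⁻¹) (sym (evalWord-++ (a₁ ++ k ∷ c) b)))
        (trans (cong (_· evalWord b ⁻¹) (trans del (trans (cong evalWord (sym (Listₚ.++-assoc a₁ c b)))
            (evalWord-++ (a₁ ++ c) b))))
          (group (evalWord (a₁ ++ c) ∷ evalWord b ∷ []) [] (x₀ ⊗ x₁ ⊗ x₁ ⁻) x₀ refl))
    ...   | inj₂ (c , refl , refl) = inj₂ (evalWord (c ++ b₁)
        , trans (cong (τ ·_) (sym (evalWord-++ a (c ++ k ∷ b₁))))
            (trans del (trans (cong evalWord (Listₚ.++-assoc a c b₁)) (evalWord-++ a (c ++ b₁))))
        , subst (ℓ (evalWord (c ++ b₁)) <_) (trans (sym (length-delete c k b₁)) lb) (s≤s (ℓ≤length (c ++ b₁))))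

    -- The minimal length of the coset W_J x can only increase along a chain, so a chain between two
    -- elements of one coset stays in it.
    Low : W → W → Set
    Low y x = ∃ λ v → ∃ λ z → Parabolic J v × x ≡ v · z × ℓ z < ℓ y

    Low-absurd : ∀ {y x} → Minimal y → InCoset y x → ¬ Low y x
    Low-absurd {y} min p (v , z , pv , refl , l) = ℕₚ.<⇒≱ l (subst (λ w → ℓ y ≤ ℓ w)
      (group (v ∷ z ∷ y ∷ []) [] (x₀ ⁻ ⊗ (x₀ ⊗ x₁ ⊗ x₂ ⁻) ⊗ x₂) x₁ refl)
          (min _ (Parabolic-· (Parabolic-inv pv) p)))

    Low-InCoset : ∀ {y z x} → ℓ z < ℓ y → InCoset z x → Low y x
    Low-InCoset {z = z} {x} l p = _ , z , p , group (x ∷ z ∷ []) [] x₀ (x₀ ⊗ x₁ ⁻ ⊗ x₁) refl , l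

    Low-down : ∀ {y x τ} → Reflection τ → ℓ (τ · x) ≡ suc (ℓ x) → Low y (τ · x) → Low y x
    Low-down {y} {x} {τ} r up (v , z , pv , q , l) with coset-down {v} {z} {τ} pv (subst (λ w → η w τ ≡ true) q
      (trans (η-flip r x) (cong not (>⇒¬η (ℕₚ.≤-reflexive (sym up))))))
    ... | inj₁ p = Low-InCoset l (subst (InCoset z) (trans (cong (τ ·_) (sym q)) (refl·refl· r x)) p)
    ... | inj₂ (z' , p , l') = v , z' , pv , trans (sym (refl·refl· r x)) (trans (cong (τ ·_) q) p) , ℕₚ.<-trans
        l' l

    InCoset-down : ∀ {y x τ} → Reflection τ → ℓ (τ · x) ≡ suc (ℓ x) → InCoset y (τ · x) → InCoset y x ⊎ Low y x
    InCoset-down {y} {x} {τ} r up p with coset-down {τ · x · y ⁻¹} {y} {τ} p (subst (λ w → η w τ ≡ true) q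
      (trans (η-flip r x) (cong not (>⇒¬η (ℕₚ.≤-reflexive (sym up))))))
      where
      q : τ · x ≡ τ · x · y ⁻¹ · y
      q = group (τ · x ∷ y ∷ []) [] x₀ (x₀ ⊗ x₁ ⁻ ⊗ x₁) refl
    ... | inj₁ p' = inj₁ (subst (InCoset y) (group (x ∷ y ∷ []) (refl-involution r ∷ [])
        (r₀ ⊗ (r₀ ⊗ x₀ ⊗ x₁ ⁻ ⊗ x₁)) x₀ refl) p')
    ... | inj₂ (z' , p' , l) = inj₂ (_ , z' , p , trans (group (x ∷ y ∷ []) (refl-involution r ∷ []) x₀
        (r₀ ⊗ (r₀ ⊗ x₀ ⊗ x₁ ⁻ ⊗ x₁)) refl) p' , l)

    -- Read backwards from the end: once an element falls into `Low`, all earlier ones do, down to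
    -- `x`.
    coset-chain′ : ∀ {y} ts {x} → All Reflection ts → Asc ts x → InCoset y (end ts x) →
        (∀ v → On v ts x → InCoset y v) ⊎ Low y x
    coset-chain′ [] _ _ p = inj₁ λ { _ refl → p }
    coset-chain′ {y} (τ ∷ ts) (r ∷ rs) (l , a) p with coset-chain′ ts rs a p
    ... | inj₂ low = inj₂ (Low-down r l low)
    ... | inj₁ f with InCoset-down {y} r l (f _ (On-start ts))
    ...   | inj₂ low = inj₂ low
    ...   | inj₁ q = inj₁ λ { _ (inj₁ refl) → q ; v (inj₂ o) → f v o }

    coset-chain : ∀ {y} ts {x} → Minimal y → All Reflection ts → Asc ts x → InCoset y x → InCoset y (end ts x) →
      ∀ v → On v ts x → InCoset y v
    coset-chain ts min rs a p q with coset-chain′ ts rs a q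
    ... | inj₁ f = f
    ... | inj₂ low = ⊥-elim (Low-absurd min p low)

  -- From a locally minimal chain to nested words

  Nest-⊆ : ∀ {is cs us} → Nest is us → is ⊆ cs → Nest cs us
  Nest-⊆ n (k ∷ʳ p) = skip (Nest-⊆ n p)
  Nest-⊆ nil [] = nil
  Nest-⊆ (skip n) (refl ∷ p) = skip (Nest-⊆ n p)
  Nest-⊆ (take n) (refl ∷ p) = take (Nest-⊆ n (Subₚ.++⁺ p ⊆-refl))

  -- The last occurrence is wanted because `strip` needs a tail of the chain without `gen s`.
  last-occurrence : ∀ (t : W) ts → t ∉ ts ⊎ ∃ λ as → ∃ λ bs → ts ≡ as ++ t ∷ bs × t ∉ bs
  last-occurrence t [] = inj₁ λ ()
  last-occurrence t (x ∷ ts) with last-occurrence t ts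
  ... | inj₂ (as , bs , refl , p) = inj₂ (x ∷ as , bs , refl , p)
  ... | inj₁ p with t ≟ x
  ...   | yes refl = inj₂ ([] , ts , refl , p)
  ...   | no t≢x = inj₁ λ { (here q) → t≢x q ; (there q) → p q }

  descent∈Parabolic : ∀ {J u} → Parabolic J u → ∀ d → ℓ (u · gen d) < ℓ u → Parabolic J (gen d)
  descent∈Parabolic {J} {u} p d l with Parabolic-inv p
  ... | b , pb , q with η-split b (gen d) (<⇒η (Reflection-gen d)
        (subst₂ _<_ (trans (ℓ-·gen u d) (cong (λ z → ℓ (gen d · z)) (sym q)))
            (trans (sym (ℓ-inv u)) (cong ℓ (sym q))) l))
  ...   | a , k , b' , refl , t , _ = subst (Parabolic J) (sym t)
          (Parabolic-conj-split a k (Allₚ.++⁻ˡ a pb) (All.head (Allₚ.++⁻ʳ a pb)))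

  NestWord : Word → W → Set
  NestWord cs v = ∃ λ us → Nest cs us × IsReduced us × evalWord us ≡ v

  -- All that is kept of minimality is the field `steps`, which is inherited both when `s` is
  -- stripped and when a step is deleted.
  record LocallyMinimal (cs : Word) (ts : List W) (u : W) : Set where
    field
      refls  : All Reflection ts
      unique : Unique cs
      asc    : Asc ts u
      size   : length ts ≡ length cs
      target : end ts u ≡ evalWord cs · u
      steps  : ∀ d → ℓ (u · gen d) < ℓ u → Step d ts u

  Nested : Word → List W → W → Set
  Nested cs ts u = ∀ v → On v ts u → NestWord cs v

  -- Since `u` is longer than `gen s · u` by one, a right descent of the latter is one of `u`, so
  -- `steps` carries over. As `s` is a left descent of every element of the chain, putting it in
  -- front of the words found keeps them reduced.
  strip-chain : ∀ {s cs ts u} → LocallyMinimal (s ∷ cs) ts u → gen s ∉ ts →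
    ℓ u ≡ suc (ℓ (gen s · u)) × LocallyMinimal (cs ++ s ∷ []) (map (conj (gen s)) ts) (gen s · u) ×
    (Nested (cs ++ s ∷ []) (map (conj (gen s)) ts) (gen s · u) → Nested (s ∷ cs) ts u)
  strip-chain {s} {cs} {ts} {u} lm s∉ = proj₂ st , record
      { refls = All-conj (gen s) rs
      ; unique = Unique-rotate uq
      ; asc = proj₁ st
      ; size = trans (Listₚ.length-map _ ts) (trans |ts| (sym |rot|))
      ; target = tgt'
      ; steps = steps'
      } , λ nested v o → take-word v o (nested (gen s · v) (On-conj (gen s) ts o))
    where
    open LocallyMinimal lm renaming (refls to rs; unique to uq; size to |ts|; target to tgt)
    desc = end-descent s cs ts asc tgt |ts|
    st = strip s rs asc s∉ desc
    ts' = map (conj (gen s)) ts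
    |rot| : length (cs ++ s ∷ []) ≡ suc (length cs)
    |rot| = trans (Listₚ.length-++ cs) (ℕₚ.+-comm _ 1)
    tgt' : end ts' (gen s · u) ≡ evalWord (cs ++ s ∷ []) · (gen s · u)
    tgt' = begin
      end ts' (gen s · u) ≡⟨ end-conj (gen s) ts u ⟩
      gen s · end ts u ≡⟨ cong (gen s ·_) tgt ⟩
      gen s · (gen s · evalWord cs · u) ≡⟨ group (evalWord cs ∷ u ∷ []) (simple s ∷ []) (r₀ ⊗ (r₀ ⊗ x₀ ⊗ x₁))
          (x₀ ⊗ r₀ ⊗ (r₀ ⊗ x₁)) refl ⟩
      evalWord cs · gen s · (gen s · u) ≡⟨ cong (λ z → evalWord cs · z · (gen s · u)) (sym evalWord-[ s ]) ⟩
      evalWord cs · evalWord (s ∷ []) · (gen s · u) ≡⟨ cong (_· (gen s · u)) (sym (evalWord-++ cs (s ∷ []))) ⟩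
      evalWord (cs ++ s ∷ []) · (gen s · u) ∎
      where open ≡-Reasoning
    steps' : ∀ d → ℓ (gen s · u · gen d) < ℓ (gen s · u) → Step d ts' (gen s · u)
    steps' d l = Step-conj d (gen s) ts (steps d (ℕₚ.≤-<-trans
      (subst (λ z → ℓ z ≤ suc (ℓ (gen s · u · gen d))) (group (u ∷ gen d ∷ []) (simple s ∷ [])
          (r₀ ⊗ (r₀ ⊗ x₀ ⊗ x₁)) (x₀ ⊗ x₁) refl) (ℓ-gen·≤ s _))
      (subst (suc (ℓ (gen s · u · gen d)) <_) (sym (proj₂ st)) (s≤s l))))
    take-word : ∀ v → On v ts u → NestWord (cs ++ s ∷ []) (gen s · v) → NestWord (s ∷ cs) v
    take-word v o (us , nst , red , q) = s ∷ us , take nst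
      , trans (cong ℓ v≡) (trans (strip-On s ts rs asc s∉ desc o) (cong suc (trans (cong ℓ (sym q)) red))) , v≡
      where
      v≡ : gen s · evalWord us ≡ v
      v≡ = trans (cong (gen s ·_) q) (gen·gen· s v)

  -- If s is one of the reflections of the chain, deleting it leaves a chain inside one coset of the parabolic
  -- subgroup of the other letters; a right descent of the minimal element y of this coset would be a descent
  -- of every element of the chain, hence not a step, so y = e.
  delete-step : ∀ {s cs as bs u} → LocallyMinimal (s ∷ cs) (as ++ gen s ∷ bs) u → gen s ∉ bs →
    LocallyMinimal cs (as ++ map (conj (gen s)) bs) u ×
    (Nested cs (as ++ map (conj (gen s)) bs) u → Nested (s ∷ cs) (as ++ gen s ∷ bs) u)
  delete-step {s} {cs} {as} {bs} {u} lm s∉ = record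
      { refls = rs'
      ; unique = uq'
      ; asc = asc'
      ; size = |ts'|
      ; target = tgt'
      ; steps = steps'
      } , λ nested v o → result nested v (On-++⁻ as o)
    where
    open Coset cs
    open LocallyMinimal lm renaming (refls to rs; unique to uq; size to |ts|; target to tgt)
    uq' : Unique cs
    uq' = AllPairs.tail uq
    p : W
    p = end as u
    bs' = map (conj (gen s)) bs
    ts' = as ++ bs'
    asc-as = Asc-++⁻ˡ as asc
    asc-sbs = Asc-++⁻ʳ as asc
    rs-as = Allₚ.++⁻ˡ as rs
    rs-bs = All.tail (Allₚ.++⁻ʳ as rs)
    end-bs : end (as ++ gen s ∷ bs) u ≡ end bs (gen s · p)
    end-bs = end-++ as (gen s ∷ bs) u
    desc : ℓ (gen s · end bs (gen s · p)) < ℓ (end bs (gen s · p))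
    desc = subst (λ z → ℓ (gen s · z) < ℓ z) end-bs (end-descent s cs (as ++ gen s ∷ bs) asc tgt |ts|)
    st = strip s rs-bs (proj₂ asc-sbs) s∉ desc
    asc-bs' : Asc bs' p
    asc-bs' = subst (Asc bs') (gen·gen· s p) (proj₁ st)
    asc' : Asc ts' u
    asc' = Asc-++⁺ as asc-as asc-bs'
    rs' : All Reflection ts'
    rs' = Allₚ.++⁺ rs-as (All-conj (gen s) rs-bs)
    |ts'| : length ts' ≡ length cs
    |ts'| = ℕₚ.suc-injective (trans (cong suc (trans (Listₚ.length-++ as)
        (cong (length as +_) (Listₚ.length-map _ bs))))
      (trans (sym (ℕₚ.+-suc (length as) (length bs))) (trans (sym (Listₚ.length-++ as)) |ts|)))
    tgt' : end ts' u ≡ evalWord cs · u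
    tgt' = begin
      end ts' u ≡⟨ end-++ as bs' u ⟩
      end bs' p ≡⟨ cong (end bs') (sym (gen·gen· s p)) ⟩
      end bs' (gen s · (gen s · p)) ≡⟨ end-conj (gen s) bs (gen s · p) ⟩
      gen s · end bs (gen s · p) ≡⟨ cong (gen s ·_) (trans (sym end-bs) tgt) ⟩
      gen s · (gen s · evalWord cs · u) ≡⟨ group (evalWord cs ∷ u ∷ []) (simple s ∷ []) (r₀ ⊗ (r₀ ⊗ x₀ ⊗ x₁))
          (x₀ ⊗ x₁) refl ⟩
      evalWord cs · u ∎
      where open ≡-Reasoning
    cs∈ : Parabolic cs (evalWord cs)
    cs∈ = Parabolic-eval (All.tabulate λ i → i)
    rep = factor (suc (ℓ u)) u ℕₚ.≤-refl
    y : W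
    y = proj₁ rep
    min : Minimal y
    min = proj₂ (proj₂ rep)
    in-coset : ∀ v → On v ts' u → InCoset y v
    in-coset = coset-chain ts' min rs' asc' (proj₁ (proj₂ rep)) (subst (InCoset y) (sym tgt')
      (subst (Parabolic cs) (sym (assoc _ _ _)) (Parabolic-· cs∈ (proj₁ (proj₂ rep)))))
    Step-cases : ∀ d → Step d (as ++ gen s ∷ bs) u → Step d ts' u ⊎ gen s · p ≡ p · gen d
    Step-cases d t with Step-++⁻ d as t
    ... | inj₁ t' = inj₁ (Step-++⁺ˡ d as t')
    ... | inj₂ (inj₁ q) = inj₂ q
    ... | inj₂ (inj₂ t') = inj₁ (Step-++⁺ʳ d as (subst (Step d bs') (gen·gen· s p) (Step-conj d (gen s) bs t')))
    y≡e : y ≡ e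
    y≡e with right-descent y
    ... | inj₁ q = q
    ... | inj₂ (d , l) with Step-cases d (steps d (coset-descent min d l (in-coset u (On-start ts'))))
    ...   | inj₁ t = ⊥-elim (no-descent-step d ts' asc' (λ v o → coset-descent min d l (in-coset v o)) t)
    -- Here `d` would be a descent at `p`, yet the deleted step from `p` goes up.
    ...   | inj₂ q = ⊥-elim (ℕₚ.<-asym (subst (λ z → ℓ z < ℓ p) (sym q)
        (coset-descent min d l (in-coset p (On-++⁺ˡ as (On-end as)))))
                (ℕₚ.≤-reflexive (sym (proj₁ asc-sbs))))
    in-parabolic : ∀ v → On v ts' u → Parabolic cs v
    in-parabolic v o = subst (Parabolic cs) (trans (cong (λ z → v · z ⁻¹) y≡e)
        (group (v ∷ []) [] (x₀ ⊗ ε ⁻) x₀ refl)) (in-coset v o)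
    steps' : ∀ d → ℓ (u · gen d) < ℓ u → Step d ts' u
    steps' d l with Step-cases d (steps d l)
    ... | inj₁ t = t
    -- If the step of `d` was the deleted one, then `gen s = conj p (gen d)` with `p` and `gen d` in
    -- the parabolic subgroup of `cs`, which does not contain `gen s`.
    ... | inj₂ q = ⊥-elim (Unique[x∷xs]⇒x∉xs uq (Parabolic-gen⁻ (subst (Parabolic cs)
            (trans (cong (_· p ⁻¹) (sym q)) (group (gen s ∷ p ∷ []) [] (x₀ ⊗ x₁ ⊗ x₁ ⁻) x₀ refl))
            (Parabolic-· (Parabolic-· p∈ (descent∈Parabolic (in-parabolic u (On-start ts')) d l))
                (Parabolic-inv p∈)))))
      where p∈ = in-parabolic p (On-++⁺ˡ as (On-end as))
    skip-word : ∀ {v} → NestWord cs v → NestWord (s ∷ cs) v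
    skip-word (us , nst , red , q) = us , skip nst , red , q
    result : Nested cs ts' u → ∀ v → On v as u ⊎ On v (gen s ∷ bs) p → NestWord (s ∷ cs) v
    result nested v (inj₁ o) = skip-word (nested v (On-++⁺ˡ as o))
    result nested v (inj₂ (inj₁ refl)) = skip-word (nested p (On-++⁺ˡ as (On-end as)))
    result nested v (inj₂ (inj₂ o))
      with nested (gen s · v) (On-++⁺ʳ as (subst (On (gen s · v) bs') (gen·gen· s p) (On-conj (gen s) bs o)))
    -- `take` puts `s` back at the end of the queue; the word found avoids it, and `Nest-⊆` skips it
    -- there.
    ... | us , nst , red , q = s ∷ us , take (Nest-⊆ nst (Subₚ.++⁺ʳ (s ∷ []) ⊆-refl))
        , trans (cong ℓ v≡) (trans (strip-On s bs rs-bs (proj₂ asc-sbs) s∉ desc o)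
            (cong suc (trans (cong ℓ (sym q)) red))) , v≡
      where
      v≡ : gen s · evalWord us ≡ v
      v≡ = trans (cong (gen s ·_) q) (gen·gen· s v)

  chain-nested-step : ∀ {n k} →
    (∀ {cs ts u} → length cs ≡ n → LocallyMinimal cs ts u → Nested cs ts u) →
    (∀ {cs ts u} → length cs ≡ suc n → ℓ u < k → LocallyMinimal cs ts u → Nested cs ts u) →
    ∀ {cs ts u} → length cs ≡ suc n → ℓ u ≤ k → LocallyMinimal cs ts u → Nested cs ts u
  chain-nested-step ih₁ ih₂ {s ∷ cs} {ts} |cs| l lm with last-occurrence (gen s) ts
  ... | inj₂ (as , bs , refl , s∉) with delete-step {as = as} lm s∉
  ...   | lm' , nested = nested (ih₁ (ℕₚ.suc-injective |cs|) lm')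
  chain-nested-step ih₁ ih₂ {s ∷ cs} {ts} |cs| l lm | inj₁ s∉ with strip-chain lm s∉
  ...   | d , lm' , nested = nested (ih₂ (trans (Listₚ.length-++ cs) (trans (ℕₚ.+-comm _ 1) |cs|))
          (ℕₚ.<-≤-trans (ℕₚ.≤-reflexive (sym d)) l) lm')

  -- Lexicographic induction: deleting a step shortens `cs`, and the bound on `ℓ u` is chosen anew;
  -- stripping keeps the number of letters and shortens `u`. When no letters remain, `steps` leaves
  -- `u` without right descents, so `u = e`.
  chain-nested : ∀ n k {cs ts u} → length cs ≡ n → ℓ u < k → LocallyMinimal cs ts u → Nested cs ts u
  chain-nested zero k {[]} {[]} {u} _ _ lm v refl with right-descent u
  ... | inj₁ refl = [] , nil , ℓ-e , refl
  ... | inj₂ (d , l) = ⊥-elim (LocallyMinimal.steps lm d l)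
  chain-nested zero k {[]} {_ ∷ _} _ _ lm with LocallyMinimal.size lm
  ... | ()
  chain-nested (suc n) (suc k) |cs| (s≤s l) lm =
    chain-nested-step (λ q lm' → chain-nested n _ q ℕₚ.≤-refl lm') (chain-nested (suc n) k) |cs| l lm

  -- Sorting words.

  module SortingWords (cw : Word) (unique : Unique cw) where
    open Sorting cw

    shift : Pos → Pos
    shift (k , j) = suc k , j

    _≟P_ : (p q : Pos) → Dec (p ≡ q)
    _≟P_ = ≡-dec ℕₚ._≟_ Finₚ._≟_

    <P-trans : ∀ {p q r} → p <P q → q <P r → p <P r
    <P-trans (inj₁ a) (inj₁ b) = inj₁ (ℕₚ.<-trans a b)
    <P-trans (inj₁ a) (inj₂ (refl , _)) = inj₁ a
    <P-trans (inj₂ (refl , _)) (inj₁ b) = inj₁ b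
    <P-trans (inj₂ (refl , a)) (inj₂ (refl , b)) = inj₂ (refl , ℕₚ.<-trans a b)

    <P-irrefl : ∀ {p} → ¬ (p <P p)
    <P-irrefl (inj₁ a) = ℕₚ.<-irrefl refl a
    <P-irrefl (inj₂ (_ , a)) = ℕₚ.<-irrefl refl a

    <P-shift : ∀ p → p <P shift p
    <P-shift p = inj₁ ℕₚ.≤-refl

    shift-mono : ∀ {p q} → p <P q → shift p <P shift q
    shift-mono (inj₁ a) = inj₁ (s≤s a)
    shift-mono (inj₂ (refl , a)) = inj₂ (refl , a)

    -- The list of positions which records, for each letter still in play, its next occurrence.
    data NestP : List Pos → List Pos → Set where
      nil  : NestP [] []
      take : ∀ {p cs ps} → NestP (cs ++ shift p ∷ []) ps → NestP (p ∷ cs) (p ∷ ps)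
      skip : ∀ {p cs ps} → NestP cs ps → NestP (p ∷ cs) ps

    map-letter-rotate : ∀ cs p → map letter (cs ++ shift p ∷ []) ≡ map letter cs ++ letter p ∷ []
    map-letter-rotate cs p = Listₚ.map-++ letter cs (shift p ∷ [])

    NestP⇒Nest : ∀ {cs ps} → NestP cs ps → Nest (map letter cs) (map letter ps)
    NestP⇒Nest nil = nil
    NestP⇒Nest (skip n) = skip (NestP⇒Nest n)
    NestP⇒Nest (take {p} {cs} {ps} n) = take (subst (λ z → Nest z (map letter ps)) (map-letter-rotate cs p)
        (NestP⇒Nest n))

    Nest⇒NestP : ∀ {ds us} → Nest ds us → ∀ cs → ds ≡ map letter cs → ∃ λ ps → NestP cs ps × map letter ps ≡ us
    Nest⇒NestP nil [] _ = [] , nil , refl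
    Nest⇒NestP (skip n) (p ∷ cs) q with Nest⇒NestP n cs (Listₚ.∷-injectiveʳ q)
    ... | ps , n' , r = ps , skip n' , r
    Nest⇒NestP (take {s} n) (p ∷ cs) q with Listₚ.∷-injective q
    ... | refl , refl with Nest⇒NestP n (cs ++ shift p ∷ []) (sym (map-letter-rotate cs p))
    ...   | ps , n' , r = p ∷ ps , take n' , cong (s ∷_) r

    -- The queue spans less than one copy of `cw`, so appending `shift p` once `p` is taken keeps it
    -- sorted.
    record Window (cs : List Pos) : Set where
      constructor window
      field
        sorted : AllPairs _<P_ cs
        period : ∀ {p q} → p ∈ cs → q ∈ cs → q <P shift p
    open Window

    Window-tail : ∀ {p cs} → Window (p ∷ cs) → Window cs
    Window-tail w = window (AllPairs.tail (sorted w)) (λ i j → period w (there i) (there j))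

    Window-rotate : ∀ {p cs} → Window (p ∷ cs) → Window (cs ++ shift p ∷ [])
    Window-rotate {p} {cs} w = window
      (AllPairsₚ.++⁺ (AllPairs.tail (sorted w)) ([] ∷ [])
          (All.tabulate λ q∈ → period w (here refl) (there q∈) ∷ []))
      (λ i j → lem (∈-++⁻ cs i) (∈-++⁻ cs j))
      where
      lem : ∀ {r q} → r ∈ cs ⊎ r ∈ shift p ∷ [] → q ∈ cs ⊎ q ∈ shift p ∷ [] → q <P shift r
      lem (inj₁ i) (inj₁ j) = period w (there i) (there j)
      lem (inj₁ i) (inj₂ (here refl)) = shift-mono (All.lookup (AllPairs.head (sorted w)) i)
      lem (inj₂ (here refl)) (inj₁ j) = <P-trans (period w (here refl) (there j)) (<P-shift _)
      lem (inj₂ (here refl)) (inj₂ (here refl)) = <P-shift _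

    NestP-above : ∀ {b cs ps} → NestP cs ps → All (b <P_) cs → All (b <P_) ps
    NestP-above nil a = a
    NestP-above (skip n) (_ ∷ a) = NestP-above n a
    NestP-above (take n) (x ∷ a) = x ∷ NestP-above n (Allₚ.++⁺ a (<P-trans x (<P-shift _) ∷ []))

    NestP-sorted : ∀ {cs ps} → NestP cs ps → Window cs → AllPairs _<P_ ps
    NestP-sorted nil _ = []
    NestP-sorted (skip n) w = NestP-sorted n (Window-tail w)
    NestP-sorted (take {p} n) w = NestP-above n (Allₚ.++⁺ (AllPairs.head (sorted w)) (<P-shift p ∷ [])) ∷
        NestP-sorted n (Window-rotate w)

    NestP-nested : ∀ {cs ps} → NestP cs ps → ∀ r → shift r ∈ ps → r ∈ ps ⊎ shift r ∈ cs
    NestP-nested (skip n) r i with NestP-nested n r i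
    ... | inj₁ j = inj₁ j
    ... | inj₂ j = inj₂ (there j)
    NestP-nested (take n) r (here refl) = inj₂ (here refl)
    NestP-nested (take {p} {cs} n) r (there i) with NestP-nested n r i
    ... | inj₁ j = inj₁ (there j)
    ... | inj₂ j with ∈-++⁻ cs j
    ...   | inj₁ j' = inj₂ (there j')
    ...   | inj₂ (here refl) = inj₁ (here refl)

    Future : List Pos → Pos → Set
    Future cs q = ∃ λ p → p ∈ cs × proj₂ p ≡ proj₂ q × proj₁ p ≤ proj₁ q

    Future-head : ∀ {p cs q} → Window (p ∷ cs) → Future (p ∷ cs) q → q ≡ p ⊎ p <P q
    Future-head w (p , here refl , refl , l) with ℕₚ.m≤n⇒m<n∨m≡n l
    ... | inj₁ l' = inj₂ (inj₁ l')
    ... | inj₂ refl = inj₁ refl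
    Future-head w (p' , there i , refl , l) with ℕₚ.m≤n⇒m<n∨m≡n l
    ... | inj₁ l' = inj₂ (<P-trans (All.lookup (AllPairs.head (sorted w)) i) (inj₁ l'))
    ... | inj₂ refl = inj₂ (All.lookup (AllPairs.head (sorted w)) i)

    Future-rotate : ∀ {p cs q} → p <P q → Future (p ∷ cs) q → Future (cs ++ shift p ∷ []) q
    Future-rotate {cs = cs} l (p , here refl , refl , l') with ℕₚ.m≤n⇒m<n∨m≡n l'
    ... | inj₁ l″ = shift p , ∈-++⁺ʳ cs (here refl) , refl , l″
    ... | inj₂ refl = ⊥-elim (<P-irrefl l)
    Future-rotate l (p' , there i , q , l') = p' , ∈-++⁺ˡ i , q , l'

    -- Greedy comparison. A skipped letter does not occur in `ps`, hence by `support` in no reduced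
    -- word of the same element, so `qs` cannot use it either. A taken position is the first one
    -- within reach: `qs` starts there, and the letter cancels, or it starts later.
    NestP-lex : ∀ {cs ps} → NestP cs ps → Window cs → Unique (map letter cs) → ∀ qs → AllPairs _<P_ qs → All
        (Future cs) qs →
      IsReduced (map letter ps) → IsReduced (map letter qs) → evalWord (map letter ps) ≡ evalWord (map letter qs)
          → LexLeq ps qs
    NestP-lex nil _ _ _ _ _ _ _ _ = tt
    NestP-lex (skip {p} {cs} {ps} n) w u qs s f r r' q = NestP-lex n (Window-tail w) (AllPairs.tail u) qs s
        (All.tabulate future) r r' q
      where
      future : ∀ {x} → x ∈ qs → Future cs x
      future i with All.lookup f i
      ... | p' , there j , a , b = p' , j , a , b
      ... | (k , j) , here refl , refl , _ = ⊥-elim (Unique[x∷xs]⇒x∉xs u (All.lookup (Nest-letters (NestP⇒Nest n))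
              (All.lookup (support (map letter qs) (map letter ps) r' (sym q)) (∈-map⁺ letter i))))
    NestP-lex (take {p} {cs} {ps} n) w u [] s f r r' q with trans (sym r) (trans (cong ℓ q) r')
    ... | ()
    NestP-lex (take {p} {cs} {ps} n) w u (x ∷ qs) (a ∷ s) (fx ∷ f) r r' q with Future-head w fx
    ... | inj₂ l = inj₁ l
    ... | inj₁ refl = inj₂ (refl , NestP-lex n (Window-rotate w)
        (subst Unique (sym (map-letter-rotate cs p)) (Unique-rotate u))
        qs s (All.tabulate λ i → Future-rotate (All.lookup a i) (All.lookup f i))
        (IsReduced-tail {letter p} {map letter ps} r) (IsReduced-tail {letter p} {map letter qs} r')
            (·-cancelˡ (gen (letter p)) q))

    record Admissible (cs ps : List Pos) : Set where
      constructor admissible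
      field
        win    : Window cs
        inc    : AllPairs _<P_ ps
        future : All (Future cs) ps
        nested : ∀ r → shift r ∈ ps → r ∈ ps ⊎ shift r ∈ cs
    open Admissible

    admissible-[] : ∀ cs → NestP cs []
    admissible-[] [] = nil
    admissible-[] (_ ∷ cs) = skip (admissible-[] cs)

    module _ (q : Pos) (ps : List Pos) (ih : ∀ cs → Admissible cs ps → NestP cs ps) where

      admissible-∷ : ∀ cs → Admissible cs (q ∷ ps) → NestP cs (q ∷ ps)
      admissible-∷ [] a with All.head (future a)
      ... | _ , () , _
      admissible-∷ (p ∷ cs) a with q ≟P p
      ... | yes refl = take (ih (cs ++ shift p ∷ []) (admissible (Window-rotate (win a)) (AllPairs.tail (inc a))
          (All.tabulate λ i → Future-rotate (p< i) (All.lookup (future a) (there i))) nested'))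
        where
        p< : ∀ {r} → r ∈ ps → p <P r
        p< = All.lookup (AllPairs.head (inc a))
        nested' : ∀ r → shift r ∈ ps → r ∈ ps ⊎ shift r ∈ cs ++ shift p ∷ []
        nested' r i with nested a r (there i)
        ... | inj₁ (here refl) = inj₂ (∈-++⁺ʳ cs (here refl))
        ... | inj₁ (there j) = inj₁ j
        ... | inj₂ (here refl) = ⊥-elim (<P-irrefl (p< i))
        ... | inj₂ (there j) = inj₂ (∈-++⁺ˡ j)
      ... | no q≢p = skip (admissible-∷ cs (admissible (Window-tail (win a)) (inc a) (All.tabulate fut) nested'))
        where
        p<q : p <P q
        p<q with Future-head (win a) (All.head (future a))
        ... | inj₁ r = ⊥-elim (q≢p r)
        ... | inj₂ r = r
        p∉ : p ∉ q ∷ ps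
        p∉ (here r) = q≢p (sym r)
        p∉ (there i) = <P-irrefl (<P-trans p<q (All.lookup (AllPairs.head (inc a)) i))
        -- Once `p` is skipped, no later copy of it is used: `nested` would lead back to `p` itself
        -- or to a later copy in the queue, which `period` excludes.
        never : ∀ n → (n + proj₁ p , proj₂ p) ∉ q ∷ ps
        never zero i = p∉ i
        never (suc n) i with nested a (n + proj₁ p , proj₂ p) i
        ... | inj₁ j = never n j
        ... | inj₂ j with period (win a) (here refl) j
        ...   | inj₁ l = ℕₚ.<⇒≱ l (s≤s (ℕₚ.m≤n+m (proj₁ p) n))
        ...   | inj₂ (_ , l) = ℕₚ.<-irrefl refl l
        fut : ∀ {r} → r ∈ q ∷ ps → Future cs r
        fut i with All.lookup (future a) i
        ... | p' , there j , b , l = p' , j , b , l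
        fut {k , _} i | _ , here refl , refl , l = ⊥-elim (never (k ∸ proj₁ p)
          (subst (λ z → (z , proj₂ p) ∈ q ∷ ps) (sym (ℕₚ.m∸n+n≡m l)) i))
        nested' : ∀ r → shift r ∈ q ∷ ps → r ∈ q ∷ ps ⊎ shift r ∈ cs
        nested' r i with nested a r i
        ... | inj₁ j = inj₁ j
        ... | inj₂ (here refl) = ⊥-elim (p∉ i)
        ... | inj₂ (there j) = inj₂ j

    -- Taking a letter rotates the queue without shortening it, hence a recursion on `ps` around the
    -- one on the queue.
    admissible⇒NestP : ∀ ps cs → Admissible cs ps → NestP cs ps
    admissible⇒NestP [] cs _ = admissible-[] cs
    admissible⇒NestP (q ∷ ps) = admissible-∷ q ps (admissible⇒NestP ps)

    initial : List Pos
    initial = tabulate (0 ,_)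

    map-letter-initial : map letter initial ≡ cw
    map-letter-initial = trans (Listₚ.map-tabulate (0 ,_) letter) (Listₚ.tabulate-lookup cw)

    initial-zero : ∀ {q} → q ∈ initial → proj₁ q ≡ 0
    initial-zero i with ∈-tabulate⁻ i
    ... | _ , refl = refl

    initial-Window : Window initial
    initial-Window = window (AllPairsₚ.tabulate⁺-< (λ l → inj₂ (refl , l)))
      (λ {p} {q} i j → subst (λ z → q <P (suc z , proj₂ p)) (sym (initial-zero i))
          (inj₁ (s≤s (ℕₚ.≤-reflexive (initial-zero j)))))

    initial-Future : ∀ q → Future initial q
    initial-Future (k , j) = (0 , j) , ∈-tabulate⁺ j , refl , z≤n

    NestWord⇒Sortable : ∀ {v} → NestWord cw v → Sortable v
    NestWord⇒Sortable {v} (us , n , r , refl) with Nest⇒NestP n initial (sym map-letter-initial)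
    ... | ps , np , refl = ps , (AllPairs⇒Linked (NestP-sorted np initial-Window) , (refl , HasSLen-ℓ r) , lex) ,
        nested-I
      where
      lex : ∀ qs → Subword qs → ReducedWordFor (map letter qs) v → LexLeq ps qs
      lex qs s (q , h) = NestP-lex np initial-Window (subst Unique (sym map-letter-initial) unique) qs
        (Linked⇒AllPairs (λ {x} {y} {z} → <P-trans {x} {y} {z}) s) (All.tabulate λ _ → initial-Future _) r
            (trans (cong ℓ q) (ℓ-unique h)) (sym q)
      nested-I : ∀ k s → I (suc k) ps s → I k ps s
      nested-I k s (j , i , q) with NestP-nested np (k , j) i
      ... | inj₁ i' = j , i' , q
      ... | inj₂ i' with initial-zero i'
      ...   | ()

    Sortable⇒NestWord : ∀ {v} → Sortable v → NestWord cw v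
    Sortable⇒NestWord (ps , (s , (refl , h) , _) , nested-I) = map letter ps
      , subst (λ z → Nest z (map letter ps)) map-letter-initial (NestP⇒Nest (admissible⇒NestP ps initial
          (admissible initial-Window (Linked⇒AllPairs (λ {x} {y} {z} → <P-trans {x} {y} {z}) s)
              (All.tabulate λ _ → initial-Future _) nst)))
      , ℓ-unique h , refl
      where
      lookup-injective : ∀ {cs : Word} → Unique cs → ∀ i j → lookup cs i ≡ lookup cs j → i ≡ j
      lookup-injective (a ∷ u) zero zero q = refl
      lookup-injective (a ∷ u) zero (suc j) q = ⊥-elim (All.lookup a (∈-lookup j) q)
      lookup-injective (a ∷ u) (suc i) zero q = ⊥-elim (All.lookup a (∈-lookup i) (sym q))
      lookup-injective (a ∷ u) (suc i) (suc j) q = cong suc (lookup-injective u i j q)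
      nst : ∀ r → shift r ∈ ps → r ∈ ps ⊎ shift r ∈ initial
      nst (k , j) i with nested-I k (lookup cw j) (j , i , refl)
      ... | j' , i' , q = inj₁ (subst (λ z → (k , z) ∈ ps) (lookup-injective unique j' j q) i')

  -- Chains in the Bruhat order and in the absolute order.

  ⋖B-ℓ : ∀ {a b} → a ⋖B b → ℓ b ≡ suc (ℓ a)
  ⋖B-ℓ (_ , n , h , h') = trans (ℓ-unique h') (cong suc (sym (ℓ-unique h)))

  ≤B-ℓ : ∀ {a b} → a ≤B b → ℓ a ≤ ℓ b
  ≤B-ℓ ε = ℕₚ.≤-refl
  ≤B-ℓ (x ◅ s) = ℕₚ.≤-trans (ℕₚ.n≤1+n _) (subst (_≤ _) (⋖B-ℓ x) (≤B-ℓ s))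

  ≤B-≢ : ∀ {a b} → a ≤B b → a ≢ b → ℓ a < ℓ b
  ≤B-≢ ε p = ⊥-elim (p refl)
  ≤B-≢ (x ◅ s) _ = subst (_≤ _) (⋖B-ℓ x) (≤B-ℓ s)

  ≤B-reflection : ∀ {a b} → a ≤B b → ℓ b ≡ suc (ℓ a) → Reflection (a ⁻¹ · b)
  ≤B-reflection ε p = ⊥-elim (ℕₚ.1+n≢n (sym p))
  ≤B-reflection {a} (((t , r , refl) , _) ◅ ε) p = subst Reflection (sym (cancelˡ a t)) r
  ≤B-reflection (x ◅ y ◅ s) p = ⊥-elim (ℕₚ.<-irrefl (sym p) (ℕₚ.<-≤-trans (s≤s (ℕₚ.≤-reflexive (sym (⋖B-ℓ x))))
    (subst (_≤ _) (⋖B-ℓ y) (≤B-ℓ s))))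

  reflection⇒⋖B : ∀ {a b} → Reflection (a ⁻¹ · b) → ℓ b ≡ suc (ℓ a) → a ⋖B b
  reflection⇒⋖B {a} {b} r p = (a ⁻¹ · b , r , sym (cancelʳ a b)) , ℓ a , ℓ-spec a , HasSLen-ℓ p

  ≤L-ℓ : ∀ {a b} → a ≤L b → ℓ a ≤ ℓ b
  ≤L-ℓ (as , bs , (_ , h) , (_ , h')) = subst₂ _≤_ (sym (ℓ-unique h')) (sym (ℓ-unique h))
    (subst (length bs ≤_) (sym (Listₚ.length-++ as)) (ℕₚ.m≤n+m _ _))

  suffix⇒≤L : ∀ {a b} → ℓ b ≡ ℓ (b · a ⁻¹) + ℓ a → a ≤L b
  suffix⇒≤L {a} {b} p with reducedWord (b · a ⁻¹) | reducedWord a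
  ... | as , la , qa | bs , lb , qb = as , bs
    , (trans (evalWord-++ as bs) (trans (cong₂ _·_ qa qb) (group (b ∷ a ∷ []) [] (x₀ ⊗ x₁ ⁻ ⊗ x₁) x₀ refl))
      , HasSLen-ℓ (trans p (sym (trans (Listₚ.length-++ as) (cong₂ _+_ la lb)))))
    , (qb , HasSLen-ℓ (sym lb))

  Saturated : ∀ {n} → (Fin (suc n) → W) → Set
  Saturated {n} f = ∀ (i : Fin n) → ℓ (f (suc i)) ≡ suc (ℓ (f (inject₁ i)))

  Saturated-ℓ : ∀ {n} (f : Fin (suc n) → W) → Saturated f → ℓ (f (fromℕ n)) ≡ ℓ (f zero) + n
  Saturated-ℓ {zero} f s = sym (ℕₚ.+-identityʳ _)
  Saturated-ℓ {suc n} f s = trans (Saturated-ℓ (f ∘ suc) (s ∘ suc))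
      (trans (cong (_+ n) (s zero)) (sym (ℕₚ.+-suc _ n)))

  increasing-ℓ : ∀ {n} (f : Fin (suc n) → W) → (∀ i → ℓ (f (inject₁ i)) < ℓ (f (suc i))) → ℓ (f zero) + n ≤ ℓ
      (f (fromℕ n))
  increasing-ℓ {zero} f s = ℕₚ.≤-reflexive (ℕₚ.+-identityʳ _)
  increasing-ℓ {suc n} f s = ℕₚ.≤-trans (subst (_≤ ℓ (f (suc zero)) + n) (sym (ℕₚ.+-suc _ n))
      (ℕₚ.+-monoˡ-≤ n (s zero)))
    (increasing-ℓ (f ∘ suc) (s ∘ suc))

  increasing⇒Saturated : ∀ {n} (f : Fin (suc n) → W) → (∀ i → ℓ (f (inject₁ i)) < ℓ (f (suc i))) →
    ℓ (f (fromℕ n)) ≤ ℓ (f zero) + n → Saturated f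
  increasing⇒Saturated {suc n} f s l = sat
    where
    first : ℓ (f (suc zero)) ≡ suc (ℓ (f zero))
    first = ℕₚ.≤-antisym (ℕₚ.+-cancelʳ-≤ n _ _ (ℕₚ.≤-trans (increasing-ℓ (f ∘ suc) (s ∘ suc))
        (subst (ℓ (f (fromℕ (suc n))) ≤_) (ℕₚ.+-suc _ n) l))) (s zero)
    sat : Saturated f
    sat zero = first
    sat (suc i) = increasing⇒Saturated (f ∘ suc) (s ∘ suc)
      (subst (ℓ (f (fromℕ (suc n))) ≤_) (trans (ℕₚ.+-suc _ n) (cong (_+ n) (sym first))) l) i

  -- For `g i = π i ⁻¹` these are the left reflections of the inverted chain; one list serves all
  -- starting points `g zero · y`.
  quotients : ∀ n → (Fin (suc n) → W) → List W
  quotients zero g = []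
  quotients (suc n) g = g (suc zero) · g zero ⁻¹ ∷ quotients n (g ∘ suc)

  quotient-· : ∀ a b y → a · b ⁻¹ · (b · y) ≡ a · y
  quotient-· a b y = group (a ∷ b ∷ y ∷ []) [] (x₀ ⊗ x₁ ⁻ ⊗ (x₁ ⊗ x₂)) (x₀ ⊗ x₂) refl

  quotients-length : ∀ n g → length (quotients n g) ≡ n
  quotients-length zero g = refl
  quotients-length (suc n) g = cong suc (quotients-length n (g ∘ suc))

  quotients-end : ∀ n g y → end (quotients n g) (g zero · y) ≡ g (fromℕ n) · y
  quotients-end zero g y = refl
  quotients-end (suc n) g y = trans (cong (end (quotients n (g ∘ suc))) (quotient-· _ _ y))
      (quotients-end n (g ∘ suc) y)

  quotients-Asc⁺ : ∀ n g y → Saturated (λ i → g i · y) → Asc (quotients n g) (g zero · y)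
  quotients-Asc⁺ zero g y s = tt
  quotients-Asc⁺ (suc n) g y s = trans (cong ℓ (quotient-· _ _ y)) (s zero)
    , subst (Asc (quotients n (g ∘ suc))) (sym (quotient-· _ _ y)) (quotients-Asc⁺ n (g ∘ suc) y (s ∘ suc))

  quotients-Asc⁻ : ∀ n g y → Asc (quotients n g) (g zero · y) → Saturated (λ i → g i · y)
  quotients-Asc⁻ (suc n) g y (l , p) zero = trans (cong ℓ (sym (quotient-· _ _ y))) l
  quotients-Asc⁻ (suc n) g y (l , p) (suc i) = quotients-Asc⁻ n (g ∘ suc) y
      (subst (Asc (quotients n (g ∘ suc))) (quotient-· _ _ y) p) i

  quotients-refl⁺ : ∀ n g → (∀ i → Reflection (g (suc i) · g (inject₁ i) ⁻¹)) → All Reflection (quotients n g)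
  quotients-refl⁺ zero g r = []
  quotients-refl⁺ (suc n) g r = r zero ∷ quotients-refl⁺ n (g ∘ suc) (r ∘ suc)

  quotients-refl⁻ : ∀ n g → All Reflection (quotients n g) → ∀ i → Reflection (g (suc i) · g (inject₁ i) ⁻¹)
  quotients-refl⁻ (suc n) g (r ∷ rs) zero = r
  quotients-refl⁻ (suc n) g (r ∷ rs) (suc i) = quotients-refl⁻ n (g ∘ suc) rs i

  quotients-On : ∀ n g y i → On (g i · y) (quotients n g) (g zero · y)
  quotients-On zero g y zero = refl
  quotients-On (suc n) g y zero = inj₁ refl
  quotients-On (suc n) g y (suc i) = inj₂ (subst (On (g (suc i) · y) (quotients n (g ∘ suc)))
      (sym (quotient-· _ _ y)) (quotients-On n (g ∘ suc) y i))

  Reflection-⁻¹ : ∀ {t} → Reflection (t ⁻¹) → Reflection t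
  Reflection-⁻¹ {t} r = subst Reflection (trans (inv-unique _ _ (Reflection-inv r)) (inv-inv t)) r

  module Translate (π g : Chain) (π≡ : ∀ i → π i ≡ g i ⁻¹) where
    ℓ-translate : ∀ x i → ℓ (x · π i) ≡ ℓ (g i · x ⁻¹)
    ℓ-translate x i = trans (sym (ℓ-inv _)) (cong ℓ (trans (cong (λ z → (x · z) ⁻¹) (π≡ i))
        (group (x ∷ g i ∷ []) [] ((x₀ ⊗ x₁ ⁻) ⁻) (x₁ ⊗ x₀ ⁻) refl)))

    Saturated⇒Asc : ∀ x → Saturated (λ i → x · π i) → Asc (quotients rank g) (g zero · x ⁻¹)
    Saturated⇒Asc x s = quotients-Asc⁺ rank g (x ⁻¹) λ i → trans (sym (ℓ-translate x (suc i)))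
        (trans (s i) (cong suc (ℓ-translate x (inject₁ i))))

    Asc⇒Saturated : ∀ x → Asc (quotients rank g) (g zero · x ⁻¹) → Saturated (λ i → x · π i)
    Asc⇒Saturated x p i = trans (ℓ-translate x (suc i)) (trans (quotients-Asc⁻ rank g (x ⁻¹) p i)
        (cong suc (sym (ℓ-translate x (inject₁ i)))))

    π-reflection : All Reflection (quotients rank g) → ∀ i → Reflection (π (inject₁ i) ⁻¹ · π (suc i))
    π-reflection rs i = Reflection-⁻¹ (subst Reflection (trans
      (group (g (suc i) ∷ g (inject₁ i) ∷ []) [] (x₀ ⊗ x₁ ⁻) ((x₁ ⁻ ⁻ ⊗ x₀ ⁻) ⁻) refl)
      (sym (cong₂ (λ a b → (a ⁻¹ · b) ⁻¹) (π≡ (inject₁ i)) (π≡ (suc i))))) (quotients-refl⁻ rank g rs i))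

    reflection-π : (∀ i → Reflection (π (inject₁ i) ⁻¹ · π (suc i))) → All Reflection (quotients rank g)
    reflection-π r = quotients-refl⁺ rank g λ i → Reflection-⁻¹ (subst Reflection (trans
      (cong₂ (λ a b → a ⁻¹ · b) (π≡ (inject₁ i)) (π≡ (suc i)))
      (group (g (suc i) ∷ g (inject₁ i) ∷ []) [] (x₁ ⁻ ⁻ ⊗ x₀ ⁻) ((x₀ ⊗ x₁ ⁻) ⁻) refl)) (r i))

  translate-quotient : ∀ x a b → (x · a) ⁻¹ · (x · b) ≡ a ⁻¹ · b
  translate-quotient x a b = group (x ∷ a ∷ b ∷ []) [] ((x₀ ⊗ x₁) ⁻ ⊗ (x₀ ⊗ x₂)) (x₁ ⁻ ⊗ x₂) refl

  module _ {c : W} {π : Chain} (π-start : π zero ≡ e) (π-end : π (fromℕ rank) ≡ c) where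

    -- Membership in `Wc⁺` fixes the total growth at `rank`, which is also the number of strict
    -- steps, so each of them raises the length by exactly one.
    Concordant⇒Saturated : (∀ i → π (inject₁ i) ≢ π (suc i)) → ∀ x → Wc⁺ c x → Concordant x π → Saturated
        (λ i → x · π i)
    Concordant⇒Saturated distinct x (n , h , h') con = increasing⇒Saturated (λ i → x · π i)
      (λ i → ≤B-≢ (con i) (λ q → distinct i (·-cancelˡ x q)))
      (ℕₚ.≤-reflexive (trans (cong (λ z → ℓ (x · z)) π-end) (trans (ℓ-unique h') (cong (_+ rank)
        (trans (sym (ℓ-unique h)) (cong ℓ (sym (trans (cong (x ·_) π-start) (identityʳ x)))))))))

    Saturated⇒Wc⁺ : ∀ x → Saturated (λ i → x · π i) → Wc⁺ c x
    Saturated⇒Wc⁺ x s = ℓ x , ℓ-spec x , HasSLen-ℓ (trans (cong (λ z → ℓ (x · z)) (sym π-end))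
      (trans (Saturated-ℓ (λ i → x · π i) s) (cong (_+ rank)
          (cong ℓ (trans (cong (x ·_) π-start) (identityʳ x))))))

    Saturated⇒Concordant : (∀ i → Reflection (π (inject₁ i) ⁻¹ · π (suc i))) → ∀ x → Saturated (λ i → x · π i) →
        Concordant x π
    Saturated⇒Concordant r x s i = reflection⇒⋖B (subst Reflection (sym (translate-quotient x _ _)) (r i)) (s i) ◅
        ε

  -- Right descents that are not steps

  step-right : ∀ {τ x} d → Reflection τ → ℓ (τ · x) ≡ suc (ℓ x) → ℓ (τ · x · gen d) < ℓ (τ · x) → ℓ (x · gen d) ≡
      suc (ℓ x) → τ · x ≡ x · gen d
  step-right {τ} {x} d r up l u with x ⁻¹ · τ · x ≟ gen d
  ... | yes q = trans (group (τ ∷ x ∷ []) [] (x₀ ⊗ x₁) (x₁ ⊗ (x₁ ⁻ ⊗ x₀ ⊗ x₁)) refl) (cong (x ·_) q)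
  ... | no ¬q = ⊥-elim (ℕₚ.<-irrefl refl (ℕₚ.<-trans
      (subst₂ _<_ u (cong ℓ (sym (assoc τ x (gen d)))) (¬η⇒> r
        (trans (η-·gen x d τ) (trans (cong₂ _xor_ (>⇒¬η (ℕₚ.≤-reflexive (sym up))) (δ-false ¬q)) refl))))
      (subst (ℓ (τ · x · gen d) <_) up l)))

  -- The mirror image of `strip`: a descent `d` that is no step passes down the whole chain, so the
  -- same reflections ascend from the shorter element `x · gen d`. This is what contradicts
  -- minimality.
  strip-right : ∀ d ts {x} → All Reflection ts → Asc ts x → ¬ Step d ts x → ℓ (end ts x · gen d) < ℓ (end ts x) →
    Asc ts (x · gen d) × ℓ x ≡ suc (ℓ (x · gen d))
  strip-right d [] {x} _ _ _ l with gen-dichotomyʳ x d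
  ... | inj₂ p = tt , p
  ... | inj₁ p = ⊥-elim (ℕₚ.<-asym l (ℕₚ.≤-reflexive (sym p)))
  strip-right d (τ ∷ ts) {x} (r ∷ rs) (up , a) ns l with strip-right d ts rs a (λ s → ns (inj₂ s)) l
  ... | a' , q with gen-dichotomyʳ x d
  ...   | inj₁ u = ⊥-elim (ns (inj₁ (step-right d r up (ℕₚ.≤-reflexive (sym q)) u)))
  ...   | inj₂ u = (trans (cong ℓ (sym (assoc τ x (gen d))))
      (ℕₚ.suc-injective (trans (sym q) (trans up (cong suc u))))
                 , subst (Asc ts) (assoc τ x (gen d)) a') , u

  Step? : ∀ d ts x → Dec (Step d ts x)
  Step? d [] x = no λ ()
  Step? d (τ ∷ ts) x = (τ · x ≟ x · gen d) ⊎-dec Step? d ts (τ · x)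

  -- Covers in the absolute order

  HasTLen-unique : ∀ {x a b} → HasTLen x a → HasTLen x b → a ≡ b
  HasTLen-unique ((ts , r , l , p) , m₁) ((ts' , r' , l' , p') , m₂) =
    ℕₚ.≤-antisym (subst (_ ≤_) l' (m₁ ts' r' p')) (subst (_ ≤_) l (m₂ ts r p))

  HasTLen-0 : ∀ {x} → HasTLen x 0 → x ≡ e
  HasTLen-0 (([] , _ , _ , p) , _) = sym p

  HasTLen-reflection : ∀ {t} → Reflection t → HasTLen t 1
  HasTLen-reflection {t} r = (t ∷ [] , r ∷ [] , refl , identityʳ t)
    , λ { [] _ p → ⊥-elim (Reflection≢e r (sym p)) ; (_ ∷ _) _ _ → s≤s z≤n }

  reflection⇒⋖T : ∀ {x y a} → HasTLen x a → HasTLen y (suc a) → Reflection (x ⁻¹ · y) → x ⋖T y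
  reflection⇒⋖T {x} {y} {a} hx hy r = (a , 1 , hx , HasTLen-reflection r , subst (HasTLen y) (ℕₚ.+-comm 1 a) hy)
    , (λ { refl → ℕₚ.1+n≢n (HasTLen-unique hy hx) }) , between
    where
    between : ∀ z → x ≤T z → z ≤T y → z ≡ x ⊎ z ≡ y
    between z (a₁ , b , h₁ , h₂ , h₃) (a₂ , d , k₁ , k₂ , k₃) with HasTLen-unique h₁ hx | HasTLen-unique k₁ h₃
    ... | refl | refl = cases b d h₂ k₂ (ℕₚ.+-cancelˡ-≡ a (b + d) 1
        (trans (sym (ℕₚ.+-assoc a b d)) (trans (HasTLen-unique k₃ hy) (ℕₚ.+-comm 1 a))))
      where
      cases : ∀ b d → HasTLen (x ⁻¹ · z) b → HasTLen (z ⁻¹ · y) d → b + d ≡ 1 → z ≡ x ⊎ z ≡ y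
      cases zero d h k _ = inj₁ (trans (sym (cancelʳ x z)) (trans (cong (x ·_) (HasTLen-0 h)) (identityʳ x)))
      cases (suc zero) zero h k _ = inj₂ (trans (sym (identityʳ z))
          (trans (cong (z ·_) (sym (HasTLen-0 k))) (cancelʳ z y)))

  prod-++ : ∀ as bs → prod (as ++ bs) ≡ prod as · prod bs
  prod-++ [] bs = sym (identityˡ _)
  prod-++ (a ∷ as) bs = trans (cong (a ·_) (prod-++ as bs)) (sym (assoc _ _ _))

  -- A shorter factorisation of the first part would, with `bs` appended, give a shorter one of the
  -- whole product.
  HasTLen-factor : ∀ {n} as bs → All Reflection as → All Reflection bs → length as + length bs ≡ n →
    (∀ ts → All Reflection ts → prod ts ≡ prod (as ++ bs) → n ≤ length ts) → HasTLen (prod as) (length as)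
  HasTLen-factor as bs ra rb l lower = (as , ra , refl , refl) , λ ts r p →
    ℕₚ.+-cancelʳ-≤ (length bs) _ _ (subst₂ _≤_ (sym l) (Listₚ.length-++ ts)
      (lower (ts ++ bs) (Allₚ.++⁺ r rb) (trans (prod-++ ts bs)
          (trans (cong (_· prod bs) p) (sym (prod-++ as bs))))))

  -- Past the end it stays put, as `List.take` does, so `at-inv` holds for every `n`.
  at : List W → ℕ → W → W
  at ts zero x = x
  at [] (suc n) x = x
  at (τ ∷ ts) (suc n) x = at ts n (τ · x)

  at-end : ∀ ts x → at ts (length ts) x ≡ end ts x
  at-end [] x = refl
  at-end (τ ∷ ts) x = at-end ts (τ · x)

  at-inv : ∀ {ts} → All Reflection ts → ∀ n x → x ⁻¹ · prod (List.take n ts) ≡ at ts n x ⁻¹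
  at-inv rs zero x = identityʳ _
  at-inv [] (suc n) x = identityʳ _
  at-inv {τ ∷ ts} (r ∷ rs) (suc n) x = trans
    (group (x ∷ prod (List.take n ts) ∷ []) (refl-involution r ∷ []) (x₀ ⁻ ⊗ (r₀ ⊗ x₁)) ((r₀ ⊗ x₀) ⁻ ⊗ x₁) refl)
        (at-inv rs n (τ · x))

  On⇒at : ∀ {v} ts x → On v ts x → ∃ λ n → n ≤ length ts × v ≡ at ts n x
  On⇒at [] x p = 0 , z≤n , p
  On⇒at (τ ∷ ts) x (inj₁ p) = 0 , z≤n , p
  On⇒at (τ ∷ ts) x (inj₂ o) with On⇒at ts (τ · x) o
  ... | n , l , p = suc n , s≤s l , p

  quotients-at : ∀ ts n x → length ts ≡ n → quotients n (λ i → at ts (toℕ i) x) ≡ ts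
  quotients-at [] zero x _ = refl
  quotients-at (τ ∷ ts) (suc n) x p = cong₂ _∷_ (group (τ ∷ x ∷ []) [] (x₀ ⊗ x₁ ⊗ x₁ ⁻) x₀ refl)
      (quotients-at ts n (τ · x) (ℕₚ.suc-injective p))

  -- The two implications

  module _ {c : W} (std : StandardCoxeter c) {cw : Word} (perm : cw ↭ allFin rank) (cw≡ : evalWord cw ≡ c ⁻¹)
      where

    unique-perm : ∀ {ws : Word} → ws ↭ allFin rank → Unique ws
    unique-perm p = Unique-↭ (↭-sym p) (allFin⁺ rank)

    length-perm : ∀ {ws : Word} → ws ↭ allFin rank → length ws ≡ rank
    length-perm p = trans (↭-length p) (Listₚ.length-tabulate _)

    absolute-length : ∀ ts → All Reflection ts → prod ts ≡ c → rank ≤ length ts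
    absolute-length ts r p = subst (_≤ length ts) (length-perm ws↭)
        (absolute-length-≥ (unique-perm ws↭) r (trans p (sym (proj₂ (proj₂ std)))))
      where ws↭ = proj₁ (proj₂ std)

    open SortingWords cw (unique-perm perm)

    Generated : W → Set
    Generated w = ∃ λ π → MaxChain c π × ∃ λ u → IsOmegaDown c π u × ∃ λ i → w ≡ u · π i

    Generated⇒NestWord : ∀ {w} → Generated w → NestWord cw (w ⁻¹)
    Generated⇒NestWord (π , (π-start , π-end , covers) , u , (wc , con , min) , i , refl) =
      subst (NestWord cw) (group (π i ∷ u ∷ []) [] (x₀ ⁻ ⊗ x₁ ⁻) ((x₁ ⊗ x₀) ⁻) refl)
        (chain-nested _ _ refl ℕₚ.≤-refl lm (π i ⁻¹ · u ⁻¹) (quotients-On rank g (u ⁻¹) i))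
      where
      g : Chain
      g j = π j ⁻¹
      open Translate π g (λ j → sym (inv-inv _))
      distinct : ∀ j → π (inject₁ j) ≢ π (suc j)
      distinct j = proj₁ (proj₂ (covers j))
      sat : Saturated (λ j → u · π j)
      sat = Concordant⇒Saturated {c} {π} π-start π-end distinct u wc con
      π-refl : ∀ j → Reflection (π (inject₁ j) ⁻¹ · π (suc j))
      π-refl j = subst Reflection (translate-quotient u _ _) (≤B-reflection (con j) (sat j))
      ts : List W
      ts = quotients rank g
      rs : All Reflection ts
      rs = reflection-π π-refl
      U : W
      U = g zero · u ⁻¹
      U≡ : U ≡ u ⁻¹
      U≡ = trans (cong (λ z → z ⁻¹ · u ⁻¹) π-start) (group (u ∷ []) [] (ε ⁻ ⊗ x₀ ⁻) (x₀ ⁻) refl)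
      asc : Asc ts U
      asc = Saturated⇒Asc u sat
      tgt : end ts U ≡ evalWord cw · U
      tgt = trans (quotients-end rank g (u ⁻¹)) (cong₂ _·_ (trans (cong _⁻¹ π-end) (sym cw≡)) (sym U≡))
      size : length ts ≡ length cw
      size = trans (quotients-length rank g) (sym (length-perm perm))
      steps : ∀ d → ℓ (U · gen d) < ℓ U → Step d ts U
      steps d l with Step? d ts U
      ... | yes s = s
      -- Otherwise `gen d · u` would be concordant with the same chain and shorter than the minimum
      -- `u`.
      ... | no ¬s = ⊥-elim (ℕₚ.<⇒≱ lt (≤L-ℓ (min x' (Saturated⇒Wc⁺ {c} {π} π-start π-end x' sat')
          (Saturated⇒Concordant {c} {π} π-start π-end π-refl x' sat'))))
        where
        x' : W
        x' = gen d · u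
        end-desc : ℓ (end ts U · gen d) < ℓ (end ts U)
        end-desc = begin-strict
          ℓ (end ts U · gen d) ≡⟨ cong (λ z → ℓ (z · gen d)) tgt ⟩
          ℓ (evalWord cw · U · gen d) ≡⟨ cong ℓ (assoc _ _ _) ⟩
          ℓ (evalWord cw · (U · gen d)) ≤⟨ ℓ-· _ _ ⟩
          ℓ (evalWord cw) + ℓ (U · gen d) ≤⟨ ℕₚ.+-monoˡ-≤ _ (ℓ≤length cw) ⟩
          length cw + ℓ (U · gen d) <⟨ ℕₚ.+-monoʳ-< (length cw) l ⟩
          length cw + ℓ U ≡⟨ ℕₚ.+-comm (length cw) _ ⟩
          ℓ U + length cw ≡⟨ cong (ℓ U +_) (sym size) ⟩
          ℓ U + length ts ≡⟨ sym (Asc-ℓ ts asc) ⟩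
          ℓ (end ts U) ∎
          where open ℕₚ.≤-Reasoning
        x'≡ : U · gen d ≡ g zero · x' ⁻¹
        x'≡ = group (g zero ∷ u ∷ []) (simple d ∷ []) (x₀ ⊗ x₁ ⁻ ⊗ r₀) (x₀ ⊗ (r₀ ⊗ x₁) ⁻) refl
        sat' : Saturated (λ j → x' · π j)
        sat' = Asc⇒Saturated x' (subst (Asc ts) x'≡ (proj₁ (strip-right d ts rs asc ¬s end-desc)))
        lt : ℓ x' < ℓ u
        lt = subst₂ _<_ (trans (cong (λ z → ℓ (z · gen d)) U≡)
            (trans (ℓ-·gen (u ⁻¹) d) (cong (λ z → ℓ (gen d · z)) (inv-inv u))))
          (trans (cong ℓ U≡) (ℓ-inv u)) l
      lm : LocallyMinimal cw ts U
      lm = record { refls = rs ; unique = unique-perm perm ; asc = asc ; size = size ; target = tgt ; steps =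
          steps }

    NestWord⇒Generated : ∀ {w} → NestWord cw (w ⁻¹) → Generated w
    NestWord⇒Generated {w} (vs , nst , red , vs≡) = π , (refl , π-end , cover) , U ⁻¹ , (wc , con , minL) , found
        (On⇒at ts U (subst (λ z → On z ts U) vs≡ on))
      where
      open MinimalChain (minimalChain (unique-perm perm) nst red) renaming (u to U)
      |ts| : length ts ≡ rank
      |ts| = trans size (length-perm perm)
      -- The chain consists of the partial products of the reflections; `g` lists their inverses,
      -- reached from `e` by left multiplication.
      π g : Chain
      π i = prod (List.take (toℕ i) ts)
      g i = at ts (toℕ i) e
      open Translate π g (λ i → trans (group (π i ∷ []) [] x₀ (ε ⁻ ⊗ x₀) refl) (at-inv refls (toℕ i) e))
      qts : quotients rank g ≡ ts
      qts = quotients-at ts rank e |ts|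
      prod-ts : prod ts ≡ c
      prod-ts = begin
        prod ts ≡⟨ cong prod (sym (Listₚ.take-all (length ts) ts ℕₚ.≤-refl)) ⟩
        prod (List.take (length ts) ts) ≡⟨ group (prod (List.take (length ts) ts) ∷ []) [] x₀ (ε ⁻ ⊗ x₀) refl ⟩
        e ⁻¹ · prod (List.take (length ts) ts) ≡⟨ at-inv refls (length ts) e ⟩
        at ts (length ts) e ⁻¹ ≡⟨ cong _⁻¹ (trans (at-end ts e) (target e)) ⟩
        (evalWord cw · e) ⁻¹ ≡⟨ cong (λ z → (z · e) ⁻¹) cw≡ ⟩
        (c ⁻¹ · e) ⁻¹ ≡⟨ group (c ∷ []) [] ((x₀ ⁻ ⊗ ε) ⁻) x₀ refl ⟩
        c ∎
        where open ≡-Reasoning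
      π-end : π (fromℕ rank) ≡ c
      π-end = trans (cong (λ k → prod (List.take k ts)) (Finₚ.toℕ-fromℕ rank))
          (trans (cong prod (Listₚ.take-all rank ts (ℕₚ.≤-reflexive |ts|))) prod-ts)
      π-refl : ∀ i → Reflection (π (inject₁ i) ⁻¹ · π (suc i))
      π-refl = π-reflection (subst (All Reflection) (sym qts) refls)
      -- Since `c` is no product of fewer than `rank` reflections, no prefix of this factorisation
      -- can be shortened.
      tlen : ∀ k → k ≤ rank → HasTLen (prod (List.take k ts)) k
      tlen k k≤ = subst (HasTLen _) len (HasTLen-factor (List.take k ts) (drop k ts) (Allₚ.take⁺ k refls)
          (Allₚ.drop⁺ k refls)
        (trans (sym (Listₚ.length-++ (List.take k ts))) (trans (cong length (Listₚ.take++drop≡id k ts)) |ts|))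
        (λ ts' r p → absolute-length ts' r (trans p (trans (cong prod (Listₚ.take++drop≡id k ts)) prod-ts))))
        where
        len : length (List.take k ts) ≡ k
        len = trans (Listₚ.length-take k ts) (ℕₚ.m≤n⇒m⊓n≡m (subst (k ≤_) (sym |ts|) k≤))
      cover : ∀ i → π (inject₁ i) ⋖T π (suc i)
      cover i = reflection⇒⋖T (subst (HasTLen (π (inject₁ i))) (Finₚ.toℕ-inject₁ i)
          (tlen _ (ℕₚ.<⇒≤ (subst (_< rank) (sym (Finₚ.toℕ-inject₁ i)) (Finₚ.toℕ<n i)))))
        (tlen (suc (toℕ i)) (Finₚ.toℕ<n i)) (π-refl i)
      Asc-at : ∀ x → Asc ts (x ⁻¹) → Saturated (λ i → x · π i)
      Asc-at x a = Asc⇒Saturated x (subst₂ Asc (sym qts) (sym (identityˡ _)) a)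
      sat : Saturated (λ i → U ⁻¹ · π i)
      sat = Asc-at (U ⁻¹) (subst (Asc ts) (sym (inv-inv U)) asc)
      wc : Wc⁺ c (U ⁻¹)
      wc = Saturated⇒Wc⁺ {c} {π} refl π-end (U ⁻¹) sat
      con : Concordant (U ⁻¹) π
      con = Saturated⇒Concordant {c} {π} refl π-end π-refl (U ⁻¹) sat
      distinct : ∀ i → π (inject₁ i) ≢ π (suc i)
      distinct i = proj₁ (proj₂ (cover i))
      -- The field `minimal` speaks of prefixes; inversion turns them into the suffixes of the left
      -- weak order.
      minL : ∀ v → Wc⁺ c v → Concordant v π → (U ⁻¹) ≤L v
      minL v wv cv = suffix⇒≤L (begin
        ℓ v ≡⟨ sym (ℓ-inv v) ⟩
        ℓ (v ⁻¹) ≡⟨ minimal (v ⁻¹) (subst₂ Asc qts (identityˡ _)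
            (Saturated⇒Asc v (Concordant⇒Saturated {c} {π} refl π-end distinct v wv cv))) ⟩
        ℓ U + ℓ (U ⁻¹ · v ⁻¹) ≡⟨ ℕₚ.+-comm (ℓ U) _ ⟩
        ℓ (U ⁻¹ · v ⁻¹) + ℓ U ≡⟨ cong₂ _+_ (trans (sym (ℓ-inv _))
            (cong ℓ (group (U ∷ v ∷ []) [] ((x₀ ⁻ ⊗ x₁ ⁻) ⁻) (x₁ ⊗ x₀ ⁻ ⁻) refl))) (sym (ℓ-inv U)) ⟩
        ℓ (v · (U ⁻¹) ⁻¹) + ℓ (U ⁻¹) ∎)
        where open ≡-Reasoning
      found : (∃ λ n → n ≤ length ts × w ⁻¹ ≡ at ts n U) → ∃ λ i → w ≡ U ⁻¹ · π i
      found (n , l , q) = i , (begin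
        w ≡⟨ sym (inv-inv w) ⟩
        (w ⁻¹) ⁻¹ ≡⟨ cong _⁻¹ q ⟩
        at ts n U ⁻¹ ≡⟨ sym (at-inv refls n U) ⟩
        U ⁻¹ · prod (List.take n ts) ≡⟨ cong (λ k → U ⁻¹ · prod (List.take k ts)) (sym (Finₚ.toℕ-fromℕ< n<)) ⟩
        U ⁻¹ · π i ∎)
        where
        open ≡-Reasoning
        n< : n < suc rank
        n< = s≤s (subst (n ≤_) |ts| l)
        i = fromℕ< n<

    generated⇔sortable : ∀ w → Generated w ⇔ Sorting.Sortable cw (w ⁻¹)
    generated⇔sortable w = mk⇔ (λ x → NestWord⇒Sortable (Generated⇒NestWord x))
        (λ s → NestWord⇒Generated (Sortable⇒NestWord s))

theorem5p12 : (C : CoxeterSystem) → let open Theory C in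
    (c : W) → StandardCoxeter c → (w : W) →
    (cw : Word) → cw ↭ allFin rank → evalWord cw ≡ c ⁻¹ →
    (∃ λ π → MaxChain c π × ∃ λ u → IsOmegaDown c π u × ∃ λ i → w ≡ u · π i)
    ⇔ Sorting.Sortable cw (w ⁻¹)
theorem5p12 C c std w cw perm cw≡ = Coxeter.generated⇔sortable C std perm cw≡ w
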